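{- Let $G_1$ be a connected graph on $n_1$ vertices, and let $G_2$ be an $r_2$-regular graph with $r_2\ge1$, on $n_2$ vertices and $m_2$ edges, with adjacency matrix $A_{G_2}$ and Laplacian eigenvalues $\mu_1(G_2),\dots,\mu_{n_2}(G_2)$. Let $C=L_{G_2}+r_2I_{n_2}$. Then \begin{align*} Kf(G_1\star G_2)&=n_1(1+n_2+m_2)\Big[\frac{n_1m_2}{3}+\frac{n_1}{3}\Big(\mathrm{tr}(C^{ -1}A_{G_2})+r_2\sum_{i=1}^{n_2}\frac{1}{\mu_i(G_2)+r_2}\Big)+3n_1\sum_{i=1}^{n_2}\frac{1}{\mu_i(G_2)+r_2}\\ &\qquad+\frac{m_2+n_2+1}{n_1}Kf(G_1)\Big]-\frac{n_1m_2r_2+n_1n_2(r_2+3)^2}{3r_2}. \end{align*}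
   Context: All graphs are simple and undirected; $L_G=D_G-A_G$ is the Laplacian matrix. The resistance distance between two vertices of a connected graph is the effective resistance between them when every edge is a unit resistor, and the Kirchhoff index $Kf(G)$ of a connected graph is the sum of resistance distances over all unordered pairs of distinct vertices. The corona-edge of the subdivision graph $G_1\star G_2$ is obtained from $G_1$ and $|V(G_1)|$ vertex-disjoint copies of the subdivision graph $S(G_2)$ (the graph obtained from $G_2$ by inserting a new vertex into every edge; the inserted vertices are the subdivision vertices) by joining the $i$-th vertex of $G_1$ to every subdivision vertex of the $i$-th copy. It has $n_1(1+n_2+m_2)$ vertices. -}

module Defs where

open import Level using (_⊔_)
open import Algebra.Apartness using (HeytingField; HeytingCommutativeRing)
open import Algebra.Bundles using (CommutativeRing)
import Algebra.Definitions.RawMonoid as RawMonoidDefs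
import Algebra.Properties.CommutativeMonoid.Sum as Sum
open import Data.Bool.Base using (Bool; true; false; if_then_else_; _∧_; _∨_)
open import Data.Bool.Properties using (∧-zeroʳ) renaming (_≟_ to _≟ᵇ_)
open import Data.Fin.Base using (Fin; zero; suc; splitAt; remQuot; punchIn)
open import Data.Fin.Properties using (_≟_; _<?_)
open import Data.Fin.Subset using (∣_∣)
open import Data.List.Base using (List; allFin; cartesianProduct; filter; length; lookup)
open import Data.Nat.Base as ℕ using (ℕ; zero; suc; NonZero)
open import Data.Product.Base using (_×_; _,_; proj₁; Σ-syntax; ∃-syntax)
open import Data.Sum.Base as Either using (_⊎_; inj₁; inj₂)
open import Data.Vec.Base using (tabulate)
open import Relation.Binary.Construct.Closure.ReflexiveTransitive using (Star)
open import Relation.Binary.PropositionalEquality using (_≡_; refl; sym; cong; cong₂)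
open import Relation.Nullary using (yes; no; contradiction)
open import Relation.Nullary.Decidable using (⌊_⌋; _×-dec_)

------------------------------------------------------------------------
-- Graphs

record Graph (n : ℕ) : Set where
  field
    adj        : Fin n → Fin n → Bool
    adj-sym    : ∀ u v → adj u v ≡ adj v u
    adj-irrefl : ∀ v → adj v v ≡ false

open Graph public

module _ {n : ℕ} (G : Graph n) where

  Adjacent : Fin n → Fin n → Set
  Adjacent u v = adj G u v ≡ true

  Connected : Set
  Connected = ∀ u v → Star Adjacent u v

  degree : Fin n → ℕ
  degree v = ∣ tabulate (adj G v) ∣

  Regular : ℕ → Set
  Regular r = ∀ v → degree v ≡ r

  -- Each edge occurs exactly once, as the pair (u , v) with u < v.
  edges : List (Fin n × Fin n)
  edges = filter (λ (u , v) → (u <? v) ×-dec (adj G u v ≟ᵇ true))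
                 (cartesianProduct (allFin n) (allFin n))

  size : ℕ
  size = length edges

infix 4 _==_

_==_ : ∀ {n} → Fin n → Fin n → Bool
i == j = ⌊ i ≟ j ⌋

==-sym : ∀ {n} (i j : Fin n) → (i == j) ≡ (j == i)
==-sym i j with i ≟ j | j ≟ i
... | yes _ | yes _ = refl
... | no  _ | no  _ = refl
... | yes p | no  q = contradiction (sym p) q
... | no  p | yes q = contradiction (sym q) p

------------------------------------------------------------------------
-- The subdivision graph: inj₁ marks the vertices of G, and inj₂ e the
-- vertex inserted into the e-th edge.

module _ {n : ℕ} (G : Graph n) where

  SubdivisionVertex : Set
  SubdivisionVertex = Fin n ⊎ Fin (size G)

  incident : Fin n → Fin (size G) → Bool
  incident v e = let (a , b) = lookup (edges G) e in (v == a) ∨ (v == b)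

  subdivisionAdj : SubdivisionVertex → SubdivisionVertex → Bool
  subdivisionAdj (inj₁ v) (inj₂ e) = incident v e
  subdivisionAdj (inj₂ e) (inj₁ v) = incident v e
  subdivisionAdj (inj₁ _) (inj₁ _) = false
  subdivisionAdj (inj₂ _) (inj₂ _) = false

  subdivisionAdj-sym : ∀ s t → subdivisionAdj s t ≡ subdivisionAdj t s
  subdivisionAdj-sym (inj₁ _) (inj₁ _) = refl
  subdivisionAdj-sym (inj₁ _) (inj₂ _) = refl
  subdivisionAdj-sym (inj₂ _) (inj₁ _) = refl
  subdivisionAdj-sym (inj₂ _) (inj₂ _) = refl

  subdivisionAdj-irrefl : ∀ s → subdivisionAdj s s ≡ false
  subdivisionAdj-irrefl (inj₁ _) = refl
  subdivisionAdj-irrefl (inj₂ _) = refl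

  subdivision : Graph (n ℕ.+ size G)
  subdivision = record
    { adj        = λ x y → subdivisionAdj (splitAt n x) (splitAt n y)
    ; adj-sym    = λ x y → subdivisionAdj-sym (splitAt n x) (splitAt n y)
    ; adj-irrefl = λ x → subdivisionAdj-irrefl (splitAt n x)
    }

  isSubdivisionVertex : Fin (n ℕ.+ size G) → Bool
  isSubdivisionVertex x with splitAt n x
  ... | inj₁ _ = false
  ... | inj₂ _ = true

------------------------------------------------------------------------
-- Corona-edge of the subdivision graph: inj₁ i is the i-th vertex of G₁,
-- and inj₂ (i , x) the vertex x of the i-th copy of the subdivision of G₂.

module _ {n₁ n₂ : ℕ} (G₁ : Graph n₁) (G₂ : Graph n₂) where

  private
    N : ℕ
    N = n₂ ℕ.+ size G₂

  CoronaVertex : Set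
  CoronaVertex = Fin n₁ ⊎ (Fin n₁ × Fin N)

  coronaVertex : Fin (n₁ ℕ.+ n₁ ℕ.* N) → CoronaVertex
  coronaVertex x = Either.map₂ (remQuot {n₁} N) (splitAt n₁ x)

  coronaAdj : CoronaVertex → CoronaVertex → Bool
  coronaAdj (inj₁ i)       (inj₁ j)       = adj G₁ i j
  coronaAdj (inj₁ i)       (inj₂ (j , y)) = (i == j) ∧ isSubdivisionVertex G₂ y
  coronaAdj (inj₂ (i , x)) (inj₁ j)       = (j == i) ∧ isSubdivisionVertex G₂ x
  coronaAdj (inj₂ (i , x)) (inj₂ (j , y)) = (i == j) ∧ adj (subdivision G₂) x y

  coronaAdj-sym : ∀ s t → coronaAdj s t ≡ coronaAdj t s
  coronaAdj-sym (inj₁ i)       (inj₁ j)       = adj-sym G₁ i j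
  coronaAdj-sym (inj₁ _)       (inj₂ _)       = refl
  coronaAdj-sym (inj₂ _)       (inj₁ _)       = refl
  coronaAdj-sym (inj₂ (i , x)) (inj₂ (j , y)) =
    cong₂ _∧_ (==-sym i j) (adj-sym (subdivision G₂) x y)

  coronaAdj-irrefl : ∀ s → coronaAdj s s ≡ false
  coronaAdj-irrefl (inj₁ i) = adj-irrefl G₁ i
  coronaAdj-irrefl (inj₂ (i , x))
    rewrite adj-irrefl (subdivision G₂) x = ∧-zeroʳ (i == i)

  infixl 7 _⋆_

  _⋆_ : Graph (n₁ ℕ.+ n₁ ℕ.* N)
  _⋆_ = record
    { adj        = λ x y → coronaAdj (coronaVertex x) (coronaVertex y)
    ; adj-sym    = λ x y → coronaAdj-sym (coronaVertex x) (coronaVertex y)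
    ; adj-irrefl = λ x → coronaAdj-irrefl (coronaVertex x)
    }

------------------------------------------------------------------------
-- Scalars: the real numbers enter only as a field of characteristic zero.

fieldRing : ∀ {c ℓ₁ ℓ₂} → HeytingField c ℓ₁ ℓ₂ → CommutativeRing c ℓ₁
fieldRing K =
  HeytingCommutativeRing.commutativeRing (HeytingField.heytingCommutativeRing K)

CharacteristicZero : ∀ {c ℓ₁ ℓ₂} → HeytingField c ℓ₁ ℓ₂ → Set ℓ₂
CharacteristicZero K = ∀ n → .{{_ : NonZero n}} → (n ×ₙ 1#) # 0#
  where
  open HeytingField K using (_#_; 0#; 1#)
  open RawMonoidDefs (CommutativeRing.+-rawMonoid (fieldRing K))
    renaming (_×_ to _×ₙ_)

module Scalars {c ℓ₁ ℓ₂} (K : HeytingField c ℓ₁ ℓ₂)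
               (char0 : CharacteristicZero K) where

  open HeytingField K public
    using (Carrier; _≈_; _#_; _+_; _*_; -_; _-_; 0#; 1#)
  open HeytingField K using (#⇒invertible)
  open CommutativeRing (fieldRing K)
    using (+-rawMonoid; +-commutativeMonoid; *-commutativeMonoid)

  open Sum +-commutativeMonoid public using (sum; sum-syntax)
  open Sum *-commutativeMonoid public using () renaming (sum to product)

  fromℕ : ℕ → Carrier
  fromℕ n = n ×ₙ 1#
    where open RawMonoidDefs +-rawMonoid renaming (_×_ to _×ₙ_)

  inverse : ∀ {x} → x # 0# → Carrier
  inverse x#0 = proj₁ (#⇒invertible x#0)

  infixl 7 _÷_

  _÷_ : Carrier → ∀ n → .{{_ : NonZero n}} → Carrier
  x ÷ n = x * inverse (char0 n)

  ----------------------------------------------------------------------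
  -- Matrices

  Matrix : ℕ → Set c
  Matrix n = Fin n → Fin n → Carrier

  infix  4 _≋_
  infixl 6 _⊞_ _⊟_
  infixl 7 _⊡_ _·_

  _≋_ : ∀ {n} → Matrix n → Matrix n → Set ℓ₁
  A ≋ B = ∀ i j → A i j ≈ B i j

  diagonal : ∀ {n} → (Fin n → Carrier) → Matrix n
  diagonal d i j = if i == j then d i else 0#

  𝕀 : ∀ {n} → Matrix n
  𝕀 = diagonal λ _ → 1#

  _⊞_ _⊟_ _⊡_ : ∀ {n} → Matrix n → Matrix n → Matrix n
  (A ⊞ B) i j = A i j + B i j
  (A ⊟ B) i j = A i j - B i j
  _⊡_ {n} A B i j = ∑[ k < n ] (A i k * B k j)

  _·_ : ∀ {n} → Carrier → Matrix n → Matrix n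
  (x · A) i j = x * A i j

  tr : ∀ {n} → Matrix n → Carrier
  tr A = sum λ i → A i i

  IsInverseOf : ∀ {n} → Matrix n → Matrix n → Set ℓ₁
  IsInverseOf A B = (A ⊡ B ≋ 𝕀) × (B ⊡ A ≋ 𝕀)

  sign : ∀ {n} → Fin n → Carrier
  sign zero    = 1#
  sign (suc i) = - sign i

  -- Laplace expansion along the first row.
  det : ∀ {n} → Matrix n → Carrier
  det {zero}  A = 1#
  det {suc n} A =
    ∑[ j < suc n ] (sign j * A zero j * det (λ i k → A (suc i) (punchIn j k)))

  -- μ lists the eigenvalues of A with multiplicity: det (x I - A) is the
  -- product of the x - μᵢ.  K is infinite, so an identity of polynomial
  -- functions on K is an identity of polynomials.
  IsSpectrumOf : ∀ {n} → (Fin n → Carrier) → Matrix n → Set (c ⊔ ℓ₁)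
  IsSpectrumOf μ A = ∀ x → det (x · 𝕀 ⊟ A) ≈ product (λ i → x - μ i)

  ----------------------------------------------------------------------
  -- Matrices of a graph, resistance distance and Kirchhoff index

  module _ {n : ℕ} (G : Graph n) where

    adjacency : Matrix n
    adjacency u v = if adj G u v then 1# else 0#

    laplacian : Matrix n
    laplacian = diagonal (λ v → fromℕ (degree G v)) ⊟ adjacency

    -- φ is a potential for a unit current entering at u and leaving at v.
    -- By Ohm's law the current along a unit resistor x—y is φ x - φ y, and
    -- by Kirchhoff's law the net current out of x is what is injected there.
    IsUnitPotential : Fin n → Fin n → (Fin n → Carrier) → Set ℓ₁
    IsUnitPotential u v φ = ∀ x →
      ∑[ y < n ] (if adj G x y then φ x - φ y else 0#) ≈ 𝕀 x u - 𝕀 x v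

    -- Potentials exist, and all of them drop by ρ from u to v; in
    -- particular ρ is determined by G, u and v.
    IsResistanceDistance : Fin n → Fin n → Carrier → Set (c ⊔ ℓ₁)
    IsResistanceDistance u v ρ =
      (∃[ φ ] IsUnitPotential u v φ) ×
      (∀ φ → IsUnitPotential u v φ → φ u - φ v ≈ ρ)

    IsKirchhoffIndex : Carrier → Set (c ⊔ ℓ₁)
    IsKirchhoffIndex κ = Σ[ R ∈ Matrix n ]
      (∀ u v → IsResistanceDistance u v (R u v)) ×
      κ ≈ ∑[ u < n ] ∑[ v < n ] (if ⌊ u <? v ⌋ then R u v else 0#)

-- If X is a matrix with L X = I - p 1ᵀ, where L is the Laplacian of a connected
-- graph on n vertices, then the potentials X (e_u - e_v) show that the Kirchhoff
-- index is n tr X - 1ᵀ X 1.  In G₁ ⋆ G₂ every vertex of G₁ separates its copy of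
-- the subdivision from the rest, so X is the sum of a grounded inverse X₁ of the
-- Laplacian of G₁, extended constantly to the copies, and of one block Z per copy,
-- the inverse of the Laplacian of the copy grounded at its root.  As B Bᵀ = r I + A
-- for the incidence matrix B of G₂, Z is expressed through the inverse of
-- C = L + r I = 2 r I - A.
--
-- The matrices C and L(G₁) without its first row and column belong to networks
-- grounded with positive rational conductances.  Eliminating one node after the
-- other (a star-mesh transformation) keeps the conductances rational, so that no
-- order on K is needed to see that the pivots are invertible; this yields both the
-- inverses and det C # 0.  Finally the sum of the 1 / (μᵢ + r) is tr C⁻¹ by
-- comparison of the linear terms in t of det (- t I - C) = ∏ (- t - r - μᵢ).

module Submission where

open import Defs
open import Algebra.Apartness using (HeytingField)
open import Data.Fin.Base using (Fin)
open import Data.Nat.Base as ℕ using (ℕ; NonZero)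
open import Data.Nat.Properties using (m*n≢0)
open import Data.Product.Base using (Σ-syntax; ∃-syntax; _×_)
open import Algebra.Bundles using (CommutativeRing)
import Algebra.Apartness.Properties.HeytingCommutativeRing as HeytingProperties
import Algebra.Properties.Ring as RingProperties
import Algebra.Properties.Semiring.Mult as Mult
import Algebra.Properties.Semiring.Sum as SumProperties
import Algebra.Solver.Ring as RingSolver
open import Algebra.Solver.Ring.AlmostCommutativeRing
  using (fromCommutativeRing; _-Raw-AlmostCommutative⟶_)
open import Data.Bool.Base using (Bool; true; false; if_then_else_; _∧_)
open import Data.Bool.Properties using () renaming (_≟_ to _≟ᵇ_)
open import Data.Fin.Base
  using (zero; suc; _<_; punchIn; _↑ˡ_; _↑ʳ_; combine; remQuot; splitAt)
open import Data.Fin.Properties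
  using ( _≟_; _<?_; suc-injective; <-cmp; <-asym; <-irrefl; splitAt-↑ˡ; splitAt-↑ʳ
        ; splitAt⁻¹-↑ˡ; splitAt⁻¹-↑ʳ; remQuot-combine; combine-remQuot )
open import Data.Fin.Subset using (∣_∣)
open import Data.Integer.Base as ℤ using (ℤ; +_; -[1+_]; _⊖_)
import Data.Integer.Properties as ℤₚ
open import Data.List.Base as List
  using (List; []; _++_; allFin; cartesianProduct; filter; foldr; length; lookup; map)
open import Data.List.Membership.Propositional.Properties using (∈-lookup)
import Data.List.Relation.Unary.All as All
open import Data.List.Relation.Unary.All.Properties using (all-filter)
open import Data.Maybe.Base using (Maybe; just; nothing)
open import Data.Nat.Base using (zero; suc)
import Data.Nat.Properties as ℕₚ
open import Data.Product.Base using (_,_; proj₁; proj₂)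
open import Data.Sum.Base as Sum using (_⊎_; inj₁; inj₂)
open import Data.Vec.Base using (tabulate)
open import Data.Vec.Functional using (updateAt; _∷_; tail)
open import Data.Vec.Functional.Properties using (updateAt-updates; updateAt-minimal)
open import Function.Base using (_∘_; const)
open import Level using (Lift; lift; _⊔_)
open import Relation.Binary.Construct.Closure.ReflexiveTransitive using (Star; _◅_)
open import Relation.Binary.Definitions using (tri<; tri≈; tri>)
open import Relation.Binary.PropositionalEquality as ≡ using (_≡_; _≢_)
open import Relation.Nullary using (Dec; does; yes; no; contradiction)
open import Relation.Nullary.Decidable using (⌊_⌋; _×-dec_; isYes≗does)

-- The 3 of the formula is the degree of a subdivision vertex in the corona: two ends and the root
-- of its copy. Eliminating these vertices from the grounded Laplacian of a copy leaves r I - (1/3)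
-- B Bᵀ = (1/3) C on the vertices of G₂, which explains the blocks of Z. With M = 1 + n₂ + m₂, the
-- formula is M² Kf(G₁), coming from X₁, plus n₁² M tr Z, minus n₁ times the sum of all entries of
-- Z, which is the subtracted fraction. For that sum the edge rows of Z need not be computed: a unit
-- current entering a copy leaves through its root, whose edges have unit conductance, so the
-- potentials of the subdivision vertices add up to 1. Apartness is the obstacle. In a Heyting field
-- x # 0 has to be shown by way of an inverse, and equality is not decided, so elimination cannot
-- search for a pivot; positive conductances guarantee each pivot in advance. Likewise, linear
-- coefficients cannot be compared by dividing by an arbitrary t: the factor t is cancelled at the
-- positive integers, where characteristic zero makes it invertible, and a polynomial that vanishes
-- there vanishes everywhere.

module Proof {c ℓ₁ ℓ₂} (K : HeytingField c ℓ₁ ℓ₂) (char0 : CharacteristicZero K) where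

  open Scalars K char0
  open HeytingField K using (#⇒invertible; heytingCommutativeRing)
  open CommutativeRing (fieldRing K)
    using ( refl; sym; trans; reflexive; setoid; semiring; ring
          ; +-cong; +-congˡ; +-congʳ; +-identityˡ; +-identityʳ; +-assoc; +-comm
          ; -‿cong; -‿inverseʳ
          ; *-cong; *-congˡ; *-congʳ; *-identityˡ; *-identityʳ; *-assoc; *-comm
          ; distribˡ; distribʳ; zeroˡ; zeroʳ )
  open HeytingProperties heytingCommutativeRing
    using (x-0≈x; 1#0; x#0y#0→xy#0; #-congʳ; invertibleˡ⇒#)
  open RingProperties ring using (-0#≈0#; -‿distribˡ-*; -‿distribʳ-*; -‿involutive; -‿+-comm)
  open Mult semiring using (×-homo-+; ×1-homo-*)
  open SumProperties semiring
    using (sum-cong-≋; ∑-distrib-+; ∑-comm; sum-replicate-zero; *-distribˡ-sum; *-distribʳ-sum)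
  open import Relation.Binary.Reasoning.Setoid setoid

  -- The integers inside K, as coefficients of the ring solver

  fromℕ-+ : ∀ m n → fromℕ (m ℕ.+ n) ≈ fromℕ m + fromℕ n
  fromℕ-+ = ×-homo-+ 1#

  fromℕ-* : ∀ m n → fromℕ (m ℕ.* n) ≈ fromℕ m * fromℕ n
  fromℕ-* = ×1-homo-*

  -- The value at 1 is 1# itself rather than 1# + 0#, so that the solver's
  -- constant con (+ 1) denotes 1#.
  fromℤ : ℤ → Carrier
  fromℤ (+ 0)           = 0#
  fromℤ (+ 1)           = 1#
  fromℤ (+ suc (suc n)) = fromℕ (suc (suc n))
  fromℤ -[1+ n ]        = - fromℕ (suc n)

  fromℤ-+ℕ : ∀ n → fromℤ (+ n) ≈ fromℕ n
  fromℤ-+ℕ 0             = refl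
  fromℤ-+ℕ 1             = sym (+-identityʳ 1#)
  fromℤ-+ℕ (suc (suc n)) = refl

  -- Rearranged by hand, because the ring solver is available only once the homomorphism built from
  -- this lemma exists.
  fromℤ-⊖ : ∀ m n → fromℤ (m ⊖ n) ≈ fromℕ m - fromℕ n
  fromℤ-⊖ m zero = begin
    fromℤ (m ⊖ 0)   ≈⟨ fromℤ-+ℕ m ⟩
    fromℕ m         ≈⟨ x-0≈x (fromℕ m) ⟨
    fromℕ m - 0#    ∎
  fromℤ-⊖ zero (suc n) = sym (+-identityˡ _)
  fromℤ-⊖ (suc m) (suc n) = begin
    fromℤ (suc m ⊖ suc n)                ≡⟨ ≡.cong fromℤ (ℤₚ.[1+m]⊖[1+n]≡m⊖n m n) ⟩
    fromℤ (m ⊖ n)                        ≈⟨ fromℤ-⊖ m n ⟩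
    fromℕ m - fromℕ n                    ≈⟨ +-identityˡ _ ⟨
    0# + (fromℕ m - fromℕ n)             ≈⟨ +-congʳ (-‿inverseʳ 1#) ⟨
    (1# - 1#) + (fromℕ m - fromℕ n)      ≈⟨ +-assoc _ _ _ ⟩
    1# + (- 1# + (fromℕ m - fromℕ n))    ≈⟨ +-congˡ (+-assoc _ _ _) ⟨
    1# + ((- 1# + fromℕ m) - fromℕ n)    ≈⟨ +-congˡ (+-congʳ (+-comm _ _)) ⟩
    1# + ((fromℕ m - 1#) - fromℕ n)      ≈⟨ +-congˡ (+-assoc _ _ _) ⟩
    1# + (fromℕ m + (- 1# - fromℕ n))    ≈⟨ +-assoc _ _ _ ⟨
    1# + fromℕ m + (- 1# - fromℕ n)      ≈⟨ +-congˡ (-‿+-comm 1# (fromℕ n)) ⟩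
    1# + fromℕ m - (1# + fromℕ n)        ∎

  fromℤ-neg : ∀ i → fromℤ (ℤ.- i) ≈ - fromℤ i
  fromℤ-neg (+ 0)           = sym -0#≈0#
  fromℤ-neg (+ 1)           = -‿cong (+-identityʳ 1#)
  fromℤ-neg (+ suc (suc n)) = refl
  fromℤ-neg -[1+ n ]        = trans (fromℤ-+ℕ (suc n)) (sym (-‿involutive _))

  fromℤ-+ : ∀ i j → fromℤ (i ℤ.+ j) ≈ fromℤ i + fromℤ j
  fromℤ-+ (+ m) (+ n) = begin
    fromℤ (+ (m ℕ.+ n))         ≈⟨ fromℤ-+ℕ (m ℕ.+ n) ⟩
    fromℕ (m ℕ.+ n)             ≈⟨ fromℕ-+ m n ⟩
    fromℕ m + fromℕ n           ≈⟨ +-cong (fromℤ-+ℕ m) (fromℤ-+ℕ n) ⟨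
    fromℤ (+ m) + fromℤ (+ n)   ∎
  fromℤ-+ (+ m) -[1+ n ] = trans (fromℤ-⊖ m (suc n)) (+-congʳ (sym (fromℤ-+ℕ m)))
  fromℤ-+ -[1+ m ] (+ n) = begin
    fromℤ (n ⊖ suc m)            ≈⟨ fromℤ-⊖ n (suc m) ⟩
    fromℕ n - fromℕ (suc m)      ≈⟨ +-comm _ _ ⟩
    - fromℕ (suc m) + fromℕ n    ≈⟨ +-congˡ (fromℤ-+ℕ n) ⟨
    - fromℕ (suc m) + fromℤ (+ n) ∎
  fromℤ-+ -[1+ m ] -[1+ n ] = begin
    - fromℕ (suc (suc (m ℕ.+ n)))         ≡⟨ ≡.cong (λ k → - fromℕ k) (≡.cong suc (≡.sym (ℕₚ.+-suc m n))) ⟩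
    - fromℕ (suc m ℕ.+ suc n)             ≈⟨ -‿cong (fromℕ-+ (suc m) (suc n)) ⟩
    - (fromℕ (suc m) + fromℕ (suc n))     ≈⟨ -‿+-comm _ _ ⟨
    - fromℕ (suc m) - fromℕ (suc n)       ∎

  fromℤ-*ℕ : ∀ m j → fromℤ (+ m ℤ.* j) ≈ fromℕ m * fromℤ j
  fromℤ-*ℕ zero    j = sym (zeroˡ (fromℤ j))
  fromℤ-*ℕ (suc m) j = begin
    fromℤ (+ suc m ℤ.* j)            ≡⟨ ≡.cong fromℤ (ℤₚ.suc-* (+ m) j) ⟩
    fromℤ (j ℤ.+ + m ℤ.* j)          ≈⟨ fromℤ-+ j (+ m ℤ.* j) ⟩
    fromℤ j + fromℤ (+ m ℤ.* j)      ≈⟨ +-cong (sym (*-identityˡ _)) (fromℤ-*ℕ m j) ⟩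
    1# * fromℤ j + fromℕ m * fromℤ j ≈⟨ distribʳ _ _ _ ⟨
    fromℕ (suc m) * fromℤ j          ∎

  fromℤ-* : ∀ i j → fromℤ (i ℤ.* j) ≈ fromℤ i * fromℤ j
  fromℤ-* (+ m) j = trans (fromℤ-*ℕ m j) (*-congʳ (sym (fromℤ-+ℕ m)))
  fromℤ-* -[1+ m ] j = begin
    fromℤ (-[1+ m ] ℤ.* j)         ≡⟨ ≡.cong fromℤ (ℤₚ.neg-distribˡ-* (+ suc m) j) ⟨
    fromℤ (ℤ.- (+ suc m ℤ.* j))    ≈⟨ fromℤ-neg (+ suc m ℤ.* j) ⟩
    - fromℤ (+ suc m ℤ.* j)        ≈⟨ -‿cong (fromℤ-*ℕ (suc m) j) ⟩
    - (fromℕ (suc m) * fromℤ j)    ≈⟨ -‿distribˡ-* _ _ ⟩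
    - fromℕ (suc m) * fromℤ j      ∎

  fromℤ-homomorphism :
    ℤ.+-*-rawRing -Raw-AlmostCommutative⟶ fromCommutativeRing (fieldRing K)
  fromℤ-homomorphism = record
    { ⟦_⟧    = fromℤ
    ; +-homo = fromℤ-+
    ; *-homo = fromℤ-*
    ; -‿homo = fromℤ-neg
    ; 0-homo = refl
    ; 1-homo = refl
    }

  -- Coefficients are compared as integers, since equality in K cannot be decided.
  fromℤ-≟ : ∀ i j → Maybe (fromℤ i ≈ fromℤ j)
  fromℤ-≟ i j with i ℤₚ.≟ j
  ... | yes i≡j = just (reflexive (≡.cong fromℤ i≡j))
  ... | no  _   = nothing

  open RingSolver ℤ.+-*-rawRing (fromCommutativeRing (fieldRing K)) fromℤ-homomorphism fromℤ-≟
    using (solve; _:=_; _:+_; _:-_; _:*_; :-_; con)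


  -- Inverses, finite sums and the identity matrix

  inverse-* : ∀ {x} (x#0 : x # 0#) → inverse x#0 * x ≈ 1#
  inverse-* x#0 = trans (*-congˡ (sym (x-0≈x _))) (proj₁ (proj₂ (#⇒invertible x#0)))

  invertible : ∀ {x y} → y * x ≈ 1# → x # 0#
  invertible {x} {y} yx≈1 = invertibleˡ⇒# (y , trans (*-congˡ (x-0≈x x)) yx≈1)

  -- `sum-cong-≋` with both families explicit, for uses where unification does not recover them.
  sum-cong : ∀ {n} (f g : Fin n → Carrier) → (∀ i → f i ≈ g i) → sum f ≈ sum g
  sum-cong _ _ = sum-cong-≋

  sum-zero : ∀ {n} {f : Fin n → Carrier} → (∀ i → f i ≈ 0#) → sum f ≈ 0#
  sum-zero {n} f≈0 = trans (sum-cong-≋ f≈0) (sum-replicate-zero n)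

  sum-neg : ∀ {n} (f : Fin n → Carrier) → ∑[ i < n ] (- f i) ≈ - sum f
  sum-neg {zero}  f = sym -0#≈0#
  sum-neg {suc n} f = trans (+-congˡ (sum-neg (f ∘ suc))) (-‿+-comm _ _)

  sum-sub : ∀ {n} (f g : Fin n → Carrier) → ∑[ i < n ] (f i - g i) ≈ sum f - sum g
  sum-sub f g = trans (∑-distrib-+ f (λ i → - g i)) (+-congˡ (sum-neg g))

  sum-const : ∀ {n} x → ∑[ i < n ] x ≈ fromℕ n * x
  sum-const {zero}  x = sym (zeroˡ x)
  sum-const {suc n} x = begin
    x + ∑[ i < n ] x        ≈⟨ +-cong (sym (*-identityˡ x)) (sum-const {n} x) ⟩
    1# * x + fromℕ n * x    ≈⟨ distribʳ x 1# (fromℕ n) ⟨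
    fromℕ (suc n) * x       ∎

  indicator : Bool → Carrier
  indicator b = if b then 1# else 0#

  if≈indicator* : ∀ b x → (if b then x else 0#) ≈ indicator b * x
  if≈indicator* true  x = sym (*-identityˡ x)
  if≈indicator* false x = sym (zeroˡ x)

  indicator-∧ : ∀ a b → indicator (a ∧ b) ≈ indicator a * indicator b
  indicator-∧ true  b = sym (*-identityˡ _)
  indicator-∧ false b = sym (zeroˡ _)

  𝕀-sym : ∀ {n} (i j : Fin n) → 𝕀 i j ≈ 𝕀 j i
  𝕀-sym i j = reflexive (≡.cong indicator (==-sym i j))

  𝕀-diag : ∀ {n} (i : Fin n) → 𝕀 i i ≈ 1#
  𝕀-diag i with i ≟ i
  ... | yes _   = refl
  ... | no  i≢i = contradiction ≡.refl i≢i

  𝕀-off : ∀ {n} {i j : Fin n} → i ≢ j → 𝕀 i j ≈ 0#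
  𝕀-off {i = i} {j} i≢j with i ≟ j
  ... | yes i≡j = contradiction i≡j i≢j
  ... | no  _   = refl

  𝕀-suc : ∀ {n} (i j : Fin n) → 𝕀 (suc i) (suc j) ≈ 𝕀 i j
  𝕀-suc i j with i ≟ j
  ... | yes _ = refl
  ... | no  _ = refl

  sum-𝕀 : ∀ {n} i (f : Fin n → Carrier) → ∑[ j < n ] (𝕀 i j * f j) ≈ f i
  sum-𝕀 zero f = begin
    1# * f zero + ∑[ j < _ ] (0# * f (suc j)) ≈⟨ +-cong (*-identityˡ _) (sum-zero (λ j → zeroˡ (f (suc j)))) ⟩
    f zero + 0#                               ≈⟨ +-identityʳ _ ⟩
    f zero                                    ∎
  sum-𝕀 (suc i) f = begin
    0# * f zero + ∑[ j < _ ] (𝕀 (suc i) (suc j) * f (suc j))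
      ≈⟨ +-cong (zeroˡ _) (sum-cong-≋ (λ j → *-congʳ (𝕀-suc i j))) ⟩
    0# + ∑[ j < _ ] (𝕀 i j * f (suc j))
      ≈⟨ +-identityˡ _ ⟩
    ∑[ j < _ ] (𝕀 i j * f (suc j))
      ≈⟨ sum-𝕀 i (f ∘ suc) ⟩
    f (suc i) ∎

  sum-𝕀′ : ∀ {n} i (f : Fin n → Carrier) → ∑[ j < n ] (𝕀 j i * f j) ≈ f i
  sum-𝕀′ i f = trans (sum-cong-≋ (λ j → *-congʳ (𝕀-sym j i))) (sum-𝕀 i f)

  sum-↑ : ∀ m {n} (f : Fin (m ℕ.+ n) → Carrier) →
          sum f ≈ ∑[ i < m ] f (i ↑ˡ n) + ∑[ j < n ] f (m ↑ʳ j)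
  sum-↑ zero    f = sym (+-identityˡ _)
  sum-↑ (suc m) f = trans (+-congˡ (sum-↑ m (f ∘ suc))) (sym (+-assoc _ _ _))

  sum-combine : ∀ m {n} (f : Fin (m ℕ.* n) → Carrier) →
                sum f ≈ ∑[ i < m ] ∑[ j < n ] f (combine i j)
  sum-combine zero    f = refl
  sum-combine (suc m) {n} f =
    trans (sum-↑ n f) (+-congˡ (sum-combine m (f ∘ (n ↑ʳ_))))

  -- Determinants

  minor : ∀ {n} → Matrix (suc n) → Fin (suc n) → Matrix n
  minor A j i k = A (suc i) (punchIn j k)

  laplace : ∀ {n} → Matrix (suc n) → Fin (suc n) → Carrier
  laplace A j = sign j * A zero j * det (minor A j)

  det-cong : ∀ {n} {A B : Matrix n} → A ≋ B → det A ≈ det B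
  det-cong {zero}  A≋B = refl
  det-cong {suc n} {A} {B} A≋B = sum-cong (laplace A) (laplace B) λ j →
    *-cong (*-congˡ (A≋B zero j)) (det-cong (λ i k → A≋B (suc i) (punchIn j k)))

  sum-linear : ∀ {n} (f g h : Fin n → Carrier) x → (∀ j → f j ≈ g j + x * h j) →
               sum f ≈ sum g + x * sum h
  sum-linear f g h x f≈ = begin
    sum f                              ≈⟨ sum-cong-≋ f≈ ⟩
    ∑[ j < _ ] (g j + x * h j)         ≈⟨ ∑-distrib-+ g (λ j → x * h j) ⟩
    sum g + ∑[ j < _ ] (x * h j)       ≈⟨ +-congˡ (*-distribˡ-sum x h) ⟨
    sum g + x * sum h                  ∎

  -- Rows and columns are counted separately, so that a determinant with its leading rows fixed is
  -- still a function of the same kind in the others.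
  Rows : ℕ → ℕ → Set c
  Rows n m = Fin n → Fin m → Carrier

  -- Linearity in row i is a relation between three matrices that agree outside that row. This
  -- avoids equations between updated matrices, and the one scalar x covers both addition and
  -- scaling.
  record MultiLinear {n m} (F : Rows n m → Carrier) : Set (c ⊔ ℓ₁) where
    field
      congruent : ∀ {A B} → (∀ i j → A i j ≈ B i j) → F A ≈ F B
      linear    : ∀ i x {A B C} →
                  (∀ k → k ≢ i → ∀ j → A k j ≈ B k j) →
                  (∀ k → k ≢ i → ∀ j → A k j ≈ C k j) →
                  (∀ j → A i j ≈ B i j + x * C i j) →
                  F A ≈ F B + x * F C

  open MultiLinear

  -- Each term of the Laplace expansion contains one entry of row 0 and a minor that omits this row;
  -- in the other rows the minors are linear by induction.
  det-multiLinear : ∀ {n} → MultiLinear (det {n})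
  det-multiLinear .congruent = det-cong
  det-multiLinear {suc n} .linear zero x {A} {B} {C} A≈B A≈C Aᵢ =
    sum-linear (laplace A) (laplace B) (laplace C) x λ j → begin
      sign j * A zero j * det (minor A j)
        ≈⟨ *-congʳ (*-congˡ (Aᵢ j)) ⟩
      sign j * (B zero j + x * C zero j) * det (minor A j)
        ≈⟨ solve 5 (λ s b x c d → s :* (b :+ x :* c) :* d := s :* b :* d :+ x :* (s :* c :* d)) refl
             (sign j) (B zero j) x (C zero j) (det (minor A j)) ⟩
      sign j * B zero j * det (minor A j) + x * (sign j * C zero j * det (minor A j))
        ≈⟨ +-cong
             (*-congˡ (det-cong (λ i k → A≈B (suc i) (λ ()) (punchIn j k))))
             (*-congˡ (*-congˡ (det-cong (λ i k → A≈C (suc i) (λ ()) (punchIn j k))))) ⟩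
      laplace B j + x * laplace C j ∎
  det-multiLinear {suc n} .linear (suc i) x {A} {B} {C} A≈B A≈C Aᵢ =
    sum-linear (laplace A) (laplace B) (laplace C) x λ j → begin
      sign j * A zero j * det (minor A j)
        ≈⟨ *-congˡ (det-multiLinear .linear i x
             (λ k k≢i l → A≈B (suc k) (k≢i ∘ suc-injective) (punchIn j l))
             (λ k k≢i l → A≈C (suc k) (k≢i ∘ suc-injective) (punchIn j l))
             (λ l → Aᵢ (punchIn j l))) ⟩
      sign j * A zero j * (det (minor B j) + x * det (minor C j))
        ≈⟨ solve 5 (λ s a b x c → s :* a :* (b :+ x :* c) := s :* a :* b :+ x :* (s :* a :* c)) refl
             (sign j) (A zero j) (det (minor B j)) x (det (minor C j)) ⟩
      sign j * A zero j * det (minor B j) + x * (sign j * A zero j * det (minor C j))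
        ≈⟨ +-cong (*-congʳ (*-congˡ (A≈B zero (λ ()) j)))
                  (*-congˡ (*-congʳ (*-congˡ (A≈C zero (λ ()) j)))) ⟩
      laplace B j + x * laplace C j ∎

  infixl 8 _[_≔_]

  _[_≔_] : ∀ {n m} → Rows n m → Fin n → (Fin m → Carrier) → Rows n m
  A [ i ≔ r ] = updateAt A i (const r)

  ≔-this : ∀ {n m} (A : Rows n m) i r j → (A [ i ≔ r ]) i j ≈ r j
  ≔-this A i r j = reflexive (≡.cong (λ row → row j) (updateAt-updates i A))

  ≔-other : ∀ {n m} (A : Rows n m) i r k → k ≢ i → ∀ j → (A [ i ≔ r ]) k j ≈ A k j
  ≔-other A i r k k≢i j = reflexive (≡.cong (λ row → row j) (updateAt-minimal k i A k≢i))

  ≔-self : ∀ {n m} (A : Rows n m) i {r} → (∀ j → A i j ≈ r j) → ∀ k j → (A [ i ≔ r ]) k j ≈ A k j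
  ≔-self A i Aᵢ k j with k ≟ i
  ... | yes ≡.refl = trans (≔-this A i _ j) (sym (Aᵢ j))
  ... | no  k≢i    = ≔-other A i _ k k≢i j

  module _ {n m} {F : Rows n m → Carrier} (F-multiLinear : MultiLinear F) where

    -- The hypothesis stands in for "r is another row of A": the lemma serves to prove that
    -- determinants alternate, so alternation cannot be presupposed.
    add-row : ∀ A i r → F (A [ i ≔ r ]) ≈ 0# → F A ≈ F (A [ i ≔ (λ j → A i j + r j) ])
    add-row A i r F≈0 = sym (begin
      F (A [ i ≔ (λ j → A i j + r j) ])
        ≈⟨ F-multiLinear .linear i 1# {C = A [ i ≔ r ]}
             (≔-other A i _)
             (λ k k≢i j → trans (≔-other A i _ k k≢i j) (sym (≔-other A i r k k≢i j)))
             (λ j → trans (≔-this A i _ j)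
                          (+-congˡ (sym (trans (*-identityˡ _) (≔-this A i r j))))) ⟩
      F A + 1# * F (A [ i ≔ r ])
        ≈⟨ +-congˡ (trans (*-identityˡ _) F≈0) ⟩
      F A + 0#
        ≈⟨ +-identityʳ _ ⟩
      F A ∎)

    row-zero : ∀ A i → (∀ j → A i j ≈ 0#) → F A ≈ 0#
    row-zero A i Aᵢ≈0 = begin
      -- Linearity is applied to A three times with scalar -1: a zero row satisfies 0 = 0 - 0, hence
      -- F A = F A - F A.
      F A                ≈⟨ F-multiLinear .linear i (- 1#) (λ _ _ _ → refl) (λ _ _ _ → refl)
                              (λ j → trans (Aᵢ≈0 j) (sym (trans (+-congˡ (*-congˡ (Aᵢ≈0 j)))
                                (trans (+-congʳ (Aᵢ≈0 j)) (trans (+-identityˡ _) (zeroʳ _)))))) ⟩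
      F A + - 1# * F A   ≈⟨ solve 1 (λ x → x :+ :- con (+ 1) :* x := con (+ 0)) refl (F A) ⟩
      0#                 ∎

    row-sum : ∀ A i {p} (x : Fin p → Carrier) (r : Rows p m) →
              F (A [ i ≔ (λ j → ∑[ k < p ] (x k * r k j)) ]) ≈ ∑[ k < p ] (x k * F (A [ i ≔ r k ]))
    row-sum A i {zero}  x r = row-zero _ i (≔-this A i _)
    row-sum A i {suc p} x r = begin
      F (A [ i ≔ _ ])
        ≈⟨ F-multiLinear .linear i (x zero) {B = A [ i ≔ tail-sum ]} {C = A [ i ≔ r zero ]}
             (λ k k≢i j → trans (≔-other A i _ k k≢i j) (sym (≔-other A i _ k k≢i j)))
             (λ k k≢i j → trans (≔-other A i _ k k≢i j) (sym (≔-other A i _ k k≢i j)))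
             (λ j → trans (≔-this A i _ j)
                    (trans (+-comm _ _)
                    (sym (+-cong (≔-this A i _ j) (*-congˡ (≔-this A i _ j)))))) ⟩
      F (A [ i ≔ tail-sum ]) + x zero * F (A [ i ≔ r zero ])
        ≈⟨ +-comm _ _ ⟩
      x zero * F (A [ i ≔ r zero ]) + F (A [ i ≔ tail-sum ])
        ≈⟨ +-congˡ (row-sum A i (x ∘ suc) (r ∘ suc)) ⟩
      ∑[ k < suc p ] (x k * F (A [ i ≔ r k ])) ∎
      where
      tail-sum : Fin m → Carrier
      tail-sum j = ∑[ k < p ] (x (suc k) * r (suc k) j)

  ∷-multiLinear : ∀ {n m} {F : Rows (suc n) m → Carrier} → MultiLinear F →
                  ∀ u → MultiLinear (λ A → F (u ∷ A))
  ∷-multiLinear F-ml u .congruent A≈B =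
    F-ml .congruent λ { zero j → refl ; (suc i) j → A≈B i j }
  ∷-multiLinear F-ml u .linear i x A≈B A≈C Aᵢ =
    F-ml .linear (suc i) x
      (λ { zero _ j → refl ; (suc k) k≢i j → A≈B k (k≢i ∘ ≡.cong suc) j })
      (λ { zero _ j → refl ; (suc k) k≢i j → A≈C k (k≢i ∘ ≡.cong suc) j })
      Aᵢ

  -- The rows are corrected from the top. A corrected row is absorbed into F by `∷-multiLinear`, and
  -- the vanishing of F on matrices with a row u is inherited.
  shift-rows : ∀ {n m} {F : Rows n m → Carrier} → MultiLinear F →
               ∀ (u : Fin m → Carrier) → (∀ A k → (∀ j → A k j ≈ u j) → F A ≈ 0#) →
               ∀ (x : Fin n → Carrier) (A B : Rows n m) → (∀ k j → A k j ≈ B k j + x k * u j) → F A ≈ F B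
  shift-rows {zero}      F-ml u F[u]≈0 x A B A≈B = F-ml .congruent (λ ())
  shift-rows {suc n} {F = F} F-ml u F[u]≈0 x A B A≈B = begin
    F A
      ≈⟨ F-ml .linear zero (x zero) {B = B zero ∷ tail A} {C = u ∷ tail A}
           (λ { zero 0≢0 _ → contradiction ≡.refl 0≢0 ; (suc k) _ j → refl })
           (λ { zero 0≢0 _ → contradiction ≡.refl 0≢0 ; (suc k) _ j → refl })
           (A≈B zero) ⟩
    F (B zero ∷ tail A) + x zero * F (u ∷ tail A)
      ≈⟨ +-congˡ (trans (*-congˡ (F[u]≈0 (u ∷ tail A) zero (λ _ → refl))) (zeroʳ _)) ⟩
    F (B zero ∷ tail A) + 0#
      ≈⟨ +-identityʳ _ ⟩
    F (B zero ∷ tail A)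
      ≈⟨ shift-rows (∷-multiLinear F-ml (B zero)) u
           (λ A k Aₖ≈u → F[u]≈0 (B zero ∷ A) (suc k) Aₖ≈u)
           (x ∘ suc) (tail A) (tail B) (λ k → A≈B (suc k)) ⟩
    F (B zero ∷ tail B)
      ≈⟨ F-ml .congruent (λ { zero j → refl ; (suc k) j → refl }) ⟩
    F B ∎

  -- Swap j k j′ k′ : deleting column j and then the k-th of the remaining
  -- columns removes the same two columns as deleting j′ and then k′, in the
  -- opposite order, with j before j′.
  data Swap : ∀ {n} → Fin (suc n) → Fin n → Fin (suc n) → Fin n → Set where
    here  : ∀ {n} {k : Fin (suc n)} → Swap zero k (suc k) zero
    there : ∀ {n} {j j′ : Fin (suc n)} {k k′ : Fin n} →
            Swap j k j′ k′ → Swap (suc j) (suc k) (suc j′) (suc k′)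

  swap-first : ∀ {n} {j j′ : Fin (suc n)} {k k′} → Swap j k j′ k′ → punchIn j k ≡ j′
  swap-first here      = ≡.refl
  swap-first (there s) = ≡.cong suc (swap-first s)

  swap-second : ∀ {n} {j j′ : Fin (suc n)} {k k′} → Swap j k j′ k′ → punchIn j′ k′ ≡ j
  swap-second here      = ≡.refl
  swap-second (there s) = ≡.cong suc (swap-second s)

  swap-punchIn : ∀ {n} {j j′ : Fin (suc (suc n))} {k k′} → Swap j k j′ k′ →
                 ∀ x → punchIn j (punchIn k x) ≡ punchIn j′ (punchIn k′ x)
  swap-punchIn here      x       = ≡.refl
  swap-punchIn (there s) zero    = ≡.refl
  swap-punchIn (there s) (suc x) = ≡.cong suc (swap-punchIn s x)

  -- Removing the earlier column first lowers the index of the later one by one, while in the other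
  -- order no index moves: k is j′ - 1 and k′ is j.
  swap-sign : ∀ {n} {j j′ : Fin (suc n)} {k k′} → Swap j k j′ k′ →
              sign j * sign k ≈ - (sign j′ * sign k′)
  swap-sign (here {k = k}) = solve 1 (λ s → con (+ 1) :* s := :- (:- s :* con (+ 1))) refl (sign k)
  swap-sign (there {j = j} {j′} {k} {k′} s) = begin
    - sign j * - sign k         ≈⟨ solve 2 (λ a b → :- a :* :- b := a :* b) refl (sign j) (sign k) ⟩
    sign j * sign k             ≈⟨ swap-sign s ⟩
    - (sign j′ * sign k′)       ≈⟨ solve 2 (λ a b → :- (a :* b) := :- (:- a :* :- b)) refl (sign j′) (sign k′) ⟩
    - (- sign j′ * - sign k′)   ∎

  sum-triangles : ∀ {m n} (f : Fin (suc m) → Fin (suc n) → Carrier) →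
                  ∑[ j < suc m ] ∑[ k < suc n ] f j k ≈
                  ∑[ k < suc n ] f zero k + ∑[ j < m ] f (suc j) zero + ∑[ j < m ] ∑[ k < n ] f (suc j) (suc k)
  sum-triangles f = trans
    (+-congˡ (∑-distrib-+ (λ j → f (suc j) zero) (λ j → ∑[ k < _ ] f (suc j) (suc k))))
    (sym (+-assoc _ _ _))

  -- Row zero cancels against column zero through `here`; what remains is the same kind of sum one
  -- size smaller, through `there`. No division by 2 occurs.
  sum-antisymmetric : ∀ {n} (f : Fin (suc n) → Fin n → Carrier) →
                      (∀ {j k j′ k′} → Swap j k j′ k′ → f j k + f j′ k′ ≈ 0#) →
                      ∑[ j < suc n ] ∑[ k < n ] f j k ≈ 0#
  sum-antisymmetric {zero}  f f-anti = +-identityʳ 0#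
  sum-antisymmetric {suc n} f f-anti = begin
    ∑[ j < suc (suc n) ] ∑[ k < suc n ] f j k
      ≈⟨ sum-triangles f ⟩
    ∑[ k < suc n ] f zero k + ∑[ j < suc n ] f (suc j) zero + ∑[ j < suc n ] ∑[ k < n ] f (suc j) (suc k)
      ≈⟨ +-cong (sym (∑-distrib-+ (f zero) (λ j → f (suc j) zero)))
                (sum-antisymmetric (λ j k → f (suc j) (suc k)) (λ s → f-anti (there s))) ⟩
    ∑[ k < suc n ] (f zero k + f (suc k) zero) + 0#
      ≈⟨ +-identityʳ _ ⟩
    ∑[ k < suc n ] (f zero k + f (suc k) zero)
      ≈⟨ sum-zero {f = λ k → f zero k + f (suc k) zero} (λ k → f-anti (here {k = k})) ⟩
    0# ∎

  -- After expansion along the two top rows each pair of columns occurs twice, once for either order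
  -- of removal, with the same minor and opposite signs.
  det-equal-top-rows : ∀ {n} (A : Matrix (suc (suc n))) →
                       (∀ j → A zero j ≈ A (suc zero) j) → det A ≈ 0#
  det-equal-top-rows {n} A A₀≈A₁ = begin
    det A
      ≈⟨ sum-cong (laplace A) (λ j → ∑[ k < suc n ] f j k) expand ⟩
    ∑[ j < suc (suc n) ] ∑[ k < suc n ] f j k
      ≈⟨ sum-antisymmetric f f-anti ⟩
    0# ∎
    where
    A₁ : Fin (suc (suc n)) → Carrier
    A₁ = A (suc zero)

    D : Fin (suc (suc n)) → Fin (suc n) → Carrier
    D j k = det (minor (minor A j) k)

    f : Fin (suc (suc n)) → Fin (suc n) → Carrier
    f j k = sign j * sign k * (A₁ j * A₁ (punchIn j k)) * D j k

    expand : ∀ j → laplace A j ≈ ∑[ k < suc n ] f j k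
    expand j = begin
      sign j * A zero j * ∑[ k < suc n ] laplace (minor A j) k
        ≈⟨ *-distribˡ-sum (sign j * A zero j) (laplace (minor A j)) ⟩
      ∑[ k < suc n ] (sign j * A zero j * laplace (minor A j) k)
        ≈⟨ sum-cong (λ k → sign j * A zero j * laplace (minor A j) k) (f j) (λ k → trans
             (*-congʳ (*-congˡ (A₀≈A₁ j)))
             (solve 5 (λ s a t b d → s :* a :* (t :* b :* d) := s :* t :* (a :* b) :* d) refl
               (sign j) (A₁ j) (sign k) (A₁ (punchIn j k)) (D j k))) ⟩
      ∑[ k < suc n ] f j k ∎

    f-anti : ∀ {j k j′ k′} → Swap j k j′ k′ → f j k + f j′ k′ ≈ 0#
    f-anti {j} {k} {j′} {k′} s = begin
      sign j * sign k * (A₁ j * A₁ (punchIn j k)) * D j k + f j′ k′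
        ≈⟨ +-congʳ (*-cong
             (*-cong (swap-sign s) (*-cong (reflexive (≡.cong A₁ (≡.sym (swap-second s))))
                                           (reflexive (≡.cong A₁ (swap-first s)))))
             (det-cong (λ i x → reflexive (≡.cong (A (suc (suc i))) (swap-punchIn s x))))) ⟩
      - (sign j′ * sign k′) * (A₁ (punchIn j′ k′) * A₁ j′) * D j′ k′ + f j′ k′
        ≈⟨ solve 4 (λ s a b d → :- s :* (a :* b) :* d :+ s :* (b :* a) :* d := con (+ 0)) refl
             (sign j′ * sign k′) (A₁ (punchIn j′ k′)) (A₁ j′) (D j′ k′) ⟩
      0# ∎

  -- Equal rows below the top remain equal in every minor, so only a pair containing the top row
  -- needs an argument of its own.
  det-alternating : ∀ {n} (A : Matrix n) i k → i ≢ k → (∀ j → A i j ≈ A k j) → det A ≈ 0#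
  det-lower-alternating : ∀ {n} (A : Matrix (suc n)) i k → i ≢ k →
                          (∀ j → A (suc i) j ≈ A (suc k) j) → det A ≈ 0#
  det-top-alternating : ∀ {n} (A : Matrix (suc n)) k → (∀ j → A zero j ≈ A (suc k) j) → det A ≈ 0#

  det-alternating A zero    zero    0≢0 Aᵢ≈Aₖ = contradiction ≡.refl 0≢0
  det-alternating A zero    (suc k) _   Aᵢ≈Aₖ = det-top-alternating A k Aᵢ≈Aₖ
  det-alternating A (suc i) zero    _   Aᵢ≈Aₖ = det-top-alternating A i (sym ∘ Aᵢ≈Aₖ)
  det-alternating A (suc i) (suc k) i≢k Aᵢ≈Aₖ =
    det-lower-alternating A i k (i≢k ∘ ≡.cong suc) Aᵢ≈Aₖ

  det-lower-alternating A i k i≢k Aᵢ≈Aₖ = sum-zero {f = laplace A} λ j →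
    trans (*-congˡ (det-alternating (minor A j) i k i≢k (λ l → Aᵢ≈Aₖ (punchIn j l)))) (zeroʳ _)

  det-top-alternating A zero A₀≈A₁ = det-equal-top-rows A A₀≈A₁
  -- Adding row 1 to row k + 2, and then row 0 to row 1, makes rows 1 and k + 2 equal.
  det-top-alternating A (suc k) A₀≈Aₖ = begin
    det A   ≈⟨ add-row det-multiLinear A (suc (suc k)) (A (suc zero))
                 (det-lower-alternating (A [ suc (suc k) ≔ A (suc zero) ]) zero (suc k) (λ ())
                   (λ j → sym (≔-this A (suc (suc k)) (A (suc zero)) j))) ⟩
    det A₂  ≈⟨ add-row det-multiLinear A₂ (suc zero) (A zero)
                 (det-equal-top-rows (A₂ [ suc zero ≔ A zero ]) (λ j → refl)) ⟩
    det A₃  ≈⟨ det-lower-alternating A₃ zero (suc k) (λ ())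
                 (λ j → trans (+-comm _ _)
                   (trans (+-congʳ (A₀≈Aₖ j)) (sym (≔-this A (suc (suc k)) _ j)))) ⟩
    0#      ∎
    where
    A₂ = A [ suc (suc k) ≔ (λ j → A (suc (suc k)) j + A (suc zero) j) ]
    A₃ = A₂ [ suc zero ≔ (λ j → A₂ (suc zero) j + A zero j) ]

  det-zero-column : ∀ {n} (A : Matrix (suc n)) → (∀ i → A i zero ≈ 0#) → det A ≈ 0#
  det-zero-column {zero} A A⋅₀≈0 =
    sum-zero {f = laplace A} λ { zero → trans (*-congʳ (trans (*-congˡ (A⋅₀≈0 zero)) (zeroʳ _))) (zeroˡ _) }
  det-zero-column {suc n} A A⋅₀≈0 = sum-zero {f = laplace A} λ
    { zero    → trans (*-congʳ (trans (*-congˡ (A⋅₀≈0 zero)) (zeroʳ _))) (zeroˡ _)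
    ; (suc j) → trans (*-congˡ (det-zero-column (minor A (suc j)) (λ i → A⋅₀≈0 (suc i)))) (zeroʳ _)
    }

  det-pivot : ∀ {n} (A : Matrix (suc n)) → (∀ i → A (suc i) zero ≈ 0#) →
              det A ≈ A zero zero * det (minor A zero)
  det-pivot {n} A A⋅₀≈0 = begin
    1# * A zero zero * det (minor A zero) + ∑[ j < n ] (sign (suc j) * A zero (suc j) * det (minor A (suc j)))
      ≈⟨ +-cong (*-congʳ (*-identityˡ _))
                (sum-zero {f = laplace A ∘ suc} (λ j → trans (*-congˡ (minors j)) (zeroʳ _))) ⟩
    A zero zero * det (minor A zero) + 0#
      ≈⟨ +-identityʳ _ ⟩
    A zero zero * det (minor A zero) ∎
    where
    minors : ∀ j → det (minor A (suc j)) ≈ 0#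
    -- The match on j only reveals that n is a successor, which `det-zero-column` requires for the
    -- minor.
    minors j@zero    = det-zero-column (minor A (suc j)) A⋅₀≈0
    minors j@(suc _) = det-zero-column (minor A (suc j)) A⋅₀≈0

  -- One step of Gaussian elimination: x lists the multiples of row 0 whose subtraction clears the
  -- first column below the pivot.
  det-schur : ∀ {n} (A : Matrix (suc n)) (x : Fin n → Carrier) →
              (∀ k → A (suc k) zero ≈ x k * A zero zero) →
              det A ≈ A zero zero * det (λ i k → A (suc i) (suc k) - x i * A zero (suc k))
  det-schur A x A⋅₀ = begin
    det A
      ≈⟨ det-cong {A = A} {B = A zero ∷ tail A} (λ { zero j → refl ; (suc i) j → refl }) ⟩
    det (A zero ∷ tail A)
      ≈⟨ shift-rows (∷-multiLinear det-multiLinear (A zero)) (A zero)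
           (λ B k Bₖ≈A₀ → det-top-alternating (A zero ∷ B) k (sym ∘ Bₖ≈A₀))
           x (tail A) (tail B)
           (λ k j → solve 3 (λ a x b → a := a :- x :* b :+ x :* b) refl (A (suc k) j) (x k) (A zero j)) ⟩
    det B
      ≈⟨ det-pivot B (λ i → trans (+-congʳ (A⋅₀ i)) (-‿inverseʳ _)) ⟩
    A zero zero * det (minor B zero) ∎
    where
    B : Matrix (suc _)
    B = A zero ∷ λ i j → A (suc i) j - x i * A zero j

  -- Polynomial functions

  -- Functions that are polynomial of degree below d, by successive synthetic
  -- divisions by t - a.
  Polynomial : ℕ → (Carrier → Carrier) → Set (c ⊔ ℓ₁)
  Polynomial zero    f = Lift c (∀ t → f t ≈ 0#)
  Polynomial (suc d) f = ∀ a → ∃[ g ] Polynomial d g × (∀ t → f t ≈ f a + (t - a) * g t)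

  polynomial-cong : ∀ {d f g} → (∀ t → f t ≈ g t) → Polynomial d f → Polynomial d g
  polynomial-cong {zero}  f≈g (lift f≈0) = lift λ t → trans (sym (f≈g t)) (f≈0 t)
  polynomial-cong {suc d} f≈g p a with p a
  ... | q , q-poly , f≈ = q , q-poly , λ t → trans (sym (f≈g t)) (trans (f≈ t) (+-congʳ (f≈g a)))

  polynomial-zero : ∀ {d} → Polynomial d (const 0#)
  polynomial-zero {zero}  = lift λ t → refl
  polynomial-zero {suc d} a = const 0# , polynomial-zero , λ t → sym (trans (+-identityˡ _) (zeroʳ _))

  polynomial-const : ∀ {d} x → Polynomial (suc d) (const x)
  polynomial-const x a = const 0# , polynomial-zero , λ t → sym (trans (+-congˡ (zeroʳ _)) (+-identityʳ x))

  polynomial-weaken : ∀ {d f} → Polynomial d f → Polynomial (suc d) f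
  polynomial-weaken {zero}  (lift f≈0) = polynomial-cong (λ t → sym (f≈0 t)) (polynomial-zero {1})
  polynomial-weaken {suc d} p a with p a
  ... | g , g-poly , f≈ = g , polynomial-weaken g-poly , f≈

  polynomial-+ : ∀ {d f g} → Polynomial d f → Polynomial d g → Polynomial d (λ t → f t + g t)
  polynomial-+ {zero}  (lift f≈0) (lift g≈0) = lift λ t → trans (+-cong (f≈0 t) (g≈0 t)) (+-identityʳ 0#)
  polynomial-+ {suc d} {f} {g} p q a with p a | q a
  ... | f′ , p′ , f≈ | g′ , q′ , g≈ = (λ t → f′ t + g′ t) , polynomial-+ p′ q′ , λ t →
    trans (+-cong (f≈ t) (g≈ t))
          (solve 6 (λ x y t a u v → x :+ (t :- a) :* u :+ (y :+ (t :- a) :* v)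
                                 := x :+ y :+ (t :- a) :* (u :+ v)) refl
             (f a) (g a) t a (f′ t) (g′ t))

  polynomial-scale : ∀ {d f} x → Polynomial d f → Polynomial d (λ t → x * f t)
  polynomial-scale {zero}  x (lift f≈0) = lift λ t → trans (*-congˡ (f≈0 t)) (zeroʳ x)
  polynomial-scale {suc d} {f} x p a with p a
  ... | g , q , f≈ = (λ t → x * g t) , polynomial-scale x q , λ t →
    trans (*-congˡ (f≈ t))
          (solve 5 (λ x y t a u → x :* (y :+ (t :- a) :* u) := x :* y :+ (t :- a) :* (x :* u)) refl
             x (f a) t a (g t))

  polynomial-*t : ∀ {d f} → Polynomial d f → Polynomial (suc d) (λ t → t * f t)
  polynomial-*t {zero} (lift f≈0) =
    polynomial-cong (λ t → sym (trans (*-congˡ (f≈0 t)) (zeroʳ t))) (polynomial-zero {1})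
  polynomial-*t {suc d} {f} p a with p a
  ... | g , q , f≈ = (λ t → f t + a * g t) , polynomial-+ p (polynomial-scale a (polynomial-weaken q)) , λ t → begin
    t * f t
      ≈⟨ solve 3 (λ t a y → t :* y := a :* y :+ (t :- a) :* y) refl t a (f t) ⟩
    a * f t + (t - a) * f t
      ≈⟨ +-congʳ (*-congˡ (f≈ t)) ⟩
    a * (f a + (t - a) * g t) + (t - a) * f t
      ≈⟨ solve 5 (λ t a x y u → a :* (x :+ (t :- a) :* u) :+ (t :- a) :* y
                             := a :* x :+ (t :- a) :* (y :+ a :* u)) refl t a (f a) (f t) (g t) ⟩
    a * f a + (t - a) * (f t + a * g t) ∎

  polynomial-sum : ∀ {d n} (f : Fin n → Carrier → Carrier) → (∀ i → Polynomial d (f i)) →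
                   Polynomial d (λ t → ∑[ i < n ] f i t)
  polynomial-sum {n = zero}  f p = polynomial-zero
  polynomial-sum {n = suc n} f p = polynomial-+ (p zero) (polynomial-sum (f ∘ suc) (p ∘ suc))

  *-cancelˡ-# : ∀ {x y} → x # 0# → x * y ≈ 0# → y ≈ 0#
  *-cancelˡ-# {x} {y} x#0 xy≈0 = begin
    y                      ≈⟨ *-identityˡ y ⟨
    1# * y                 ≈⟨ *-congʳ (inverse-* x#0) ⟨
    inverse x#0 * x * y    ≈⟨ *-assoc _ _ _ ⟩
    inverse x#0 * (x * y)  ≈⟨ *-congˡ xy≈0 ⟩
    inverse x#0 * 0#       ≈⟨ zeroʳ _ ⟩
    0#                     ∎

  -- A polynomial with too many zeros vanishes. The bound m lets the zeros run out one at a time: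
  -- dividing by t - (m + 1) keeps all later integers as zeros, because their distance to m + 1 is
  -- invertible.
  polynomial-vanishing : ∀ {d f} → Polynomial d f → ∀ m → (∀ k → f (fromℕ (suc k ℕ.+ m)) ≈ 0#) →
                         ∀ t → f t ≈ 0#
  polynomial-vanishing {zero}  (lift f≈0) m _ = f≈0
  polynomial-vanishing {suc d} {f} p m f≈0 t with p (fromℕ (suc m))
  ... | g , q , f≈ = begin
    f t                      ≈⟨ f≈ t ⟩
    f a + (t - a) * g t      ≈⟨ +-cong (f≈0 0) (*-congˡ (polynomial-vanishing q (suc m) g≈0 t)) ⟩
    0# + (t - a) * 0#        ≈⟨ trans (+-identityˡ _) (zeroʳ _) ⟩
    0#                       ∎
    where
    a = fromℕ (suc m)

    g≈0 : ∀ k → g (fromℕ (suc k ℕ.+ suc m)) ≈ 0#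
    g≈0 k = *-cancelˡ-# (char0 (suc k)) (begin
      fromℕ (suc k) * g b
        ≈⟨ solve 3 (λ x a u → x :* u := con (+ 0) :+ (x :+ a :- a) :* u) refl (fromℕ (suc k)) a (g b) ⟩
      0# + (fromℕ (suc k) + a - a) * g b
        ≈⟨ +-cong (sym (f≈0 0)) (*-congʳ (+-congʳ (sym (fromℕ-+ (suc k) (suc m))))) ⟩
      f a + (b - a) * g b
        ≈⟨ f≈ b ⟨
      f b
        ≡⟨ ≡.cong (f ∘ fromℕ) (ℕₚ.+-suc (suc k) m) ⟩
      f (fromℕ (suc (suc k) ℕ.+ m))
        ≈⟨ f≈0 (suc k) ⟩
      0# ∎)
      where b = fromℕ (suc k ℕ.+ suc m)

  -- The value x and the derivative y of f at 0. The remainder is required to be polynomial, so that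
  -- f determines both.
  FirstOrder : (Carrier → Carrier) → Carrier → Carrier → Set (c ⊔ ℓ₁)
  FirstOrder f x y = ∃[ d ] ∃[ h ] Polynomial d h × (∀ t → f t ≈ x + t * y + t * t * h t)

  polynomial-lift : ∀ {d e f} → Polynomial d f → Polynomial (e ℕ.+ d) f
  polynomial-lift {e = zero}  p = p
  polynomial-lift {e = suc e} p = polynomial-weaken (polynomial-lift {e = e} p)

  -- The constant terms agree by evaluation at 0. The difference of the rest is t q(t) with q(0) = y
  -- - y′; t cannot be cancelled at 0 itself, but it can at every positive integer, which forces the
  -- polynomial q to vanish everywhere.
  firstOrder-unique : ∀ {f x y x′ y′} → FirstOrder f x y → FirstOrder f x′ y′ → x ≈ x′ × y ≈ y′
  firstOrder-unique {f} {x} {y} {x′} {y′} (d , h , h-poly , f≈) (d′ , h′ , h′-poly , f≈′) = x≈x′ , y≈y′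
    where
    x≈x′ : x ≈ x′
    x≈x′ = begin
      x                                  ≈⟨ solve 3 (λ x y z → x := x :+ con (+ 0) :* y :+ con (+ 0) :* con (+ 0) :* z)
                                              refl x y (h 0#) ⟩
      x + 0# * y + 0# * 0# * h 0#        ≈⟨ f≈ 0# ⟨
      f 0#                               ≈⟨ f≈′ 0# ⟩
      x′ + 0# * y′ + 0# * 0# * h′ 0#     ≈⟨ solve 3 (λ x y z → x := x :+ con (+ 0) :* y :+ con (+ 0) :* con (+ 0) :* z)
                                              refl x′ y′ (h′ 0#) ⟨
      x′                                 ∎

    q : Carrier → Carrier
    q t = (y - y′) + t * (h t + - 1# * h′ t)

    q-poly : Polynomial (suc (d′ ℕ.+ d)) q
    q-poly = polynomial-+ (polynomial-const (y - y′)) (polynomial-*t (polynomial-+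
      (polynomial-lift {e = d′} h-poly)
      (polynomial-scale (- 1#) (≡.subst (λ e → Polynomial e h′) (ℕₚ.+-comm d d′) (polynomial-lift {e = d} h′-poly)))))

    t*q≈0 : ∀ t → t * q t ≈ 0#
    t*q≈0 t = begin
      t * q t
        ≈⟨ solve 7 (λ t x y y′ x′ h h′ →
              t :* (y :- y′ :+ t :* (h :+ :- con (+ 1) :* h′))
                := (x :+ t :* y :+ t :* t :* h) :- (x :+ t :* y′ :+ t :* t :* h′))
             refl t x y y′ x′ (h t) (h′ t) ⟩
      x + t * y + t * t * h t - (x + t * y′ + t * t * h′ t)
        ≈⟨ +-cong (sym (f≈ t)) (-‿cong (trans (+-congʳ (+-congʳ x≈x′)) (sym (f≈′ t)))) ⟩
      f t - f t
        ≈⟨ -‿inverseʳ _ ⟩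
      0# ∎

    y≈y′ : y ≈ y′
    y≈y′ = begin
      y           ≈⟨ solve 3 (λ y y′ u → y := (y :- y′ :+ con (+ 0) :* u) :+ y′)
                       refl y y′ (h 0# + - 1# * h′ 0#) ⟩
      q 0# + y′   ≈⟨ +-congʳ (polynomial-vanishing q-poly 0 (λ k → *-cancelˡ-# (char0 (suc (k ℕ.+ 0))) (t*q≈0 _)) 0#) ⟩
      0# + y′     ≈⟨ +-identityˡ y′ ⟩
      y′          ∎

  minor-≔ : ∀ {n m} (A : Rows n (suc m)) i r j k l →
            (A [ i ≔ r ]) k (punchIn j l) ≈ ((λ k l → A k (punchIn j l)) [ i ≔ r ∘ punchIn j ]) k l
  minor-≔ A zero    r j zero    l = refl
  minor-≔ A zero    r j (suc k) l = refl
  minor-≔ A (suc i) r j zero    l = refl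
  minor-≔ A (suc i) r j (suc k) l = minor-≔ (A ∘ suc) i r j k l

  -- The product rule for the multilinear determinant: the linear term replaces one row of A at a
  -- time by the same row of B.
  det-expansion : ∀ {n} (A B : Matrix n) →
    ∃[ h ] Polynomial n h ×
    (∀ t → det (λ i j → A i j + t * B i j) ≈ det A + t * ∑[ i < n ] det (A [ i ≔ B i ]) + t * t * h t)
  det-expansion {zero}  A B = const 0# , polynomial-zero , λ t →
    solve 1 (λ t → con (+ 1) := con (+ 1) :+ t :* con (+ 0) :+ t :* t :* con (+ 0)) refl t
  det-expansion {suc n} A B = (λ t → ∑[ j < suc n ] h j t) , polynomial-sum h h-poly , expand
    where
    a d : Fin (suc n) → Carrier
    a j = det (minor A j)
    d j = ∑[ i < n ] det (minor A j [ i ≔ minor B j i ])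

    e : Fin (suc n) → Carrier → Carrier
    e j = proj₁ (det-expansion (minor A j) (minor B j))

    h : Fin (suc n) → Carrier → Carrier
    -- The part of degree at least 2 in (x + t y)(a + t d + t² e), divided by t²: y d + x e + t y e.
    h j t = sign j * B zero j * d j + (sign j * A zero j * e j t + t * (sign j * B zero j * e j t))

    h-poly : ∀ j → Polynomial (suc n) (h j)
    h-poly j = polynomial-+ (polynomial-const _)
      (polynomial-+ (polynomial-scale _ (polynomial-weaken e-poly)) (polynomial-*t (polynomial-scale _ e-poly)))
      where e-poly = proj₁ (proj₂ (det-expansion (minor A j) (minor B j)))

    lower : ∀ i → det (A [ suc i ≔ B (suc i) ]) ≈
                  ∑[ j < suc n ] (sign j * A zero j * det (minor A j [ i ≔ minor B j i ]))
    lower i = sum-cong (laplace (A [ suc i ≔ B (suc i) ])) _ λ j →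
      *-congˡ (det-cong (λ k l → minor-≔ (A ∘ suc) i (B (suc i)) j k l))

    first-order : ∑[ j < suc n ] (sign j * B zero j * a j + sign j * A zero j * d j) ≈ ∑[ i < suc n ] det (A [ i ≔ B i ])
    first-order = begin
      ∑[ j < suc n ] (sign j * B zero j * a j + sign j * A zero j * d j)
        ≈⟨ ∑-distrib-+ (λ j → sign j * B zero j * a j) (λ j → sign j * A zero j * d j) ⟩
      det (A [ zero ≔ B zero ]) + ∑[ j < suc n ] (sign j * A zero j * d j)
        ≈⟨ +-congˡ (sum-cong (λ j → sign j * A zero j * d j) _
             (λ j → *-distribˡ-sum (sign j * A zero j) (λ i → det (minor A j [ i ≔ minor B j i ])))) ⟩
      det (A [ zero ≔ B zero ]) + ∑[ j < suc n ] ∑[ i < n ] (sign j * A zero j * det (minor A j [ i ≔ minor B j i ]))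
        ≈⟨ +-congˡ (∑-comm (λ j i → sign j * A zero j * det (minor A j [ i ≔ minor B j i ]))) ⟩
      det (A [ zero ≔ B zero ]) + ∑[ i < n ] ∑[ j < suc n ] (sign j * A zero j * det (minor A j [ i ≔ minor B j i ]))
        ≈⟨ +-congˡ (sum-cong _ (λ i → det (A [ suc i ≔ B (suc i) ])) (sym ∘ lower)) ⟩
      ∑[ i < suc n ] det (A [ i ≔ B i ]) ∎

    expand : ∀ t → det (λ i j → A i j + t * B i j) ≈
                   det A + t * ∑[ i < suc n ] det (A [ i ≔ B i ]) + t * t * ∑[ j < suc n ] h j t
    expand t = begin
      det (λ i j → A i j + t * B i j)
        ≈⟨ sum-linear (laplace (λ i j → A i j + t * B i j)) f (λ j → h j t) (t * t) (λ j → trans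
             (*-congˡ (proj₂ (proj₂ (det-expansion (minor A j) (minor B j))) t))
             (solve 7 (λ s x y t a d e →
                 s :* (x :+ t :* y) :* (a :+ t :* d :+ t :* t :* e)
                   := s :* x :* a :+ t :* (s :* y :* a :+ s :* x :* d)
                      :+ t :* t :* (s :* y :* d :+ (s :* x :* e :+ t :* (s :* y :* e))))
               refl (sign j) (A zero j) (B zero j) t (a j) (d j) (e j t))) ⟩
      sum f + t * t * ∑[ j < suc n ] h j t
        ≈⟨ +-congʳ (sum-linear f (laplace A) (λ j → sign j * B zero j * a j + sign j * A zero j * d j) t (λ j → refl)) ⟩
      det A + t * ∑[ j < suc n ] (sign j * B zero j * a j + sign j * A zero j * d j) + t * t * ∑[ j < suc n ] h j t
        ≈⟨ +-congʳ (+-congˡ (*-congˡ first-order)) ⟩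
      det A + t * ∑[ i < suc n ] det (A [ i ≔ B i ]) + t * t * ∑[ j < suc n ] h j t ∎
      where
      f : Fin (suc n) → Carrier
      f j = sign j * A zero j * a j + t * (sign j * B zero j * a j + sign j * A zero j * d j)

  -- Row i of `X ⊡ A` is a combination of the rows of A; by alternation only the multiple of row i
  -- itself contributes. This plays the part of Cramer's rule.
  det-row-combination : ∀ {n} (A X : Matrix n) i → det (A [ i ≔ (X ⊡ A) i ]) ≈ X i i * det A
  det-row-combination {n} A X i = begin
    det (A [ i ≔ (X ⊡ A) i ])
      ≈⟨ row-sum det-multiLinear A i (X i) A ⟩
    ∑[ k < n ] (X i k * det (A [ i ≔ A k ]))
      ≈⟨ sum-cong-≋ (λ k → trans (*-congˡ (replaced k))
           (solve 3 (λ x e d → x :* (e :* d) := e :* (x :* d)) refl (X i k) (𝕀 i k) (det A))) ⟩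
    ∑[ k < n ] (𝕀 i k * (X i k * det A))
      ≈⟨ sum-𝕀 i (λ k → X i k * det A) ⟩
    X i i * det A ∎
    where
    replaced : ∀ k → det (A [ i ≔ A k ]) ≈ 𝕀 i k * det A
    replaced k with i ≟ k
    ... | yes ≡.refl = trans (det-cong (≔-self A i (λ _ → refl))) (sym (*-identityˡ _))
    ... | no  i≢k    = trans
      (det-alternating (A [ i ≔ A k ]) i k i≢k (λ j →
        trans (≔-this A i (A k) j) (sym (≔-other A i (A k) k (i≢k ∘ ≡.sym) j))))
      (sym (zeroˡ _))

  -- Characteristic polynomials

  *-#0ˡ : ∀ {x y} → x * y # 0# → x # 0#
  *-#0ˡ {x} {y} xy#0 = invertible {y = inverse xy#0 * y} (begin
    inverse xy#0 * y * x    ≈⟨ trans (*-assoc _ _ _) (*-congˡ (*-comm y x)) ⟩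
    inverse xy#0 * (x * y)  ≈⟨ inverse-* xy#0 ⟩
    1#                      ∎)

  *-#0ʳ : ∀ {x y} → x * y # 0# → y # 0#
  *-#0ʳ {x} {y} xy#0 = *-#0ˡ (#-congʳ (*-comm x y) xy#0)

  neg-#0 : ∀ {x} → - x # 0# → x # 0#
  neg-#0 {x} -x#0 = *-#0ʳ {x = - 1#} (#-congʳ (solve 1 (λ x → :- x := :- con (+ 1) :* x) refl x) -x#0)

  product-#0 : ∀ {n} (f : Fin n → Carrier) → product f # 0# → ∀ i → f i # 0#
  product-#0 f Πf#0 zero    = *-#0ˡ Πf#0
  product-#0 f Πf#0 (suc i) = product-#0 (f ∘ suc) (*-#0ʳ Πf#0) i

  product-cong : ∀ {n} {f g : Fin n → Carrier} → (∀ i → f i ≈ g i) → product f ≈ product g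
  product-cong {zero}  f≈g = refl
  product-cong {suc n} f≈g = *-cong (f≈g zero) (product-cong (f≈g ∘ suc))

  *-cancelˡ : ∀ {x y z} → x # 0# → x * y ≈ x * z → y ≈ z
  *-cancelˡ {x} {y} {z} x#0 xy≈xz = begin
    y            ≈⟨ solve 2 (λ y z → y := (y :- z) :+ z) refl y z ⟩
    y - z + z    ≈⟨ +-congʳ (*-cancelˡ-# x#0 (begin
                      x * (y - z)      ≈⟨ solve 3 (λ x y z → x :* (y :- z) := x :* y :- x :* z) refl x y z ⟩
                      x * y - x * z    ≈⟨ +-congʳ xy≈xz ⟩
                      x * z - x * z    ≈⟨ -‿inverseʳ _ ⟩
                      0#               ∎)) ⟩
    0# + z       ≈⟨ +-identityˡ z ⟩
    z            ∎

  -- Each factor is -(μᵢ + r) - t, whose logarithmic derivative at 0 is 1 / (μᵢ + r).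
  product-firstOrder : ∀ {n} r (μ : Fin n → Carrier) (nz : ∀ i → μ i + r # 0#) →
    let P = product (λ i → - (μ i + r)) in
    FirstOrder (λ t → product (λ i → - (r + t) - μ i)) P (P * ∑[ i < n ] inverse (nz i))
  product-firstOrder {zero} r μ nz = 0 , const 0# , polynomial-zero , λ t →
    solve 1 (λ t → con (+ 1) := con (+ 1) :+ t :* (con (+ 1) :* con (+ 0)) :+ t :* t :* con (+ 0)) refl t
  product-firstOrder {suc n} r μ nz with product-firstOrder r (μ ∘ suc) (nz ∘ suc)
  ... | d , h , h-poly , expand = suc d , h⁺ , h⁺-poly , expand⁺
    where
    ν = μ zero + r
    P = product (λ i → - (μ (suc i) + r))
    S = ∑[ i < n ] inverse (nz (suc i))

    h⁺ : Carrier → Carrier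
    -- The part of degree at least 2 in (-ν - t)(P + t P S + t² h), divided by t².
    h⁺ t = - (P * S) + (- ν * h t + t * (- 1# * h t))

    h⁺-poly : Polynomial (suc d) h⁺
    h⁺-poly = polynomial-+ (polynomial-const _)
      (polynomial-+ (polynomial-scale (- ν) (polynomial-weaken h-poly))
                    (polynomial-*t (polynomial-scale (- 1#) h-poly)))

    expand⁺ : ∀ t → (- (r + t) - μ zero) * product (λ i → - (r + t) - μ (suc i)) ≈
                    - ν * P + t * (- ν * P * (inverse (nz zero) + S)) + t * t * h⁺ t
    expand⁺ t = begin
      (- (r + t) - μ zero) * product (λ i → - (r + t) - μ (suc i))
        ≈⟨ *-congˡ (expand t) ⟩
      (- (r + t) - μ zero) * (P + t * (P * S) + t * t * h t)
        ≈⟨ solve 6 (λ r t m p s h →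
             (:- (r :+ t) :- m) :* (p :+ t :* (p :* s) :+ t :* t :* h)
               := :- (m :+ r) :* p :+ t :* (:- con (+ 1) :* p :- (m :+ r) :* p :* s)
                  :+ t :* t :* (:- (p :* s) :+ (:- (m :+ r) :* h :+ t :* (:- con (+ 1) :* h))))
             refl r t (μ zero) P S (h t) ⟩
      - ν * P + t * (- 1# * P - ν * P * S) + t * t * h⁺ t
        ≈⟨ +-congʳ (+-congˡ (*-congˡ (+-congʳ (*-congʳ (-‿cong (sym (inverse-* (nz zero)))))))) ⟩
      - ν * P + t * (- (inverse (nz zero) * ν) * P - ν * P * S) + t * t * h⁺ t
        ≈⟨ +-congʳ (+-congˡ (*-congˡ (solve 4 (λ i v p s → :- (i :* v) :* p :- v :* p :* s := :- v :* p :* (i :+ s))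
             refl (inverse (nz zero)) ν P S))) ⟩
      - ν * P + t * (- ν * P * (inverse (nz zero) + S)) + t * t * h⁺ t ∎

  -- Both sides are the logarithmic derivative at 0 of det (- t I - (L + r I)).
  module _ {n} {L : Matrix n} {μ : Fin n → Carrier} (spectrum : IsSpectrumOf μ L)
           (r : Carrier) (X : Matrix n) where

    private
      A : Matrix n
      A i j = - (L ⊞ r · 𝕀) i j

      det≈product : ∀ t → det (λ i j → A i j + t * - 𝕀 i j) ≈ product (λ i → - (r + t) - μ i)
      det≈product t = trans
        (det-cong (λ i j → solve 4 (λ l r t e → :- (l :+ r :* e) :+ t :* :- e := :- (r :+ t) :* e :- l) refl
          (L i j) r t (𝕀 i j)))
        (spectrum (- (r + t)))

      det≈product₀ : det A ≈ product (λ i → - (μ i + r))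
      det≈product₀ = begin
        det A
          ≈⟨ det-cong (λ i j → solve 2 (λ a e → a := a :+ con (+ 0) :* e) refl (A i j) (- 𝕀 i j)) ⟩
        det (λ i j → A i j + 0# * - 𝕀 i j)
          ≈⟨ det≈product 0# ⟩
        product (λ i → - (r + 0#) - μ i)
          ≈⟨ product-cong (λ i → solve 2 (λ r m → :- (r :+ con (+ 0)) :- m := :- (m :+ r)) refl r (μ i)) ⟩
        product (λ i → - (μ i + r)) ∎

    -- The spectrum is given only through the characteristic polynomial, whose value at -r is the
    -- product of the -(μᵢ + r); a factor of an invertible product is invertible.
    shifted-eigenvalues-#0 : det A # 0# → ∀ i → μ i + r # 0#
    shifted-eigenvalues-#0 det#0 i =
      neg-#0 (product-#0 (λ i → - (μ i + r)) (#-congʳ det≈product₀ det#0) i)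

    sum-inverse-eigenvalues : X ⊡ (L ⊞ r · 𝕀) ≋ 𝕀 → det A # 0# → (nz : ∀ i → μ i + r # 0#) →
                              ∑[ i < n ] inverse (nz i) ≈ tr X
    sum-inverse-eigenvalues XC≋𝕀 det#0 nz = *-cancelˡ det#0 (begin
      det A * ∑[ i < n ] inverse (nz i)
        ≈⟨ *-congʳ det≈product₀ ⟩
      product (λ i → - (μ i + r)) * ∑[ i < n ] inverse (nz i)
        ≈⟨ proj₂ (firstOrder-unique (product-firstOrder r μ nz) det-firstOrder) ⟩
      ∑[ i < n ] det (A [ i ≔ (λ j → - 𝕀 i j) ])
        -- As X inverts -A, the replacing row is row i of `X ⊡ A`, so the i-th determinant is X i i
        -- times det A.
        ≈⟨ sum-cong-≋ (λ i → trans (det-cong (row i)) (det-row-combination A X i)) ⟩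
      ∑[ i < n ] (X i i * det A)
        ≈⟨ *-distribʳ-sum (det A) (λ i → X i i) ⟨
      tr X * det A
        ≈⟨ *-comm _ _ ⟩
      det A * tr X ∎)
      where
      det-firstOrder : FirstOrder (λ t → product (λ i → - (r + t) - μ i)) (det A)
                                  (∑[ i < n ] det (A [ i ≔ (λ j → - 𝕀 i j) ]))
      det-firstOrder with det-expansion A (λ i j → - 𝕀 i j)
      ... | h , h-poly , expand = n , h , h-poly , λ t → trans (sym (det≈product t)) (expand t)

      XA≈-𝕀 : ∀ i j → (X ⊡ A) i j ≈ - 𝕀 i j
      XA≈-𝕀 i j = begin
        ∑[ k < n ] (X i k * A k j)
          ≈⟨ sum-cong-≋ (λ k → sym (-‿distribʳ-* (X i k) _)) ⟩
        ∑[ k < n ] (- (X i k * (L ⊞ r · 𝕀) k j))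
          ≈⟨ sum-neg (λ k → X i k * (L ⊞ r · 𝕀) k j) ⟩
        - (X ⊡ (L ⊞ r · 𝕀)) i j
          ≈⟨ -‿cong (XC≋𝕀 i j) ⟩
        - 𝕀 i j ∎

      row : ∀ i k j → (A [ i ≔ (λ j → - 𝕀 i j) ]) k j ≈ (A [ i ≔ (X ⊡ A) i ]) k j
      row i k j with k ≟ i
      ... | yes ≡.refl = trans (≔-this A i _ j) (trans (sym (XA≈-𝕀 i j)) (sym (≔-this A i _ j)))
      ... | no  k≢i    = trans (≔-other A i _ k k≢i j) (sym (≔-other A i _ k k≢i j))

  -- Networks

  -- The nonnegative and the positive rationals inside K.
  NonNegative : Carrier → Set ℓ₁
  NonNegative x = ∃[ p ] ∃[ q ] x * fromℕ (suc q) ≈ fromℕ p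

  Positive : Carrier → Set ℓ₁
  Positive x = ∃[ p ] ∃[ q ] x * fromℕ (suc q) ≈ fromℕ (suc p)

  positive⇒nonNegative : ∀ {x} → Positive x → NonNegative x
  positive⇒nonNegative (p , q , xq≈p) = suc p , q , xq≈p

  fraction-+ : ∀ {x y} p q r s → x * fromℕ (suc q) ≈ fromℕ p → y * fromℕ (suc s) ≈ fromℕ r →
               (x + y) * fromℕ (suc q ℕ.* suc s) ≈ fromℕ (p ℕ.* suc s ℕ.+ r ℕ.* suc q)
  fraction-+ {x} {y} p q r s xq≈p ys≈r = begin
    (x + y) * fromℕ (suc q ℕ.* suc s)
      ≈⟨ *-congˡ (fromℕ-* (suc q) (suc s)) ⟩
    (x + y) * (fromℕ (suc q) * fromℕ (suc s))
      ≈⟨ solve 4 (λ x y q s → (x :+ y) :* (q :* s) := x :* q :* s :+ y :* s :* q)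
           refl x y (fromℕ (suc q)) (fromℕ (suc s)) ⟩
    x * fromℕ (suc q) * fromℕ (suc s) + y * fromℕ (suc s) * fromℕ (suc q)
      ≈⟨ +-cong (*-congʳ xq≈p) (*-congʳ ys≈r) ⟩
    fromℕ p * fromℕ (suc s) + fromℕ r * fromℕ (suc q)
      ≈⟨ +-cong (fromℕ-* p (suc s)) (fromℕ-* r (suc q)) ⟨
    fromℕ (p ℕ.* suc s) + fromℕ (r ℕ.* suc q)
      ≈⟨ fromℕ-+ (p ℕ.* suc s) (r ℕ.* suc q) ⟨
    fromℕ (p ℕ.* suc s ℕ.+ r ℕ.* suc q) ∎

  fraction-* : ∀ {x y} p q r s → x * fromℕ (suc q) ≈ fromℕ p → y * fromℕ (suc s) ≈ fromℕ r →
               x * y * fromℕ (suc q ℕ.* suc s) ≈ fromℕ (p ℕ.* r)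
  fraction-* {x} {y} p q r s xq≈p ys≈r = begin
    x * y * fromℕ (suc q ℕ.* suc s)
      ≈⟨ *-congˡ (fromℕ-* (suc q) (suc s)) ⟩
    x * y * (fromℕ (suc q) * fromℕ (suc s))
      ≈⟨ solve 4 (λ x y q s → x :* y :* (q :* s) := x :* q :* (y :* s))
           refl x y (fromℕ (suc q)) (fromℕ (suc s)) ⟩
    x * fromℕ (suc q) * (y * fromℕ (suc s))
      ≈⟨ *-cong xq≈p ys≈r ⟩
    fromℕ p * fromℕ r
      ≈⟨ fromℕ-* p r ⟨
    fromℕ (p ℕ.* r) ∎

  nonNegative-+ : ∀ {x y} → NonNegative x → NonNegative y → NonNegative (x + y)
  nonNegative-+ (p , q , x≈) (r , s , y≈) =
    -- The second number is the predecessor of `suc q * suc s`, by computation; the same device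
    -- recurs below.
    p ℕ.* suc s ℕ.+ r ℕ.* suc q , s ℕ.+ q ℕ.* suc s , fraction-+ p q r s x≈ y≈

  nonNegative-* : ∀ {x y} → NonNegative x → NonNegative y → NonNegative (x * y)
  nonNegative-* (p , q , x≈) (r , s , y≈) =
    p ℕ.* r , s ℕ.+ q ℕ.* suc s , fraction-* p q r s x≈ y≈

  positive-+ˡ : ∀ {x y} → Positive x → NonNegative y → Positive (x + y)
  positive-+ˡ (p , q , x≈) (r , s , y≈) =
    s ℕ.+ p ℕ.* suc s ℕ.+ r ℕ.* suc q , s ℕ.+ q ℕ.* suc s , fraction-+ (suc p) q r s x≈ y≈

  positive-cong : ∀ {x y} → x ≈ y → Positive x → Positive y
  positive-cong x≈y (p , q , x≈) = p , q , trans (*-congʳ (sym x≈y)) x≈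

  positive-+ʳ : ∀ {x y} → NonNegative x → Positive y → Positive (x + y)
  positive-+ʳ x≥0 y>0 = positive-cong (+-comm _ _) (positive-+ˡ y>0 x≥0)

  positive-* : ∀ {x y} → Positive x → Positive y → Positive (x * y)
  positive-* (p , q , x≈) (r , s , y≈) =
    r ℕ.+ p ℕ.* suc r , s ℕ.+ q ℕ.* suc s , fraction-* (suc p) q (suc r) s x≈ y≈

  positive-fromℕ : ∀ n .{{_ : NonZero n}} → Positive (fromℕ n)
  positive-fromℕ (suc n) = n , 0 , solve 1 (λ x → x :* (con (+ 1) :+ con (+ 0)) := x) refl (fromℕ (suc n))

  positive-1# : Positive 1#
  positive-1# = positive-cong (+-identityʳ 1#) (positive-fromℕ 1)

  nonNegative-indicator : ∀ b → NonNegative (indicator b)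
  nonNegative-indicator true  = positive⇒nonNegative positive-1#
  nonNegative-indicator false = 0 , 0 , zeroˡ _

  nonNegative-sum : ∀ {n} (f : Fin n → Carrier) → (∀ i → NonNegative (f i)) → NonNegative (sum f)
  nonNegative-sum {zero}  f f≥0 = 0 , 0 , zeroˡ _
  nonNegative-sum {suc n} f f≥0 = nonNegative-+ (f≥0 zero) (nonNegative-sum (f ∘ suc) (f≥0 ∘ suc))

  positive-sum : ∀ {n} (f : Fin n → Carrier) → (∀ i → NonNegative (f i)) → ∀ i → Positive (f i) → Positive (sum f)
  positive-sum f f≥0 zero    f₀>0 = positive-+ˡ f₀>0 (nonNegative-sum (f ∘ suc) (f≥0 ∘ suc))
  positive-sum f f≥0 (suc i) fᵢ>0 = positive-+ʳ (f≥0 zero) (positive-sum (f ∘ suc) (f≥0 ∘ suc) i fᵢ>0)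

  -- In characteristic zero the numerator is invertible, and x is a factor of it.
  positive⇒#0 : ∀ {x} → Positive x → x # 0#
  positive⇒#0 (p , q , xq≈p) = *-#0ˡ (#-congʳ (sym xq≈p) (char0 (suc p)))

  positive-inverse : ∀ {x} (x>0 : Positive x) → Positive (inverse (positive⇒#0 x>0))
  positive-inverse {x} x>0@(p , q , xq≈p) = q , p , (begin
    y * fromℕ (suc p)         ≈⟨ *-congˡ xq≈p ⟨
    y * (x * fromℕ (suc q))   ≈⟨ *-assoc _ _ _ ⟨
    y * x * fromℕ (suc q)     ≈⟨ *-congʳ (inverse-* (positive⇒#0 x>0)) ⟩
    1# * fromℕ (suc q)        ≈⟨ *-identityˡ _ ⟩
    fromℕ (suc q)             ∎)
    where y = inverse (positive⇒#0 x>0)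

  -- A network of conductances w between n nodes and g from the nodes to the ground.
  record Network (n : ℕ) : Set (c ⊔ ℓ₁) where
    field
      w   : Matrix n
      g   : Fin n → Carrier
      w≥0 : ∀ x y → NonNegative (w x y)
      g≥0 : ∀ x → NonNegative (g x)

  module _ {n} (N : Network n) where

    open Network N

    data Grounded : Fin n → Set (c ⊔ ℓ₁) where
      ground : ∀ {x} → Positive (g x) → Grounded x
      step   : ∀ {x y} → Positive (w x y) → Grounded y → Grounded x

    current : (Fin n → Carrier) → Fin n → Carrier
    current φ x = ∑[ y < n ] (w x y * (φ x - φ y)) + g x * φ x

    conductance : Fin n → Carrier
    conductance x = sum (w x) + g x

    -- The sign matches the matrix -C in the characteristic polynomial. Loops `w x x`, which node
    -- elimination creates, cancel on the diagonal.
    negativeLaplacian : Matrix n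
    negativeLaplacian x y = w x y - 𝕀 x y * conductance x

  -- Kron reduction: node 0 is replaced by the conductances it induces between
  -- its neighbours.
  module Reduction {n} (N : Network (suc n)) (grounded : ∀ x → Grounded N x) where

    open Network N

    -- Unlike `conductance` it leaves out the loop at node 0, which carries no current; its negative
    -- is the pivot of `negativeLaplacian`.
    conductance₀ : Carrier
    conductance₀ = sum (w zero ∘ suc) + g zero

    private
      -- The path from node 0 to the ground must leave this node along a positive conductance; loops
      -- before that are skipped.
      positive₀ : Grounded N zero → Positive conductance₀
      positive₀ (ground g>0)           = positive-+ʳ (nonNegative-sum (w zero ∘ suc) (w≥0 zero ∘ suc)) g>0
      positive₀ (step {y = zero} _ p)  = positive₀ p
      positive₀ (step {y = suc y} w>0 _) = positive-+ˡ (positive-sum (w zero ∘ suc) (w≥0 zero ∘ suc) y w>0) (g≥0 zero)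

    conductance₀>0 : Positive conductance₀
    conductance₀>0 = positive₀ (grounded zero)

    e : Carrier
    e = inverse (positive⇒#0 conductance₀>0)

    e*conductance₀ : e * conductance₀ ≈ 1#
    e*conductance₀ = inverse-* (positive⇒#0 conductance₀>0)

    e>0 : Positive e
    e>0 = positive-inverse conductance₀>0

    private
      induced≥0 : ∀ {x y} → NonNegative x → NonNegative y → NonNegative (x * e * y)
      induced≥0 x≥0 y≥0 = nonNegative-* (nonNegative-* x≥0 (positive⇒nonNegative e>0)) y≥0

      induced>0 : ∀ {x y} → Positive x → Positive y → Positive (x * e * y)
      induced>0 x>0 y>0 = positive-* (positive-* x>0 e>0) y>0

    reduced : Network n
    reduced = record
      { w   = λ x y → w (suc x) (suc y) + w (suc x) zero * e * w zero (suc y)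
      ; g   = λ x → g (suc x) + w (suc x) zero * e * g zero
      ; w≥0 = λ x y → nonNegative-+ (w≥0 _ _) (induced≥0 (w≥0 _ _) (w≥0 _ _))
      ; g≥0 = λ x → nonNegative-+ (g≥0 _) (induced≥0 (w≥0 _ _) (g≥0 _))
      }

    private
      -- A passage of the path through node 0 is bridged by the induced conductance: `grounded-zero`
      -- remembers the conductance into node 0 until the path leaves it.
      grounded-suc  : ∀ {x} → Grounded N (suc x) → Grounded reduced x
      grounded-zero : ∀ {x} → Positive (w (suc x) zero) → Grounded N zero → Grounded reduced x

      grounded-suc (ground g>0)             = ground (positive-+ˡ g>0 (induced≥0 (w≥0 _ _) (g≥0 _)))
      grounded-suc (step {y = zero}  w>0 p) = grounded-zero w>0 p
      grounded-suc (step {y = suc y} w>0 p) = step (positive-+ˡ w>0 (induced≥0 (w≥0 _ _) (w≥0 _ _))) (grounded-suc p)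

      grounded-zero x0>0 (ground g>0)             = ground (positive-+ʳ (g≥0 _) (induced>0 x0>0 g>0))
      grounded-zero x0>0 (step {y = zero}  w>0 p) = grounded-zero x0>0 p
      grounded-zero x0>0 (step {y = suc y} w>0 p) = step (positive-+ʳ (w≥0 _ _) (induced>0 x0>0 w>0)) (grounded-suc p)

    reduced-grounded : ∀ x → Grounded reduced x
    reduced-grounded x = grounded-suc (grounded (suc x))

    -- The conductance from x to node 0 is redistributed over the neighbours of node 0 and the
    -- ground, in shares that add up to `e * conductance₀`, which is 1.
    reduced-conductance : ∀ x → conductance reduced x ≈ conductance N (suc x)
    reduced-conductance x = begin
      ∑[ y < n ] (w (suc x) (suc y) + w (suc x) zero * e * w zero (suc y)) + (g (suc x) + w (suc x) zero * e * g zero)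
        ≈⟨ +-congʳ (sum-linear _ (w (suc x) ∘ suc) (w zero ∘ suc) (w (suc x) zero * e) (λ y → refl)) ⟩
      s + w (suc x) zero * e * t + (g (suc x) + w (suc x) zero * e * g zero)
        ≈⟨ solve 6 (λ s u e t g h → s :+ u :* e :* t :+ (g :+ u :* e :* h) := s :+ u :* (e :* (t :+ h)) :+ g)
             refl
             s (w (suc x) zero) e t (g (suc x)) (g zero) ⟩
      s + w (suc x) zero * (e * (t + g zero)) + g (suc x)
        ≈⟨ +-congʳ (trans (+-congˡ (trans (*-congˡ e*conductance₀) (*-identityʳ _))) (+-comm _ _)) ⟩
      w (suc x) zero + s + g (suc x) ∎
      where
      s = sum (w (suc x) ∘ suc)
      t = sum (w zero ∘ suc)

  solve-network : ∀ {n} (N : Network n) → (∀ x → Grounded N x) →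
                  ∀ (b : Fin n → Carrier) → ∃[ φ ] (∀ x → current N φ x ≈ b x)
  solve-network {zero}  N grounded b = (λ ()) , λ ()
  solve-network {suc n} N grounded b = φ , solves
    where
    open Network N
    open Reduction N grounded

    IH : ∃[ φ ] (∀ x → current reduced φ x ≈ b (suc x) + w (suc x) zero * e * b zero)
    -- The current b zero injected at node 0 is passed on to the other nodes in shares
    -- `w (suc x) zero * e`.
    IH = solve-network reduced reduced-grounded (λ x → b (suc x) + w (suc x) zero * e * b zero)

    ψ : Fin n → Carrier
    ψ = proj₁ IH

    flow φ₀ : Carrier
    flow = ∑[ y < n ] (w zero (suc y) * ψ y)
    -- The potential that balances the currents at node 0, given those of its neighbours.
    φ₀   = e * (b zero + flow)

    φ : Fin (suc n) → Carrier
    φ = φ₀ ∷ ψ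

    differences : ∀ x → ∑[ y < n ] (w zero (suc y) * (x - ψ y)) ≈ sum (w zero ∘ suc) * x - flow
    differences x = begin
      ∑[ y < n ] (w zero (suc y) * (x - ψ y))
        ≈⟨ sum-cong-≋ (λ y → solve 3 (λ w x p → w :* (x :- p) := w :* x :- w :* p)
             refl (w zero (suc y)) x (ψ y)) ⟩
      ∑[ y < n ] (w zero (suc y) * x - w zero (suc y) * ψ y)
        ≈⟨ sum-sub (λ y → w zero (suc y) * x) (λ y → w zero (suc y) * ψ y) ⟩
      ∑[ y < n ] (w zero (suc y) * x) - flow
        ≈⟨ +-congʳ (*-distribʳ-sum x (w zero ∘ suc)) ⟨
      sum (w zero ∘ suc) * x - flow ∎

    solves : ∀ x → current N φ x ≈ b x
    solves zero = begin
      w zero zero * (φ₀ - φ₀) + ∑[ y < n ] (w zero (suc y) * (φ₀ - ψ y)) + g zero * φ₀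
        ≈⟨ +-congʳ (+-congˡ (differences φ₀)) ⟩
      w zero zero * (φ₀ - φ₀) + (t * φ₀ - flow) + g zero * φ₀
        ≈⟨ solve 6 (λ w t g f e b →
             w :* (e :* (b :+ f) :- e :* (b :+ f)) :+ (t :* (e :* (b :+ f)) :- f) :+ g :* (e :* (b :+ f))
               := e :* (t :+ g) :* (b :+ f) :- f)
             refl (w zero zero) t (g zero) flow e (b zero) ⟩
      e * conductance₀ * (b zero + flow) - flow
        ≈⟨ +-congʳ (*-congʳ e*conductance₀) ⟩
      1# * (b zero + flow) - flow
        ≈⟨ solve 2 (λ b f → con (+ 1) :* (b :+ f) :- f := b) refl (b zero) flow ⟩
      b zero ∎
      where t = sum (w zero ∘ suc)
    solves (suc x) = begin
      u * (ψ x - φ₀) + s + g (suc x) * ψ x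
        ≈⟨ solve 7 (λ u p e b f s g →
             u :* (p :- e :* (b :+ f)) :+ s :+ g :* p
               := s :+ u :* (con (+ 1) :* p :- e :* f) :+ g :* p :- u :* e :* b)
             refl u (ψ x) e (b zero) flow s (g (suc x)) ⟩
      s + u * (1# * ψ x - e * flow) + g (suc x) * ψ x - u * e * b zero
        -- Writing 1 as `e * conductance₀` splits the current towards node 0 into the induced
        -- currents between nodes and the induced leak to the ground.
        ≈⟨ +-congʳ (+-congʳ (+-congˡ (*-congˡ (+-congʳ (*-congʳ e*conductance₀))))) ⟨
      s + u * (e * conductance₀ * ψ x - e * flow) + g (suc x) * ψ x - u * e * b zero
        ≈⟨ solve 9 (λ s u e t h p f g b →
             s :+ u :* (e :* (t :+ h) :* p :- e :* f) :+ g :* p :- u :* e :* b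
               := s :+ u :* e :* (t :* p :- f) :+ (g :+ u :* e :* h) :* p :- u :* e :* b)
             refl s u e (sum (w zero ∘ suc)) (g zero) (ψ x) flow (g (suc x)) (b zero) ⟩
      s + u * e * (sum (w zero ∘ suc) * ψ x - flow) + (g (suc x) + u * e * g zero) * ψ x - u * e * b zero
        ≈⟨ +-congʳ (+-congʳ (+-congˡ (*-congˡ (differences (ψ x))))) ⟨
      s + u * e * ∑[ y < n ] (w zero (suc y) * (ψ x - ψ y)) + (g (suc x) + u * e * g zero) * ψ x - u * e * b zero
        ≈⟨ +-congʳ (+-congʳ (sum-linear (λ y → Network.w reduced x y * (ψ x - ψ y))
             (λ y → w (suc x) (suc y) * (ψ x - ψ y))
             (λ y → w zero (suc y) * (ψ x - ψ y)) (u * e)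
             (λ y → solve 4 (λ v k z p → (v :+ k :* z) :* p := v :* p :+ k :* (z :* p)) refl
                (w (suc x) (suc y)) (u * e) (w zero (suc y)) (ψ x - ψ y)))) ⟨
      current reduced ψ x - u * e * b zero
        ≈⟨ +-congʳ (proj₂ IH x) ⟩
      b (suc x) + u * e * b zero - u * e * b zero
        ≈⟨ solve 2 (λ b u → b :+ u :- u := b) refl (b (suc x)) (u * e * b zero) ⟩
      b (suc x) ∎
      where
      u s : Carrier
      u = w (suc x) zero
      s = ∑[ y < n ] (w (suc x) (suc y) * (ψ x - ψ y))

  -- The Schur complement at node 0 is the matrix of the reduced network, so the determinant is a
  -- product of pivots, each the negative of a positive rational.
  det-negativeLaplacian-#0 : ∀ {n} (N : Network n) → (∀ x → Grounded N x) → det (negativeLaplacian N) # 0#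
  det-negativeLaplacian-#0 {zero}  N grounded = 1#0
  det-negativeLaplacian-#0 {suc n} N grounded =
    #-congʳ (sym det≈) (x#0y#0→xy#0 A₀₀#0 (det-negativeLaplacian-#0 reduced reduced-grounded))
    where
    open Network N
    open Reduction N grounded

    A : Matrix (suc n)
    A = negativeLaplacian N

    A₀₀≈ : A zero zero ≈ - conductance₀
    A₀₀≈ = solve 3 (λ w t g → w :- con (+ 1) :* (w :+ t :+ g) := :- (t :+ g)) refl
             (w zero zero) (sum (w zero ∘ suc)) (g zero)

    A₀₀#0 : A zero zero # 0#
    A₀₀#0 = invertible {y = - e} (begin
      - e * A zero zero       ≈⟨ *-congˡ A₀₀≈ ⟩
      - e * - conductance₀    ≈⟨ solve 2 (λ e d → :- e :* :- d := e :* d) refl e conductance₀ ⟩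
      e * conductance₀        ≈⟨ e*conductance₀ ⟩
      1#                      ∎)

    multiplier : Fin n → Carrier
    multiplier x = - (w (suc x) zero * e)

    A⋅₀≈ : ∀ x → A (suc x) zero ≈ multiplier x * A zero zero
    A⋅₀≈ x = begin
      w (suc x) zero - 0# * conductance N (suc x)
        ≈⟨ solve 2 (λ w t → w :- con (+ 0) :* t := w :* con (+ 1))
             refl (w (suc x) zero) (conductance N (suc x)) ⟩
      w (suc x) zero * 1#
        ≈⟨ *-congˡ e*conductance₀ ⟨
      w (suc x) zero * (e * conductance₀)
        ≈⟨ solve 3 (λ w e d → w :* (e :* d) := :- (w :* e) :* :- d) refl (w (suc x) zero) e conductance₀ ⟩
      multiplier x * - conductance₀
        ≈⟨ *-congˡ A₀₀≈ ⟨
      multiplier x * A zero zero ∎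

    det≈ : det A ≈ A zero zero * det (negativeLaplacian reduced)
    det≈ = trans (det-schur A multiplier A⋅₀≈) (*-congˡ (det-cong λ x y → begin
      w (suc x) (suc y) - 𝕀 (suc x) (suc y) * conductance N (suc x)
        - multiplier x * (w zero (suc y) - 0# * conductance N zero)
        ≈⟨ +-congʳ (+-congˡ (-‿cong (*-cong (𝕀-suc x y) (sym (reduced-conductance x))))) ⟩
      w (suc x) (suc y) - 𝕀 x y * conductance reduced x - multiplier x * (w zero (suc y) - 0# * conductance N zero)
        ≈⟨ solve 5 (λ w i u z t → w :- i :- :- u :* (z :- con (+ 0) :* t) := w :+ u :* z :- i) refl
             (w (suc x) (suc y)) (𝕀 x y * conductance reduced x) (w (suc x) zero * e) (w zero (suc y)) (conductance N zero) ⟩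
      negativeLaplacian reduced x y ∎))

  -- Laplacians and incidence of graphs

  before : ∀ {n} → Fin n → Fin n → Carrier
  before u v = indicator ⌊ u <? v ⌋

  -- Exactly one of u < v and v < u holds, except on the diagonal, where z vanishes.
  before-either : ∀ {n} (u v : Fin n) {z} → (u ≡ v → z ≈ 0#) → (before u v + before v u) * z ≈ z
  before-either u v {z} z≈0 with u <? v | v <? u
  ... | yes u<v | yes v<u = contradiction v<u (<-asym u<v)
  ... | yes u<v | no  _   = solve 1 (λ z → (con (+ 1) :+ con (+ 0)) :* z := z) refl z
  ... | no  _   | yes v<u = solve 1 (λ z → (con (+ 0) :+ con (+ 1)) :* z := z) refl z
  ... | no  u≮v | no  v≮u with <-cmp u v
  ...   | tri< u<v _ _ = contradiction u<v u≮v
  ...   | tri≈ _ u≡v _ = trans (*-congˡ (z≈0 u≡v)) (trans (zeroʳ _) (sym (z≈0 u≡v)))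
  ...   | tri> _ _ v<u = contradiction v<u v≮u

  -- Passes between sums over unordered pairs, as in the Kirchhoff index and the edge list, and full
  -- double sums, as in matrix algebra.
  sum-before : ∀ {n} (f : Fin n → Fin n → Carrier) → (∀ u → f u u ≈ 0#) →
               ∑[ u < n ] ∑[ v < n ] (before u v * (f u v + f v u)) ≈ ∑[ u < n ] ∑[ v < n ] f u v
  sum-before {n} f f≈0 = begin
    ∑[ u < n ] ∑[ v < n ] (before u v * (f u v + f v u))
      ≈⟨ sum-cong-≋ (λ u → trans (sum-cong-≋ (λ v → distribˡ (before u v) (f u v) (f v u)))
                                   (∑-distrib-+ (λ v → before u v * f u v) (λ v → before u v * f v u))) ⟩
    ∑[ u < n ] (∑[ v < n ] (before u v * f u v) + ∑[ v < n ] (before u v * f v u))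
      ≈⟨ ∑-distrib-+ (λ u → ∑[ v < n ] (before u v * f u v)) (λ u → ∑[ v < n ] (before u v * f v u)) ⟩
    ∑[ u < n ] ∑[ v < n ] (before u v * f u v) + ∑[ u < n ] ∑[ v < n ] (before u v * f v u)
      ≈⟨ +-congˡ (∑-comm (λ u v → before u v * f v u)) ⟩
    ∑[ u < n ] ∑[ v < n ] (before u v * f u v) + ∑[ u < n ] ∑[ v < n ] (before v u * f u v)
      ≈⟨ ∑-distrib-+ (λ u → ∑[ v < n ] (before u v * f u v)) (λ u → ∑[ v < n ] (before v u * f u v)) ⟨
    ∑[ u < n ] (∑[ v < n ] (before u v * f u v) + ∑[ v < n ] (before v u * f u v))
      ≈⟨ sum-cong-≋ (λ u → trans (sym (∑-distrib-+ (λ v → before u v * f u v) (λ v → before v u * f u v)))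
           (sum-cong-≋ (λ v → trans (sym (distribʳ (f u v) _ _))
             (before-either u v (λ { ≡.refl → f≈0 u }))))) ⟩
    ∑[ u < n ] ∑[ v < n ] f u v ∎

  module _ {n} (G : Graph n) where

    adjacency-sym : ∀ u v → adjacency G u v ≈ adjacency G v u
    adjacency-sym u v = reflexive (≡.cong indicator (adj-sym G u v))

    adjacency-diag : ∀ v → adjacency G v v ≈ 0#
    adjacency-diag v = reflexive (≡.cong indicator (adj-irrefl G v))

    fromℕ-degree : ∀ v → fromℕ (degree G v) ≈ ∑[ u < n ] adjacency G v u
    fromℕ-degree v = fromℕ-count (adj G v)
      where
      fromℕ-count : ∀ {n} (p : Fin n → Bool) → fromℕ ∣ tabulate p ∣ ≈ ∑[ u < n ] indicator (p u)
      fromℕ-count {zero}  p = refl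
      fromℕ-count {suc n} p with p zero
      ... | true  = +-congˡ (fromℕ-count (p ∘ suc))
      ... | false = trans (fromℕ-count (p ∘ suc)) (sym (+-identityˡ _))

    -- The Laplacian applied to φ, written as net current so that it agrees with both
    -- `IsUnitPotential` and `current`.
    divergence : (Fin n → Carrier) → Fin n → Carrier
    divergence φ x = ∑[ y < n ] (adjacency G x y * (φ x - φ y))

    divergence-sub : ∀ φ ψ x → divergence (λ y → φ y - ψ y) x ≈ divergence φ x - divergence ψ x
    divergence-sub φ ψ x = trans
      (sum-cong-≋ (λ y → solve 5 (λ a p q r s → a :* (p :- q :- (r :- s)) := a :* (p :- r) :- a :* (q :- s))
        refl
        (adjacency G x y) (φ x) (ψ x) (φ y) (ψ y)))
      (sum-sub (λ y → adjacency G x y * (φ x - φ y)) (λ y → adjacency G x y * (ψ x - ψ y)))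

    divergence-selfAdjoint : ∀ φ ψ → ∑[ x < n ] (divergence φ x * ψ x) ≈ ∑[ x < n ] (divergence ψ x * φ x)
    divergence-selfAdjoint φ ψ = begin
      ∑[ x < n ] (divergence φ x * ψ x)
        ≈⟨ expand φ ψ ⟩
      ∑[ x < n ] ∑[ y < n ] (a x y * (φ x * ψ x)) - ∑[ x < n ] ∑[ y < n ] (a x y * (φ y * ψ x))
        ≈⟨ +-cong (sum-cong-≋ (λ x → sum-cong-≋ (λ y → *-congˡ {x = a x y} (*-comm (φ x) (ψ x)))))
                  (-‿cong (trans (∑-comm (λ x y → a x y * (φ y * ψ x)))
                    (sum-cong-≋ (λ y → sum-cong-≋ (λ x → *-cong (adjacency-sym x y) (*-comm (φ y) (ψ x))))))) ⟩
      ∑[ x < n ] ∑[ y < n ] (a x y * (ψ x * φ x)) - ∑[ x < n ] ∑[ y < n ] (a x y * (ψ y * φ x))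
        ≈⟨ expand ψ φ ⟨
      ∑[ x < n ] (divergence ψ x * φ x) ∎
      where
      a = adjacency G

      expand : ∀ φ ψ → ∑[ x < n ] (divergence φ x * ψ x) ≈
               ∑[ x < n ] ∑[ y < n ] (a x y * (φ x * ψ x)) - ∑[ x < n ] ∑[ y < n ] (a x y * (φ y * ψ x))
      expand φ ψ = begin
        ∑[ x < n ] (divergence φ x * ψ x)
          ≈⟨ sum-cong-≋ (λ x → *-distribʳ-sum (ψ x) (λ y → a x y * (φ x - φ y))) ⟩
        ∑[ x < n ] ∑[ y < n ] (a x y * (φ x - φ y) * ψ x)
          ≈⟨ sum-cong-≋ (λ x → trans
               (sum-cong-≋ (λ y → solve 4 (λ a p q r → a :* (p :- q) :* r := a :* (p :* r) :- a :* (q :* r))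
                 refl
                 (a x y) (φ x) (φ y) (ψ x)))
               (sum-sub (λ y → a x y * (φ x * ψ x)) (λ y → a x y * (φ y * ψ x)))) ⟩
        ∑[ x < n ] (∑[ y < n ] (a x y * (φ x * ψ x)) - ∑[ y < n ] (a x y * (φ y * ψ x)))
          ≈⟨ sum-sub (λ x → ∑[ y < n ] (a x y * (φ x * ψ x))) (λ x → ∑[ y < n ] (a x y * (φ y * ψ x))) ⟩
        ∑[ x < n ] ∑[ y < n ] (a x y * (φ x * ψ x)) - ∑[ x < n ] ∑[ y < n ] (a x y * (φ y * ψ x)) ∎

    divergence≈ : ∀ φ x → ∑[ y < n ] (if adj G x y then φ x - φ y else 0#) ≈ divergence φ x
    divergence≈ φ x = sum-cong-≋ (λ y → if≈indicator* (adj G x y) (φ x - φ y))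

    -- Reciprocity: pairing the divergence of one potential with the other yields the drop of the
    -- latter, and this pairing is symmetric.
    unitPotential-drop : ∀ {u v φ ψ} → IsUnitPotential G u v φ → IsUnitPotential G u v ψ →
                         φ u - φ v ≈ ψ u - ψ v
    unitPotential-drop {u} {v} {φ} {ψ} φ-unit ψ-unit = begin
      φ u - φ v                            ≈⟨ drop ψ φ ψ-unit ⟨
      ∑[ x < n ] (divergence ψ x * φ x)    ≈⟨ divergence-selfAdjoint ψ φ ⟩
      ∑[ x < n ] (divergence φ x * ψ x)    ≈⟨ drop φ ψ φ-unit ⟩
      ψ u - ψ v                            ∎
      where
      drop : ∀ φ ψ → IsUnitPotential G u v φ → ∑[ x < n ] (divergence φ x * ψ x) ≈ ψ u - ψ v
      drop φ ψ φ-unit = begin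
        ∑[ x < n ] (divergence φ x * ψ x)
          ≈⟨ sum-cong-≋ (λ x → trans (*-congʳ (trans (sym (divergence≈ φ x)) (φ-unit x)))
               (solve 3 (λ a b p → (a :- b) :* p := a :* p :- b :* p) refl (𝕀 x u) (𝕀 x v) (ψ x))) ⟩
        ∑[ x < n ] (𝕀 x u * ψ x - 𝕀 x v * ψ x)
          ≈⟨ sum-sub (λ x → 𝕀 x u * ψ x) (λ x → 𝕀 x v * ψ x) ⟩
        ∑[ x < n ] (𝕀 x u * ψ x) - ∑[ x < n ] (𝕀 x v * ψ x)
          ≈⟨ +-cong (sum-𝕀′ u ψ) (-‿cong (sum-𝕀′ v ψ)) ⟩
        ψ u - ψ v ∎

    -- The columns of X invert the Laplacian up to a multiple of a fixed vector p,
    -- which cancels in the potentials X e_u - X e_v.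
    kirchhoffIndex : (X : Matrix n) (p : Fin n → Carrier) →
                     (∀ u x → divergence (λ y → X y u) x ≈ 𝕀 x u - p x) →
                     ∀ {κ} → κ ≈ fromℕ n * tr X - ∑[ u < n ] ∑[ v < n ] X u v →
                     IsKirchhoffIndex G κ
    kirchhoffIndex X p LX≈ {κ} κ≈ = R , resistance , κ≈∑R
      where
      φ : Fin n → Fin n → Fin n → Carrier
      φ u v x = X x u - X x v

      R : Matrix n
      R u v = φ u v u - φ u v v

      φ-unit : ∀ u v → IsUnitPotential G u v (φ u v)
      φ-unit u v x = begin
        ∑[ y < n ] (if adj G x y then φ u v x - φ u v y else 0#)
          ≈⟨ divergence≈ (φ u v) x ⟩
        divergence (φ u v) x
          ≈⟨ divergence-sub (λ y → X y u) (λ y → X y v) x ⟩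
        divergence (λ y → X y u) x - divergence (λ y → X y v) x
          ≈⟨ +-cong (LX≈ u x) (-‿cong (LX≈ v x)) ⟩
        (𝕀 x u - p x) - (𝕀 x v - p x)
          ≈⟨ solve 3 (λ a b p → (a :- p) :- (b :- p) := a :- b) refl (𝕀 x u) (𝕀 x v) (p x) ⟩
        𝕀 x u - 𝕀 x v ∎

      resistance : ∀ u v → IsResistanceDistance G u v (R u v)
      resistance u v = (φ u v , φ-unit u v) , λ ψ ψ-unit → unitPotential-drop ψ-unit (φ-unit u v)

      -- R u v is f u v + f v u, so the sum over u < v becomes the sum of f over all ordered pairs.
      f : Fin n → Fin n → Carrier
      f u v = X u u - X u v

      κ≈∑R : κ ≈ ∑[ u < n ] ∑[ v < n ] (if ⌊ u <? v ⌋ then R u v else 0#)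
      κ≈∑R = sym (begin
        ∑[ u < n ] ∑[ v < n ] (if ⌊ u <? v ⌋ then R u v else 0#)
          ≈⟨ sum-cong-≋ (λ u → sum-cong-≋ (λ v → trans (if≈indicator* ⌊ u <? v ⌋ (R u v))
               (*-congˡ (solve 4 (λ a b c d → (a :- b) :- (c :- d) := (a :- b) :+ (d :- c)) refl
                          (X u u) (X u v) (X v u) (X v v))))) ⟩
        ∑[ u < n ] ∑[ v < n ] (before u v * (f u v + f v u))
          ≈⟨ sum-before f (λ u → -‿inverseʳ (X u u)) ⟩
        ∑[ u < n ] ∑[ v < n ] f u v
          ≈⟨ sum-cong-≋ (λ u → trans (sum-sub (λ v → X u u) (X u)) (+-congʳ (sum-const {n} (X u u)))) ⟩
        ∑[ u < n ] (fromℕ n * X u u - sum (X u))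
          ≈⟨ sum-sub (λ u → fromℕ n * X u u) (λ u → sum (X u)) ⟩
        ∑[ u < n ] (fromℕ n * X u u) - ∑[ u < n ] ∑[ v < n ] X u v
          ≈⟨ +-congʳ (*-distribˡ-sum (fromℕ n) (λ u → X u u)) ⟨
        fromℕ n * tr X - ∑[ u < n ] ∑[ v < n ] X u v
          ≈⟨ κ≈ ⟨
        κ ∎)

    -- The incidence matrix and sums over the list of edges

    source target : Fin (size G) → Fin n
    source e = proj₁ (lookup (edges G) e)
    target e = proj₂ (lookup (edges G) e)

    incidence : Fin n → Fin (size G) → Carrier
    incidence v e = indicator (incident G v e)

    -- The disjunction in `incident` is a sum because the two ends of a listed edge differ: the list
    -- keeps only pairs with source < target.
    incidence≈ : ∀ v e → incidence v e ≈ 𝕀 v (source e) + 𝕀 v (target e)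
    incidence≈ v e with v ≟ source e | v ≟ target e
    ... | no  _ | no  _ = sym (+-identityʳ 0#)
    ... | no  _ | yes _ = sym (+-identityˡ 1#)
    ... | yes _ | no  _ = sym (+-identityʳ 1#)
    ... | yes p | yes q = contradiction source<target (<-irrefl (≡.trans (≡.sym p) q))
      where
      source<target : source e < target e
      source<target = proj₁ (All.lookup (all-filter edge? (cartesianProduct (allFin n) (allFin n)))
                                        (∈-lookup {xs = edges G} e))
        where edge? = λ ((u , v) : Fin n × Fin n) → (u <? v) ×-dec (adj G u v ≟ᵇ true)

    sum-incidence : ∀ e (y : Fin n → Carrier) → ∑[ v < n ] (incidence v e * y v) ≈ y (source e) + y (target e)
    sum-incidence e y = begin
      ∑[ v < n ] (incidence v e * y v)
        ≈⟨ sum-cong-≋ (λ v → trans (*-congʳ (incidence≈ v e)) (distribʳ (y v) _ _)) ⟩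
      ∑[ v < n ] (𝕀 v (source e) * y v + 𝕀 v (target e) * y v)
        ≈⟨ ∑-distrib-+ (λ v → 𝕀 v (source e) * y v) (λ v → 𝕀 v (target e) * y v) ⟩
      ∑[ v < n ] (𝕀 v (source e) * y v) + ∑[ v < n ] (𝕀 v (target e) * y v)
        ≈⟨ +-cong (sum-𝕀′ (source e) y) (sum-𝕀′ (target e) y) ⟩
      y (source e) + y (target e) ∎

    private
      sumList : ∀ {A : Set} → (A → Carrier) → List A → Carrier
      sumList f = foldr (λ x s → f x + s) 0#

      sum-lookup : ∀ {A : Set} (f : A → Carrier) xs → ∑[ i < length xs ] f (lookup xs i) ≈ sumList f xs
      sum-lookup f []       = refl
      sum-lookup f (x List.∷ xs) = +-congˡ (sum-lookup f xs)

      sumList-filter : ∀ {A : Set} {P : A → Set} (P? : ∀ x → Dec (P x)) (f : A → Carrier) xs →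
                       sumList f (filter P? xs) ≈ sumList (λ x → indicator (does (P? x)) * f x) xs
      sumList-filter P? f []       = refl
      sumList-filter P? f (x List.∷ xs) with does (P? x)
      ... | true  = +-cong (sym (*-identityˡ _)) (sumList-filter P? f xs)
      ... | false = trans (sumList-filter P? f xs) (sym (trans (+-congʳ (zeroˡ _)) (+-identityˡ _)))

      sumList-++ : ∀ {A : Set} (f : A → Carrier) xs ys → sumList f (xs ++ ys) ≈ sumList f xs + sumList f ys
      sumList-++ f []       ys = sym (+-identityˡ _)
      sumList-++ f (x List.∷ xs) ys = trans (+-congˡ (sumList-++ f xs ys)) (sym (+-assoc _ _ _))

      sumList-map : ∀ {A B : Set} (f : B → Carrier) (g : A → B) xs → sumList f (map g xs) ≈ sumList (f ∘ g) xs
      sumList-map f g []       = refl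
      sumList-map f g (x List.∷ xs) = +-congˡ (sumList-map f g xs)

      sumList-cartesianProduct : ∀ {A B : Set} (f : A × B → Carrier) xs ys →
        sumList f (cartesianProduct xs ys) ≈ sumList (λ x → sumList (λ y → f (x , y)) ys) xs
      sumList-cartesianProduct f []       ys = refl
      sumList-cartesianProduct f (x List.∷ xs) ys = trans
        (sumList-++ f (map (x ,_) ys) (cartesianProduct xs ys))
        (+-cong (sumList-map f (x ,_) ys) (sumList-cartesianProduct f xs ys))

      sumList-tabulate : ∀ {A : Set} {n} (f : A → Carrier) (g : Fin n → A) →
                         sumList f (List.tabulate g) ≈ ∑[ i < n ] f (g i)
      sumList-tabulate {n = zero}  f g = refl
      sumList-tabulate {n = suc n} f g = +-congˡ (sumList-tabulate f (g ∘ suc))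

    sum-edges : ∀ (f : Fin n × Fin n → Carrier) →
                ∑[ e < size G ] f (lookup (edges G) e) ≈
                ∑[ u < n ] ∑[ v < n ] (before u v * (adjacency G u v * f (u , v)))
    sum-edges f = begin
      ∑[ e < size G ] f (lookup (edges G) e)
        ≈⟨ sum-lookup f (edges G) ⟩
      sumList f (edges G)
        ≈⟨ sumList-filter edge? f (cartesianProduct (allFin n) (allFin n)) ⟩
      sumList h (cartesianProduct (allFin n) (allFin n))
        ≈⟨ sumList-cartesianProduct h (allFin n) (allFin n) ⟩
      sumList (λ u → sumList (λ v → h (u , v)) (allFin n)) (allFin n)
        ≈⟨ sumList-tabulate (λ u → sumList (λ v → h (u , v)) (allFin n)) (λ u → u) ⟩
      ∑[ u < n ] sumList (λ v → h (u , v)) (allFin n)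
        ≈⟨ sum-cong-≋ (λ u → trans (sumList-tabulate (λ v → h (u , v)) (λ v → v)) (sum-cong-≋ (h≈ u))) ⟩
      ∑[ u < n ] ∑[ v < n ] (before u v * (adjacency G u v * f (u , v))) ∎
      where
      edge? : ∀ (p : Fin n × Fin n) → Dec (proj₁ p < proj₂ p × adj G (proj₁ p) (proj₂ p) ≡ true)
      edge? (u , v) = (u <? v) ×-dec (adj G u v ≟ᵇ true)

      does-≟-true : ∀ b → does (b ≟ᵇ true) ≡ b
      does-≟-true true  = ≡.refl
      does-≟-true false = ≡.refl

      h : Fin n × Fin n → Carrier
      h p = indicator (does (edge? p)) * f p

      h≈ : ∀ u v → h (u , v) ≈ before u v * (adjacency G u v * f (u , v))
      h≈ u v = begin
        indicator (does (u <? v) ∧ does (adj G u v ≟ᵇ true)) * f (u , v)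
          -- `filter` tests with `does`, whereas `before` is defined by `⌊_⌋`.
          ≡⟨ ≡.cong₂ (λ p q → indicator (p ∧ q) * f (u , v)) (≡.sym (isYes≗does (u <? v))) (does-≟-true (adj G u v)) ⟩
        indicator (⌊ u <? v ⌋ ∧ adj G u v) * f (u , v)
          ≈⟨ *-congʳ (indicator-∧ ⌊ u <? v ⌋ (adj G u v)) ⟩
        before u v * adjacency G u v * f (u , v)
          ≈⟨ *-assoc _ _ _ ⟩
        before u v * (adjacency G u v * f (u , v)) ∎

    -- The edges at v correspond to its neighbours. Symmetry of s is required because v may be
    -- either the source or the target in the list.
    sum-incident-edges : ∀ v (s : Fin n → Fin n → Carrier) → (∀ a b → s a b ≈ s b a) →
                         ∑[ e < size G ] (incidence v e * s (source e) (target e)) ≈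
                         ∑[ u < n ] (adjacency G v u * s v u)
    sum-incident-edges v s s-sym = begin
      ∑[ e < size G ] (incidence v e * s (source e) (target e))
        ≈⟨ sum-cong-≋ (λ e → *-congʳ (incidence≈ v e)) ⟩
      ∑[ e < size G ] ((𝕀 v (source e) + 𝕀 v (target e)) * s (source e) (target e))
        ≈⟨ sum-edges (λ (a , b) → (𝕀 v a + 𝕀 v b) * s a b) ⟩
      ∑[ a < n ] ∑[ b < n ] (before a b * (adjacency G a b * ((𝕀 v a + 𝕀 v b) * s a b)))
        ≈⟨ sum-cong-≋ (λ a → sum-cong-≋ (λ b → *-congˡ (split a b))) ⟩
      ∑[ a < n ] ∑[ b < n ] (before a b * (f a b + f b a))
        ≈⟨ sum-before f (λ a → trans (*-congˡ (trans (*-congʳ (adjacency-diag a)) (zeroˡ _))) (zeroʳ _)) ⟩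
      ∑[ a < n ] ∑[ b < n ] (𝕀 v a * (adjacency G a b * s a b))
        ≈⟨ sum-cong-≋ (λ a → *-distribˡ-sum (𝕀 v a) (λ b → adjacency G a b * s a b)) ⟨
      ∑[ a < n ] (𝕀 v a * ∑[ b < n ] (adjacency G a b * s a b))
        ≈⟨ sum-𝕀 v (λ a → ∑[ b < n ] (adjacency G a b * s a b)) ⟩
      ∑[ u < n ] (adjacency G v u * s v u) ∎
      where
      f : Fin n → Fin n → Carrier
      f a b = 𝕀 v a * (adjacency G a b * s a b)

      split : ∀ a b → adjacency G a b * ((𝕀 v a + 𝕀 v b) * s a b) ≈ f a b + f b a
      split a b = begin
        adjacency G a b * ((𝕀 v a + 𝕀 v b) * s a b)
          ≈⟨ solve 4 (λ w x y s → w :* ((x :+ y) :* s) := x :* (w :* s) :+ y :* (w :* s)) refl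
               (adjacency G a b) (𝕀 v a) (𝕀 v b) (s a b) ⟩
        f a b + 𝕀 v b * (adjacency G a b * s a b)
          ≈⟨ +-congˡ (*-congˡ (*-cong (adjacency-sym a b) (s-sym a b))) ⟩
        f a b + f b a ∎

  module _ {n} (G : Graph n) where

    -- A constant potential drives no current, and the divergence is self-adjoint.
    divergence-total : ∀ φ → ∑[ x < n ] divergence G φ x ≈ 0#
    divergence-total φ = begin
      ∑[ x < n ] divergence G φ x
        ≈⟨ sum-cong-≋ (λ x → *-identityʳ (divergence G φ x)) ⟨
      ∑[ x < n ] (divergence G φ x * 1#)
        ≈⟨ divergence-selfAdjoint G φ (const 1#) ⟩
      ∑[ x < n ] (divergence G (const 1#) x * φ x)
        ≈⟨ sum-zero (λ x → trans (*-congʳ (divergence-const x)) (zeroˡ (φ x))) ⟩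
      0# ∎
      where
      divergence-const : ∀ x → divergence G (const 1#) x ≈ 0#
      divergence-const x = sum-zero (λ y → trans (*-congˡ (-‿inverseʳ 1#)) (zeroʳ (adjacency G x y)))

  positive-adjacency : ∀ {n} (G : Graph n) {u v} → Adjacent G u v → Positive (adjacency G u v)
  positive-adjacency G u~v = ≡.subst (λ b → Positive (indicator b)) (≡.sym u~v) positive-1#

  -- Inverses of the grounded and of the shifted Laplacian

  module _ {n} (G : Graph (suc n)) (connected : Connected G) where

    private
      N : Network n
      N = record
        { w   = λ x y → adjacency G (suc x) (suc y)
        ; g   = λ x → adjacency G (suc x) zero
        ; w≥0 = λ x y → nonNegative-indicator (adj G (suc x) (suc y))
        ; g≥0 = λ x → nonNegative-indicator (adj G (suc x) zero)
        }

      path-grounded : ∀ {x} → Star (Adjacent G) (suc x) zero → Grounded N x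
      -- The path is cut where it first reaches vertex zero, which serves as the ground.
      path-grounded (_◅_ {j = zero}  x~0 _) = ground (positive-adjacency G x~0)
      path-grounded (_◅_ {j = suc y} x~y p) = step (positive-adjacency G x~y) (path-grounded p)

      grounded : ∀ x → Grounded N x
      grounded x = path-grounded (connected (suc x) zero)

      potential : ∀ u → ∃[ φ ] (∀ x → current N φ x ≈ 𝕀 (suc x) u)
      potential u = solve-network N grounded (λ x → 𝕀 (suc x) u)

    groundedInverse : Matrix (suc n)
    groundedInverse x u = (0# ∷ proj₁ (potential u)) x

    -- The network imposes the balance at all vertices but zero. There it follows from the vanishing
    -- total: the injected current returns through the ground, so p is the unit vector at zero.
    divergence-groundedInverse : ∀ u x → divergence G (λ y → groundedInverse y u) x ≈ 𝕀 x u - 𝕀 x zero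
    divergence-groundedInverse u = λ { zero → at-zero ; (suc x) → trans (at-suc x) (sym (x-0≈x _)) }
      where
      φ : Fin n → Carrier
      φ = proj₁ (potential u)

      φ₀ : Fin (suc n) → Carrier
      φ₀ = λ y → groundedInverse y u

      at-suc : ∀ x → divergence G φ₀ (suc x) ≈ 𝕀 (suc x) u
      at-suc x = begin
        adjacency G (suc x) zero * (φ x - 0#) + ∑[ y < n ] (adjacency G (suc x) (suc y) * (φ x - φ y))
          ≈⟨ trans (+-comm _ _) (+-congˡ (*-congˡ (x-0≈x (φ x)))) ⟩
        current N φ x
          ≈⟨ proj₂ (potential u) x ⟩
        𝕀 (suc x) u ∎

      at-zero : divergence G φ₀ zero ≈ 𝕀 zero u - 1#
      at-zero = begin
        divergence G φ₀ zero
          ≈⟨ solve 2 (λ d s → d := (d :+ s) :- s)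
               refl (divergence G φ₀ zero) (∑[ x < n ] divergence G φ₀ (suc x)) ⟩
        ∑[ x < suc n ] divergence G φ₀ x - ∑[ x < n ] divergence G φ₀ (suc x)
          ≈⟨ +-cong (divergence-total G φ₀) (-‿cong (sum-cong-≋ at-suc)) ⟩
        0# - ∑[ x < n ] 𝕀 (suc x) u
          ≈⟨ solve 2 (λ d s → con (+ 0) :- s := d :- (d :+ s)) refl (𝕀 zero u) (∑[ x < n ] 𝕀 (suc x) u) ⟩
        𝕀 zero u - ∑[ x < suc n ] 𝕀 x u
          ≈⟨ +-congˡ (-‿cong (sum-cong (λ x → 𝕀 x u) (λ x → 𝕀 x u * 1#) (λ x → sym (*-identityʳ (𝕀 x u))))) ⟩
        𝕀 zero u - ∑[ x < suc n ] (𝕀 x u * 1#)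
          ≈⟨ +-congˡ (-‿cong (sum-𝕀′ u (const 1#))) ⟩
        𝕀 zero u - 1# ∎

  module _ {n} {A X : Matrix n} (A-sym : ∀ i j → A i j ≈ A j i) (AX≋𝕀 : A ⊡ X ≋ 𝕀) where

    private
      XᵀA≈𝕀 : ∀ i j → ∑[ k < n ] (X k i * A k j) ≈ 𝕀 i j
      XᵀA≈𝕀 i j = begin
        ∑[ k < n ] (X k i * A k j)   ≈⟨ sum-cong-≋ (λ k → trans (*-comm _ _) (*-congʳ (A-sym k j))) ⟩
        ∑[ k < n ] (A j k * X k i)   ≈⟨ AX≋𝕀 j i ⟩
        𝕀 j i                        ≈⟨ 𝕀-sym j i ⟩
        𝕀 i j                        ∎

      X-sym : ∀ i j → X i j ≈ X j i
      X-sym i j = begin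
        X i j
          ≈⟨ sum-𝕀 i (λ k → X k j) ⟨
        ∑[ k < n ] (𝕀 i k * X k j)
          ≈⟨ sum-cong-≋ (λ k → trans (*-congʳ (sym (XᵀA≈𝕀 i k))) (*-distribʳ-sum (X k j) (λ l → X l i * A l k))) ⟩
        ∑[ k < n ] ∑[ l < n ] (X l i * A l k * X k j)
          ≈⟨ ∑-comm (λ k l → X l i * A l k * X k j) ⟩
        ∑[ l < n ] ∑[ k < n ] (X l i * A l k * X k j)
          ≈⟨ sum-cong-≋ (λ l → trans (sum-cong-≋ (λ k → *-assoc (X l i) (A l k) (X k j)))
                                       (sym (*-distribˡ-sum (X l i) (λ k → A l k * X k j)))) ⟩
        ∑[ l < n ] (X l i * (A ⊡ X) l j)
          ≈⟨ sum-cong-≋ (λ l → trans (*-congˡ (AX≋𝕀 l j)) (*-comm _ _)) ⟩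
        ∑[ l < n ] (𝕀 l j * X l i)
          ≈⟨ sum-𝕀′ j (λ l → X l i) ⟩
        X j i ∎

    -- Solving for unit currents yields only a right inverse. By symmetry of A its transpose is a
    -- left inverse, and the two agree: X = (Xᵀ A) X = Xᵀ (A X) = Xᵀ.
    symmetric-leftInverse : X ⊡ A ≋ 𝕀
    symmetric-leftInverse i j = trans (sum-cong-≋ (λ k → *-congʳ (X-sym i k))) (XᵀA≈𝕀 i j)

  -- L + r I is the Laplacian of the network in which a conductance r joins each
  -- vertex to the ground.
  module ShiftedLaplacian {n} (G : Graph n) (r : ℕ) .{{_ : NonZero r}} where

    C : Matrix n
    C = laplacian G ⊞ fromℕ r · 𝕀

    private
      N : Network n
      N = record
        { w   = adjacency G
        ; g   = const (fromℕ r)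
        ; w≥0 = λ x y → nonNegative-indicator (adj G x y)
        ; g≥0 = λ x → positive⇒nonNegative (positive-fromℕ r)
        }

      grounded : ∀ x → Grounded N x
      grounded x = ground (positive-fromℕ r)

      solution : ∀ u → ∃[ φ ] (∀ x → current N φ x ≈ 𝕀 x u)
      solution u = solve-network N grounded (λ x → 𝕀 x u)

      C≈ : ∀ x y → C x y ≈ 𝕀 x y * conductance N x - adjacency G x y
      C≈ x y = begin
        diagonal (λ v → fromℕ (degree G v)) x y - adjacency G x y + fromℕ r * 𝕀 x y
          ≈⟨ +-congʳ (+-congʳ (trans (if≈indicator* (x == y) (fromℕ (degree G x))) (*-congˡ (fromℕ-degree G x)))) ⟩
        𝕀 x y * sum (adjacency G x) - adjacency G x y + fromℕ r * 𝕀 x y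
          ≈⟨ solve 4 (λ i s a r → i :* s :- a :+ r :* i := i :* (s :+ r) :- a) refl
               (𝕀 x y) (sum (adjacency G x)) (adjacency G x y) (fromℕ r) ⟩
        𝕀 x y * conductance N x - adjacency G x y ∎

    det-C#0 : det (λ x y → - C x y) # 0#
    det-C#0 = #-congʳ
      (det-cong (λ x y → trans
        (solve 2 (λ a d → a :- d := :- (d :- a)) refl (adjacency G x y) (𝕀 x y * conductance N x))
        (-‿cong (sym (C≈ x y)))))
      (det-negativeLaplacian-#0 N grounded)

    C⁻¹ : Matrix n
    C⁻¹ x u = proj₁ (solution u) x

    divergence-C⁻¹ : ∀ u x → divergence G (λ y → C⁻¹ y u) x + fromℕ r * C⁻¹ x u ≈ 𝕀 x u
    divergence-C⁻¹ u = proj₂ (solution u)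

    C⊡C⁻¹ : C ⊡ C⁻¹ ≋ 𝕀
    C⊡C⁻¹ x u = begin
      ∑[ y < n ] (C x y * φ y)
        ≈⟨ sum-cong-≋ (λ y → trans (*-congʳ (C≈ x y))
             (solve 4 (λ i d a p → (i :* d :- a) :* p := d :* (i :* p) :- a :* p) refl
               (𝕀 x y) (conductance N x) (adjacency G x y) (φ y))) ⟩
      ∑[ y < n ] (conductance N x * (𝕀 x y * φ y) - adjacency G x y * φ y)
        ≈⟨ sum-sub (λ y → conductance N x * (𝕀 x y * φ y)) (λ y → adjacency G x y * φ y) ⟩
      ∑[ y < n ] (conductance N x * (𝕀 x y * φ y)) - s
        ≈⟨ +-congʳ (trans (sym (*-distribˡ-sum (conductance N x) (λ y → 𝕀 x y * φ y))) (*-congˡ (sum-𝕀 x φ))) ⟩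
      (sum (adjacency G x) + fromℕ r) * φ x - s
        ≈⟨ solve 4 (λ d r p s → (d :+ r) :* p :- s := d :* p :- s :+ r :* p) refl
             (sum (adjacency G x)) (fromℕ r) (φ x) s ⟩
      sum (adjacency G x) * φ x - s + fromℕ r * φ x
        ≈⟨ +-congʳ (trans (+-congʳ (*-distribʳ-sum (φ x) (adjacency G x)))
             (sym (sum-sub (λ y → adjacency G x y * φ x) (λ y → adjacency G x y * φ y)))) ⟩
      ∑[ y < n ] (adjacency G x y * φ x - adjacency G x y * φ y) + fromℕ r * φ x
        ≈⟨ +-congʳ (sum-cong-≋ (λ y → solve 3 (λ a p q → a :* p :- a :* q := a :* (p :- q)) refl
             (adjacency G x y) (φ x) (φ y))) ⟩
      current N φ x
        ≈⟨ proj₂ (solution u) x ⟩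
      𝕀 x u ∎
      where
      φ : Fin n → Carrier
      φ y = C⁻¹ y u

      s : Carrier
      s = ∑[ y < n ] (adjacency G x y * φ y)

    C-sym : ∀ x y → C x y ≈ C y x
    C-sym x y = trans (C≈ x y) (trans
      (+-cong (diagonal-sym (x ≟ y)) (-‿cong (adjacency-sym G x y)))
      (sym (C≈ y x)))
      where
      diagonal-sym : Dec (x ≡ y) → 𝕀 x y * conductance N x ≈ 𝕀 y x * conductance N y
      diagonal-sym (yes ≡.refl) = refl
      diagonal-sym (no  x≢y)    = trans (trans (*-congʳ (𝕀-off x≢y)) (zeroˡ _))
                                        (sym (trans (*-congʳ (𝕀-off (x≢y ∘ ≡.sym))) (zeroˡ _)))

    C⁻¹⊡C : C⁻¹ ⊡ C ≋ 𝕀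
    C⁻¹⊡C = symmetric-leftInverse C-sym C⊡C⁻¹

    -- The unit current injected at u leaves entirely through the ground conductances r, since the
    -- currents within the graph cancel in the total.
    sum-column-C⁻¹ : ∀ u → fromℕ r * ∑[ x < n ] C⁻¹ x u ≈ 1#
    sum-column-C⁻¹ u = begin
      fromℕ r * ∑[ x < n ] C⁻¹ x u
        ≈⟨ *-distribˡ-sum (fromℕ r) (λ x → C⁻¹ x u) ⟩
      ∑[ x < n ] (fromℕ r * C⁻¹ x u)
        ≈⟨ trans (+-congʳ (divergence-total G (λ x → C⁻¹ x u))) (+-identityˡ _) ⟨
      ∑[ x < n ] divergence G (λ x → C⁻¹ x u) x + ∑[ x < n ] (fromℕ r * C⁻¹ x u)
        ≈⟨ ∑-distrib-+ (divergence G (λ x → C⁻¹ x u)) (λ x → fromℕ r * C⁻¹ x u) ⟨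
      ∑[ x < n ] (divergence G (λ x → C⁻¹ x u) x + fromℕ r * C⁻¹ x u)
        ≈⟨ sum-cong-≋ (λ x → trans (divergence-C⁻¹ u x) (sym (*-identityʳ (𝕀 x u)))) ⟩
      ∑[ x < n ] (𝕀 x u * 1#)
        ≈⟨ sum-𝕀′ u (const 1#) ⟩
      1# ∎

  -- The corona

  module RootedCopy {n} (G : Graph n) (r : ℕ) .{{_ : NonZero r}} (regular : Regular G r) where

    open ShiftedLaplacian G r public

    private
      m : ℕ
      m = size G

      A : Matrix n
      A = adjacency G

      src tgt : Fin m → Fin n
      src = source G
      tgt = target G

      B : Fin n → Fin m → Carrier
      B = incidence G

      null : ∀ {k} (f : Fin k → Carrier) → ∑[ i < k ] (0# * f i) ≈ 0#
      null f = sum-zero (λ i → zeroˡ (f i))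

    ⅓ : Carrier
    ⅓ = inverse (char0 3)

    r⁻¹ : Carrier
    r⁻¹ = inverse (char0 r)

    -- A copy of the subdivision of G together with the vertex of G₁ it hangs on.
    data Place : Set where
      root   : Place
      vertex : Fin n → Place
      edge   : Fin m → Place

    sumPlaces : (Place → Carrier) → Carrier
    sumPlaces f = f root + (∑[ v < n ] f (vertex v) + ∑[ e < m ] f (edge e))

    sumPlaces-cong : ∀ {f g} → (∀ s → f s ≈ g s) → sumPlaces f ≈ sumPlaces g
    sumPlaces-cong f≈g =
      +-cong (f≈g root) (+-cong (sum-cong-≋ (λ v → f≈g (vertex v))) (sum-cong-≋ (λ e → f≈g (edge e))))

    sumPlaces-+ : ∀ f g → sumPlaces (λ s → f s + g s) ≈ sumPlaces f + sumPlaces g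
    sumPlaces-+ f g = trans
      (+-congˡ (+-cong (∑-distrib-+ (λ v → f (vertex v)) (λ v → g (vertex v)))
                       (∑-distrib-+ (λ e → f (edge e)) (λ e → g (edge e)))))
      (solve 6 (λ a b c d e f → a :+ b :+ (c :+ d :+ (e :+ f)) := a :+ (c :+ e) :+ (b :+ (d :+ f))) refl
        (f root) (g root) (∑[ v < n ] f (vertex v)) (∑[ v < n ] g (vertex v))
        (∑[ e < m ] f (edge e)) (∑[ e < m ] g (edge e)))

    *-distribˡ-sumPlaces : ∀ x f → x * sumPlaces f ≈ sumPlaces (λ s → x * f s)
    *-distribˡ-sumPlaces x f = trans (distribˡ x _ _) (+-congˡ (trans (distribˡ x _ _)
      (+-cong (*-distribˡ-sum x (λ v → f (vertex v))) (*-distribˡ-sum x (λ e → f (edge e))))))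

    sumPlaces-const : ∀ x → sumPlaces (const x) ≈ fromℕ (1 ℕ.+ n ℕ.+ m) * x
    sumPlaces-const x = begin
      x + (∑[ v < n ] x + ∑[ e < m ] x)          ≈⟨ +-congˡ (+-cong (sum-const {n} x) (sum-const {m} x)) ⟩
      x + (fromℕ n * x + fromℕ m * x)            ≈⟨ solve 3 (λ x a b → x :+ (a :* x :+ b :* x) := (con (+ 1) :+ (a :+ b)) :* x)
                                                      refl x (fromℕ n) (fromℕ m) ⟩
      (1# + (fromℕ n + fromℕ m)) * x             ≈⟨ *-congʳ (+-congˡ (fromℕ-+ n m)) ⟨
      fromℕ (1 ℕ.+ n ℕ.+ m) * x                  ∎

    localAdj : Place → Place → Carrier
    localAdj root       (edge _)   = 1#
    localAdj (edge _)   root       = 1#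
    localAdj (vertex v) (edge e)   = B v e
    localAdj (edge e)   (vertex v) = B v e
    localAdj root       root       = 0#
    localAdj root       (vertex _) = 0#
    localAdj (vertex _) root       = 0#
    localAdj (vertex _) (vertex _) = 0#
    localAdj (edge _)   (edge _)   = 0#

    isRoot : Place → Carrier
    isRoot root       = 1#
    isRoot (vertex _) = 0#
    isRoot (edge _)   = 0#

    sumPlaces-isRoot : ∀ (f : Place → Carrier) → sumPlaces (λ s → isRoot s * f s) ≈ f root
    sumPlaces-isRoot f = begin
      1# * f root + (∑[ v < n ] (0# * f (vertex v)) + ∑[ e < m ] (0# * f (edge e)))
        ≈⟨ +-cong (*-identityˡ _) (+-cong (null (λ v → f (vertex v))) (null (λ e → f (edge e)))) ⟩
      f root + (0# + 0#)
        ≈⟨ trans (+-congˡ (+-identityʳ 0#)) (+-identityʳ _) ⟩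
      f root ∎

    δ : Place → Place → Carrier
    δ root       root       = 1#
    δ root       (vertex _) = 0#
    δ root       (edge _)   = 0#
    δ (vertex _) root       = 0#
    δ (vertex v) (vertex w) = 𝕀 v w
    δ (vertex _) (edge _)   = 0#
    δ (edge _)   root       = 0#
    δ (edge _)   (vertex _) = 0#
    δ (edge e)   (edge f)   = 𝕀 e f

    localDivergence : (Place → Carrier) → Place → Carrier
    localDivergence z s = sumPlaces λ t → localAdj s t * (z s - z t)

    ends : Fin m → Fin n → Carrier
    ends f v = C⁻¹ v (src f) + C⁻¹ v (tgt f)

    -- The inverse of the Laplacian of the copy grounded at its root: in block
    -- form 3 C⁻¹, C⁻¹ B, Bᵀ C⁻¹ and (Bᵀ C⁻¹ B + I) / 3, for the incidence matrix B.
    Z : Place → Place → Carrier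
    Z root       _          = 0#
    Z (vertex _) root       = 0#
    Z (edge _)   root       = 0#
    Z (vertex v) (vertex w) = fromℕ 3 * C⁻¹ v w
    Z (edge e)   (vertex w) = C⁻¹ (src e) w + C⁻¹ (tgt e) w
    Z (vertex v) (edge f)   = ends f v
    Z (edge e)   (edge f)   = ⅓ * (ends f (src e) + ends f (tgt e) + 𝕀 e f)

    sum-adjacency : ∀ v → ∑[ u < n ] A v u ≈ fromℕ r
    sum-adjacency v = trans (sym (fromℕ-degree G v)) (reflexive (≡.cong fromℕ (regular v)))

    localDivergence-root : ∀ z → z root ≈ 0# → localDivergence z root ≈ - ∑[ e < m ] z (edge e)
    localDivergence-root z z₀≈0 = begin
      0# * (z root - z root) + (∑[ v < n ] (0# * (z root - z (vertex v))) + ∑[ e < m ] (1# * (z root - z (edge e))))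
        ≈⟨ +-cong (zeroˡ _) (trans (+-congʳ (null (λ v → z root - z (vertex v)))) (+-identityˡ _)) ⟩
      0# + ∑[ e < m ] (1# * (z root - z (edge e)))
        ≈⟨ trans (+-identityˡ _) (sum-cong (λ e → 1# * (z root - z (edge e))) (λ e → - z (edge e))
             (λ e → trans (*-identityˡ _) (trans (+-congʳ z₀≈0) (+-identityˡ _)))) ⟩
      ∑[ e < m ] (- z (edge e))
        ≈⟨ sum-neg (λ e → z (edge e)) ⟩
      - ∑[ e < m ] z (edge e) ∎

    localDivergence-vertex : ∀ z v → localDivergence z (vertex v) ≈ ∑[ e < m ] (B v e * (z (vertex v) - z (edge e)))
    localDivergence-vertex z v = begin
      0# * (z (vertex v) - z root) + (∑[ w < n ] (0# * (z (vertex v) - z (vertex w))) + s)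
        ≈⟨ +-cong (zeroˡ _) (trans (+-congʳ (null (λ w → z (vertex v) - z (vertex w)))) (+-identityˡ _)) ⟩
      0# + s
        ≈⟨ +-identityˡ s ⟩
      s ∎
      where s = ∑[ e < m ] (B v e * (z (vertex v) - z (edge e)))

    localDivergence-edge : ∀ z e → z root ≈ 0# →
      localDivergence z (edge e) ≈ z (edge e) + ∑[ v < n ] (B v e * (z (edge e) - z (vertex v)))
    localDivergence-edge z e z₀≈0 = begin
      1# * (z (edge e) - z root) + (s + ∑[ f < m ] (0# * (z (edge e) - z (edge f))))
        ≈⟨ +-cong (trans (*-identityˡ _) (trans (+-congˡ (-‿cong z₀≈0)) (x-0≈x _)))
                  (trans (+-congˡ (null (λ f → z (edge e) - z (edge f)))) (+-identityʳ _)) ⟩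
      z (edge e) + s ∎
      where s = ∑[ v < n ] (B v e * (z (edge e) - z (vertex v)))

    -- The currents along the edges of the subdivision cancel in the total.
    sum-edge-values : ∀ z → z root ≈ 0# →
      ∑[ e < m ] z (edge e) ≈ ∑[ v < n ] localDivergence z (vertex v) + ∑[ e < m ] localDivergence z (edge e)
    sum-edge-values z z₀≈0 = sym (begin
      ∑[ v < n ] localDivergence z (vertex v) + ∑[ e < m ] localDivergence z (edge e)
        ≈⟨ +-cong (trans (sum-cong-≋ (localDivergence-vertex z)) (∑-comm (λ v e → B v e * (z (vertex v) - z (edge e)))))
                  (trans (sum-cong-≋ (λ e → localDivergence-edge z e z₀≈0))
                         (∑-distrib-+ (λ e → z (edge e)) (λ e → ∑[ v < n ] (B v e * (z (edge e) - z (vertex v)))))) ⟩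
      out + (∑[ e < m ] z (edge e) + ∑[ e < m ] ∑[ v < n ] (B v e * (z (edge e) - z (vertex v))))
        ≈⟨ +-congˡ (+-congˡ (trans
             (sum-cong-≋ (λ e → trans
               (sum-cong-≋ (λ v → solve 3 (λ b x y → b :* (x :- y) := :- (b :* (y :- x))) refl
                 (B v e) (z (edge e)) (z (vertex v))))
               (sum-neg (λ v → B v e * (z (vertex v) - z (edge e))))))
             (sum-neg (λ e → ∑[ v < n ] (B v e * (z (vertex v) - z (edge e))))))) ⟩
      out + (∑[ e < m ] z (edge e) - out)
        ≈⟨ solve 2 (λ o s → o :+ (s :- o) := s) refl out (∑[ e < m ] z (edge e)) ⟩
      ∑[ e < m ] z (edge e) ∎)
      where out = ∑[ e < m ] ∑[ v < n ] (B v e * (z (vertex v) - z (edge e)))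

    -- (3 D - B Bᵀ) x = C x, because B Bᵀ = D + A and D = r I.
    incidence-operator : ∀ (x : Fin n → Carrier) v →
      ∑[ e < m ] (B v e * (fromℕ 3 * x v - (x (src e) + x (tgt e)))) ≈ divergence G x v + fromℕ r * x v
    incidence-operator x v = begin
      ∑[ e < m ] (B v e * (fromℕ 3 * x v - (x (src e) + x (tgt e))))
        ≈⟨ sum-incident-edges G v (λ a b → fromℕ 3 * x v - (x a + x b)) (λ a b → +-congˡ (-‿cong (+-comm (x a) (x b)))) ⟩
      ∑[ u < n ] (A v u * (fromℕ 3 * x v - (x v + x u)))
        ≈⟨ sum-cong-≋ (λ u → solve 3 (λ a p q → a :* (con (+ 3) :* p :- (p :+ q)) := a :* (p :- q) :+ a :* p)
             refl
             (A v u) (x v) (x u)) ⟩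
      ∑[ u < n ] (A v u * (x v - x u) + A v u * x v)
        ≈⟨ ∑-distrib-+ (λ u → A v u * (x v - x u)) (λ u → A v u * x v) ⟩
      divergence G x v + ∑[ u < n ] (A v u * x v)
        ≈⟨ +-congˡ (trans (sym (*-distribʳ-sum (x v) (A v))) (*-congʳ (sum-adjacency v))) ⟩
      divergence G x v + fromℕ r * x v ∎

    -- A subdivision vertex has three neighbours; the summand y outside the sum is its current to
    -- the root, which lies at potential 0.
    edge-operator : ∀ (x : Fin n → Carrier) e y →
      y + ∑[ v < n ] (B v e * (y - x v)) ≈ fromℕ 3 * y - (x (src e) + x (tgt e))
    edge-operator x e y = begin
      y + ∑[ v < n ] (B v e * (y - x v))
        ≈⟨ +-congˡ (sum-incidence G e (λ v → y - x v)) ⟩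
      y + ((y - x (src e)) + (y - x (tgt e)))
        ≈⟨ solve 3 (λ y a b → y :+ ((y :- a) :+ (y :- b)) := con (+ 3) :* y :- (a :+ b))
             refl y (x (src e)) (x (tgt e)) ⟩
      fromℕ 3 * y - (x (src e) + x (tgt e)) ∎

    ends-operator : ∀ f v → divergence G (ends f) v + fromℕ r * ends f v ≈ B v f
    ends-operator f v = begin
      divergence G (ends f) v + fromℕ r * (p v + q v)
        ≈⟨ +-congʳ (trans
             (sum-cong-≋ (λ u → solve 5 (λ a p q s t → a :* (p :+ q :- (s :+ t)) := a :* (p :- s) :+ a :* (q :- t))
               refl
               (A v u) (p v) (q v) (p u) (q u)))
             (∑-distrib-+ (λ u → A v u * (p v - p u)) (λ u → A v u * (q v - q u)))) ⟩
      divergence G p v + divergence G q v + fromℕ r * (p v + q v)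
        ≈⟨ solve 5 (λ d e r p q → d :+ e :+ r :* (p :+ q) := (d :+ r :* p) :+ (e :+ r :* q)) refl
             (divergence G p v) (divergence G q v) (fromℕ r) (p v) (q v) ⟩
      (divergence G p v + fromℕ r * p v) + (divergence G q v + fromℕ r * q v)
        ≈⟨ +-cong (divergence-C⁻¹ (src f) v) (divergence-C⁻¹ (tgt f) v) ⟩
      𝕀 v (src f) + 𝕀 v (tgt f)
        ≈⟨ incidence≈ G v f ⟨
      B v f ∎
      where
      p q : Fin n → Carrier
      p v = C⁻¹ v (src f)
      q v = C⁻¹ v (tgt f)

    private
      3*⅓ : fromℕ 3 * ⅓ ≈ 1#
      3*⅓ = trans (*-comm _ _) (inverse-* (char0 3))

      ⅓-difference : ∀ y z → y - ⅓ * z ≈ ⅓ * (fromℕ 3 * y - z)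
      ⅓-difference y z = begin
        y - ⅓ * z                    ≈⟨ +-congʳ (*-identityˡ y) ⟨
        1# * y - ⅓ * z               ≈⟨ +-congʳ (*-congʳ 3*⅓) ⟨
        fromℕ 3 * ⅓ * y - ⅓ * z      ≈⟨ solve 3 (λ h y z → con (+ 3) :* h :* y :- h :* z := h :* (con (+ 3) :* y :- z))
                                          refl ⅓ y z ⟩
        ⅓ * (fromℕ 3 * y - z)        ∎

    -- The operator 3 D - B Bᵀ is C: it takes C⁻¹ to I, and C⁻¹ B to B, which the summand I of the
    -- edge block then cancels.
    localDivergence-Z-vertex : ∀ t v → localDivergence (λ s → Z s t) (vertex v) ≈ δ (vertex v) t
    localDivergence-Z-vertex root v = trans (localDivergence-vertex (λ s → Z s root) v)
      (sum-zero {f = λ e → B v e * (0# - 0#)} (λ e → trans (*-congˡ (-‿inverseʳ 0#)) (zeroʳ _)))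
    localDivergence-Z-vertex (vertex w) v = begin
      localDivergence (λ s → Z s (vertex w)) (vertex v)
        ≈⟨ localDivergence-vertex (λ s → Z s (vertex w)) v ⟩
      ∑[ e < m ] (B v e * (fromℕ 3 * C⁻¹ v w - (C⁻¹ (src e) w + C⁻¹ (tgt e) w)))
        ≈⟨ incidence-operator (λ u → C⁻¹ u w) v ⟩
      divergence G (λ u → C⁻¹ u w) v + fromℕ r * C⁻¹ v w
        ≈⟨ divergence-C⁻¹ w v ⟩
      𝕀 v w ∎
    localDivergence-Z-vertex (edge f) v = begin
      localDivergence (λ s → Z s (edge f)) (vertex v)
        ≈⟨ localDivergence-vertex (λ s → Z s (edge f)) v ⟩
      ∑[ e < m ] (B v e * (y v - ⅓ * (y (src e) + y (tgt e) + 𝕀 e f)))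
        ≈⟨ sum-cong-≋ (λ e → trans (*-congˡ (⅓-difference (y v) (y (src e) + y (tgt e) + 𝕀 e f)))
             (solve 6 (λ b h p q s i → b :* (h :* (con (+ 3) :* p :- (q :+ s :+ i)))
                                    := h :* (b :* (con (+ 3) :* p :- (q :+ s)) :- i :* b)) refl
               (B v e) ⅓ (y v) (y (src e)) (y (tgt e)) (𝕀 e f))) ⟩
      ∑[ e < m ] (⅓ * (B v e * (fromℕ 3 * y v - (y (src e) + y (tgt e))) - 𝕀 e f * B v e))
        ≈⟨ *-distribˡ-sum ⅓ (λ e → B v e * (fromℕ 3 * y v - (y (src e) + y (tgt e))) - 𝕀 e f * B v e) ⟨
      ⅓ * ∑[ e < m ] (B v e * (fromℕ 3 * y v - (y (src e) + y (tgt e))) - 𝕀 e f * B v e)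
        ≈⟨ *-congˡ (sum-sub (λ e → B v e * (fromℕ 3 * y v - (y (src e) + y (tgt e)))) (λ e → 𝕀 e f * B v e)) ⟩
      ⅓ * (∑[ e < m ] (B v e * (fromℕ 3 * y v - (y (src e) + y (tgt e)))) - ∑[ e < m ] (𝕀 e f * B v e))
        ≈⟨ *-congˡ (+-cong (trans (incidence-operator y v) (ends-operator f v)) (-‿cong (sum-𝕀′ f (B v)))) ⟩
      ⅓ * (B v f - B v f)
        ≈⟨ trans (*-congˡ (-‿inverseʳ _)) (zeroʳ ⅓) ⟩
      0# ∎
      where y = ends f

    localDivergence-Z-edge : ∀ t e → localDivergence (λ s → Z s t) (edge e) ≈ δ (edge e) t
    localDivergence-Z-edge root e = trans (localDivergence-edge (λ s → Z s root) e refl)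
      (trans (+-identityˡ _) (sum-zero {f = λ v → B v e * (0# - 0#)} (λ v → trans (*-congˡ (-‿inverseʳ 0#)) (zeroʳ _))))
    localDivergence-Z-edge (vertex w) e = begin
      localDivergence (λ s → Z s (vertex w)) (edge e)
        ≈⟨ localDivergence-edge (λ s → Z s (vertex w)) e refl ⟩
      p + q + ∑[ v < n ] (B v e * (p + q - fromℕ 3 * C⁻¹ v w))
        ≈⟨ edge-operator (λ v → fromℕ 3 * C⁻¹ v w) e (p + q) ⟩
      fromℕ 3 * (p + q) - (fromℕ 3 * p + fromℕ 3 * q)
        ≈⟨ solve 2 (λ p q → con (+ 3) :* (p :+ q) :- (con (+ 3) :* p :+ con (+ 3) :* q) := con (+ 0)) refl p q ⟩
      0# ∎
      where
      p = C⁻¹ (src e) w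
      q = C⁻¹ (tgt e) w
    localDivergence-Z-edge (edge f) e = begin
      localDivergence (λ s → Z s (edge f)) (edge e)
        ≈⟨ localDivergence-edge (λ s → Z s (edge f)) e refl ⟩
      Z (edge e) (edge f) + ∑[ v < n ] (B v e * (Z (edge e) (edge f) - y v))
        ≈⟨ edge-operator y e (Z (edge e) (edge f)) ⟩
      fromℕ 3 * (⅓ * (p + q + 𝕀 e f)) - (p + q)
        ≈⟨ +-congʳ (trans (sym (*-assoc _ _ _)) (trans (*-congʳ 3*⅓) (*-identityˡ _))) ⟩
      p + q + 𝕀 e f - (p + q)
        ≈⟨ solve 2 (λ p i → p :+ i :- p := i) refl (p + q) (𝕀 e f) ⟩
      𝕀 e f ∎
      where
      y = ends f
      p = y (src e)
      q = y (tgt e)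

    private
      sum-𝕀₁ : ∀ {k} (j : Fin k) → ∑[ i < k ] 𝕀 i j ≈ 1#
      sum-𝕀₁ j = trans (sum-cong-≋ (λ i → sym (*-identityʳ (𝕀 i j)))) (sum-𝕀′ j (const 1#))

    sum-δ : ∀ t → ∑[ v < n ] δ (vertex v) t + ∑[ e < m ] δ (edge e) t ≈ 1# - isRoot t
    sum-δ root       = trans (+-cong (sum-replicate-zero n) (sum-replicate-zero m))
                             (trans (+-identityʳ 0#) (sym (-‿inverseʳ 1#)))
    sum-δ (vertex w) = trans (+-cong (sum-𝕀₁ w) (sum-replicate-zero m)) (+-congˡ (sym -0#≈0#))
    sum-δ (edge f)   = trans (+-comm _ _) (trans (+-cong (sum-𝕀₁ f) (sum-replicate-zero n)) (+-congˡ (sym -0#≈0#)))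

    -- With the root at potential 0 the value at a subdivision vertex is its current into the root.
    -- Together these carry away the unit current injected at t, except when t is the root.
    sum-Z-edges : ∀ t → ∑[ e < m ] Z (edge e) t ≈ 1# - isRoot t
    sum-Z-edges t = begin
      ∑[ e < m ] Z (edge e) t
        ≈⟨ sum-edge-values (λ s → Z s t) refl ⟩
      ∑[ v < n ] localDivergence (λ s → Z s t) (vertex v) + ∑[ e < m ] localDivergence (λ s → Z s t) (edge e)
        ≈⟨ +-cong (sum-cong-≋ (localDivergence-Z-vertex t)) (sum-cong-≋ (localDivergence-Z-edge t)) ⟩
      ∑[ v < n ] δ (vertex v) t + ∑[ e < m ] δ (edge e) t
        ≈⟨ sum-δ t ⟩
      1# - isRoot t ∎

    localDivergence-Z : ∀ t s → localDivergence (λ s → Z s t) s ≈ δ s t - isRoot s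
    localDivergence-Z t (vertex v) = trans (localDivergence-Z-vertex t v) (sym (x-0≈x _))
    localDivergence-Z t (edge e)   = trans (localDivergence-Z-edge t e) (sym (x-0≈x _))
    localDivergence-Z t root       = begin
      localDivergence (λ s → Z s t) root    ≈⟨ localDivergence-root (λ s → Z s t) refl ⟩
      - ∑[ e < m ] Z (edge e) t             ≈⟨ -‿cong (sum-Z-edges t) ⟩
      - (1# - isRoot t)                     ≈⟨ solve 1 (λ x → :- (con (+ 1) :- x) := x :- con (+ 1))
                                                 refl (isRoot t) ⟩
      isRoot t - 1#                         ≈⟨ +-congʳ (isRoot≈δ t) ⟩
      δ root t - 1#                         ∎
      where
      isRoot≈δ : ∀ t → isRoot t ≈ δ root t
      isRoot≈δ root       = refl
      isRoot≈δ (vertex _) = refl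
      isRoot≈δ (edge _)   = refl

    sum-column : ∀ u → ∑[ v < n ] C⁻¹ v u ≈ r⁻¹
    sum-column u = begin
      ∑[ v < n ] C⁻¹ v u                      ≈⟨ *-identityˡ _ ⟨
      1# * ∑[ v < n ] C⁻¹ v u                 ≈⟨ *-congʳ (inverse-* (char0 r)) ⟨
      r⁻¹ * fromℕ r * ∑[ v < n ] C⁻¹ v u      ≈⟨ *-assoc _ _ _ ⟩
      r⁻¹ * (fromℕ r * ∑[ v < n ] C⁻¹ v u)    ≈⟨ trans (*-congˡ (sum-column-C⁻¹ u)) (*-identityʳ _) ⟩
      r⁻¹                                     ∎

    sum-Z-column : Place → Carrier
    sum-Z-column t = sumPlaces (λ s → Z s t)

    -- In each column the subdivision vertices contribute 1. The remaining 3 / r and 2 / r are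
    -- column sums of 3 C⁻¹ and C⁻¹ B, as every column of C⁻¹ sums to 1 / r and an edge has two
    -- ends.
    total-Z : sumPlaces sum-Z-column ≈
              fromℕ n * (fromℕ 3 * r⁻¹ + 1#) + fromℕ m * (fromℕ 2 * r⁻¹ + 1#)
    total-Z = begin
      sumPlaces sum-Z-column
        ≈⟨ +-cong at-root (+-cong (trans (sum-cong-≋ at-vertex) (sum-const {n} _))
                                  (trans (sum-cong-≋ at-edge) (sum-const {m} _))) ⟩
      0# + (fromℕ n * (fromℕ 3 * r⁻¹ + 1#) + fromℕ m * (fromℕ 2 * r⁻¹ + 1#))
        ≈⟨ +-identityˡ _ ⟩
      fromℕ n * (fromℕ 3 * r⁻¹ + 1#) + fromℕ m * (fromℕ 2 * r⁻¹ + 1#) ∎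
      where
      at-root : sum-Z-column root ≈ 0#
      at-root = trans (+-identityˡ _) (trans (+-cong (sum-replicate-zero n) (sum-replicate-zero m)) (+-identityʳ 0#))

      at-vertex : ∀ w → sum-Z-column (vertex w) ≈ fromℕ 3 * r⁻¹ + 1#
      at-vertex w = trans (+-identityˡ _) (+-cong
        (trans (sym (*-distribˡ-sum (fromℕ 3) (λ v → C⁻¹ v w))) (*-congˡ (sum-column w)))
        (trans (sum-Z-edges (vertex w)) (x-0≈x 1#)))

      at-edge : ∀ f → sum-Z-column (edge f) ≈ fromℕ 2 * r⁻¹ + 1#
      at-edge f = trans (+-identityˡ _) (+-cong
        (trans (∑-distrib-+ (λ v → C⁻¹ v (src f)) (λ v → C⁻¹ v (tgt f)))
          (trans (+-cong (sum-column (src f)) (sum-column (tgt f)))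
                 (solve 1 (λ x → x :+ x := con (+ 2) :* x) refl r⁻¹)))
        (trans (sum-Z-edges (edge f)) (x-0≈x 1#)))

    trace-Z : sumPlaces (λ s → Z s s) ≈
              fromℕ 3 * tr C⁻¹ + ⅓ * (tr (C⁻¹ ⊡ A) + fromℕ r * tr C⁻¹ + fromℕ m)
    trace-Z = begin
      0# + (∑[ v < n ] (fromℕ 3 * C⁻¹ v v) + ∑[ f < m ] (⅓ * (ends f (src f) + ends f (tgt f) + 𝕀 f f)))
        ≈⟨ trans (+-identityˡ _) (+-cong
             (sym (*-distribˡ-sum (fromℕ 3) (λ v → C⁻¹ v v)))
             (sym (*-distribˡ-sum ⅓ (λ f → ends f (src f) + ends f (tgt f) + 𝕀 f f)))) ⟩
      fromℕ 3 * tr C⁻¹ + ⅓ * ∑[ f < m ] (ends f (src f) + ends f (tgt f) + 𝕀 f f)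
        ≈⟨ +-congˡ (*-congˡ (trans
             (∑-distrib-+ (λ f → ends f (src f) + ends f (tgt f)) (λ f → 𝕀 f f))
             (+-cong ends-total (trans (sum-cong {m} (λ f → 𝕀 f f) (const 1#) 𝕀-diag)
               (trans (sum-const {m} 1#) (*-identityʳ _)))))) ⟩
      fromℕ 3 * tr C⁻¹ + ⅓ * (tr (C⁻¹ ⊡ A) + fromℕ r * tr C⁻¹ + fromℕ m) ∎
      where
      -- The trace of Bᵀ C⁻¹ B, which is that of C⁻¹ B Bᵀ = C⁻¹ (A + r I).
      ends-total : ∑[ f < m ] (ends f (src f) + ends f (tgt f)) ≈ tr (C⁻¹ ⊡ A) + fromℕ r * tr C⁻¹
      ends-total = begin
        ∑[ f < m ] (ends f (src f) + ends f (tgt f))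
          ≈⟨ sum-cong-≋ (λ f → sum-incidence G f (ends f)) ⟨
        ∑[ f < m ] ∑[ v < n ] (B v f * ends f v)
          ≈⟨ ∑-comm (λ f v → B v f * ends f v) ⟩
        ∑[ v < n ] ∑[ f < m ] (B v f * ends f v)
          ≈⟨ sum-cong-≋ (λ v → sum-incident-edges G v (λ a b → C⁻¹ v a + C⁻¹ v b) (λ a b → +-comm (C⁻¹ v a) (C⁻¹ v b))) ⟩
        ∑[ v < n ] ∑[ u < n ] (A v u * (C⁻¹ v v + C⁻¹ v u))
          ≈⟨ sum-cong-≋ (λ v → trans
               (sum-cong-≋ (λ u → trans
                 (solve 3 (λ a p q → a :* (p :+ q) := q :* a :+ a :* p) refl (A v u) (C⁻¹ v v) (C⁻¹ v u))
                 (+-congʳ (*-congˡ (adjacency-sym G v u)))))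
               (∑-distrib-+ (λ u → C⁻¹ v u * A u v) (λ u → A v u * C⁻¹ v v))) ⟩
        ∑[ v < n ] ((C⁻¹ ⊡ A) v v + ∑[ u < n ] (A v u * C⁻¹ v v))
          ≈⟨ ∑-distrib-+ (λ v → (C⁻¹ ⊡ A) v v) (λ v → ∑[ u < n ] (A v u * C⁻¹ v v)) ⟩
        tr (C⁻¹ ⊡ A) + ∑[ v < n ] ∑[ u < n ] (A v u * C⁻¹ v v)
          ≈⟨ +-congˡ (trans
               (sum-cong-≋ (λ v → trans (sym (*-distribʳ-sum (C⁻¹ v v) (A v))) (*-congʳ (sum-adjacency v))))
               (sym (*-distribˡ-sum (fromℕ r) (λ v → C⁻¹ v v)))) ⟩
        tr (C⁻¹ ⊡ A) + fromℕ r * tr C⁻¹ ∎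

    handshake : fromℕ 2 * fromℕ m ≈ fromℕ n * fromℕ r
    handshake = begin
      fromℕ 2 * fromℕ m
        ≈⟨ *-comm _ _ ⟩
      fromℕ m * fromℕ 2
        ≈⟨ sum-const {m} (fromℕ 2) ⟨
      ∑[ e < m ] fromℕ 2
        ≈⟨ sum-cong (λ e → ∑[ v < n ] (B v e * 1#)) (const (fromℕ 2))
             (λ e → trans (sum-incidence G e (const 1#)) (+-congˡ {x = 1#} (sym (+-identityʳ 1#)))) ⟨
      ∑[ e < m ] ∑[ v < n ] (B v e * 1#)
        ≈⟨ ∑-comm (λ e v → B v e * 1#) ⟩
      ∑[ v < n ] ∑[ e < m ] (B v e * 1#)
        ≈⟨ sum-cong-≋ (λ v → trans (sum-incident-edges G v (λ _ _ → 1#) (λ _ _ → refl))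
             (trans (sum-cong-≋ (λ u → *-identityʳ (A v u))) (sum-adjacency v))) ⟩
      ∑[ v < n ] fromℕ r
        ≈⟨ sum-const {n} (fromℕ r) ⟩
      fromℕ n * fromℕ r ∎

  -- Potentials on the whole corona

  module Corona {n₁ n₂ : ℕ} (G₁ : Graph n₁) (G₂ : Graph n₂)
                (r : ℕ) .{{_ : NonZero r}} (regular : Regular G₂ r)
                (X₁ : Matrix n₁) (p₁ : Fin n₁ → Carrier)
                (LX₁≈ : ∀ u x → divergence G₁ (λ y → X₁ y u) x ≈ 𝕀 x u - p₁ x) where

    open RootedCopy G₂ r regular public

    private
      m₂ = size G₂
      N  = n₂ ℕ.+ m₂
      H  = G₁ ⋆ G₂

    M : Carrier
    M = fromℕ (1 ℕ.+ n₂ ℕ.+ m₂)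

    place : Fin n₂ ⊎ Fin m₂ → Place
    place (inj₁ v) = vertex v
    place (inj₂ e) = edge e

    locateCorona : CoronaVertex G₁ G₂ → Fin n₁ × Place
    locateCorona (inj₁ i)       = i , root
    locateCorona (inj₂ (i , x)) = i , place (splitAt n₂ x)

    locate : Fin (n₁ ℕ.+ n₁ ℕ.* N) → Fin n₁ × Place
    locate x = locateCorona (coronaVertex G₁ G₂ x)

    -- The inverse of `locate`; through it a sum over all vertices becomes a double sum over copies
    -- and their places.
    index : Fin n₁ → Place → Fin (n₁ ℕ.+ n₁ ℕ.* N)
    index i root       = i ↑ˡ (n₁ ℕ.* N)
    index i (vertex v) = n₁ ↑ʳ combine i (v ↑ˡ m₂)
    index i (edge e)   = n₁ ↑ʳ combine i (n₂ ↑ʳ e)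

    locate-copy : ∀ i x → locate (n₁ ↑ʳ combine i x) ≡ (i , place (splitAt n₂ x))
    locate-copy i x = ≡.trans
      (≡.cong (λ z → locateCorona (Sum.map₂ (remQuot {n₁} N) z)) (splitAt-↑ʳ n₁ (n₁ ℕ.* N) (combine i x)))
      (≡.cong (λ (j , y) → j , place (splitAt n₂ y)) (remQuot-combine i x))

    locate-index : ∀ i s → locate (index i s) ≡ (i , s)
    locate-index i root =
      ≡.cong (λ z → locateCorona (Sum.map₂ (remQuot {n₁} N) z)) (splitAt-↑ˡ n₁ i (n₁ ℕ.* N))
    locate-index i (vertex v) = ≡.trans (locate-copy i (v ↑ˡ m₂)) (≡.cong (λ z → i , place z) (splitAt-↑ˡ n₂ v m₂))
    locate-index i (edge e)   = ≡.trans (locate-copy i (n₂ ↑ʳ e)) (≡.cong (λ z → i , place z) (splitAt-↑ʳ n₂ m₂ e))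

    index-locate : ∀ x → index (proj₁ (locate x)) (proj₂ (locate x)) ≡ x
    index-locate x with splitAt n₁ x in x≡
    ... | inj₁ i = splitAt⁻¹-↑ˡ x≡
    ... | inj₂ y with splitAt n₂ (proj₂ (remQuot {n₁} N y)) in y≡
    ...   | inj₁ v = ≡.trans (≡.cong (n₁ ↑ʳ_) (≡.trans
                       (≡.cong (combine (proj₁ (remQuot {n₁} N y))) (splitAt⁻¹-↑ˡ y≡)) (combine-remQuot {n₁} N y)))
                       (splitAt⁻¹-↑ʳ x≡)
    ...   | inj₂ e = ≡.trans (≡.cong (n₁ ↑ʳ_) (≡.trans
                       (≡.cong (combine (proj₁ (remQuot {n₁} N y))) (splitAt⁻¹-↑ʳ y≡)) (combine-remQuot {n₁} N y)))
                       (splitAt⁻¹-↑ʳ x≡)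

    locate-injective : ∀ {x y} → locate x ≡ locate y → x ≡ y
    locate-injective {x} {y} eq = ≡.trans (≡.sym (index-locate x))
      (≡.trans (≡.cong (λ (i , s) → index i s) eq) (index-locate y))

    sum-index : ∀ f → sum f ≈ ∑[ i < n₁ ] sumPlaces (λ s → f (index i s))
    sum-index f = begin
      sum f
        ≈⟨ sum-↑ n₁ f ⟩
      ∑[ i < n₁ ] f (i ↑ˡ (n₁ ℕ.* N)) + ∑[ y < n₁ ℕ.* N ] f (n₁ ↑ʳ y)
        ≈⟨ +-congˡ (trans (sum-combine n₁ {N} (λ y → f (n₁ ↑ʳ y)))
             (sum-cong-≋ {n₁} (λ i → sum-↑ n₂ {m₂} (λ x → f (n₁ ↑ʳ combine i x))))) ⟩
      ∑[ i < n₁ ] f (i ↑ˡ (n₁ ℕ.* N)) +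
      ∑[ i < n₁ ] (∑[ v < n₂ ] f (index i (vertex v)) + ∑[ e < m₂ ] f (index i (edge e)))
        ≈⟨ ∑-distrib-+ (λ i → f (i ↑ˡ (n₁ ℕ.* N)))
             (λ i → ∑[ v < n₂ ] f (index i (vertex v)) + ∑[ e < m₂ ] f (index i (edge e))) ⟨
      ∑[ i < n₁ ] sumPlaces (λ s → f (index i s)) ∎

    sum-locate : ∀ (F : Fin n₁ × Place → Carrier) →
                 ∑[ x < n₁ ℕ.+ n₁ ℕ.* N ] F (locate x) ≈ ∑[ i < n₁ ] sumPlaces (λ s → F (i , s))
    sum-locate F = trans (sum-index (λ x → F (locate x)))
      (sum-cong-≋ (λ i → sumPlaces-cong (λ s → reflexive (≡.cong F (locate-index i s)))))

    -- The two summands are the edges within a copy and the edges of G₁.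
    weight : Fin n₁ × Place → Fin n₁ × Place → Carrier
    weight (i , s) (j , t) = 𝕀 i j * localAdj s t + isRoot s * (isRoot t * adjacency G₁ i j)

    private
      within : ∀ x i j → 𝕀 i j * x ≈ 𝕀 i j * x + 0# * (0# * adjacency G₁ i j)
      within x i j = solve 3 (λ e x a → e :* x := e :* x :+ con (+ 0) :* (con (+ 0) :* a)) refl
        (𝕀 i j) x (adjacency G₁ i j)

    coronaAdj-weight : ∀ p q → indicator (coronaAdj G₁ G₂ p q) ≈ weight (locateCorona p) (locateCorona q)
    coronaAdj-weight (inj₁ i) (inj₁ j) =
      solve 2 (λ e a → a := e :* con (+ 0) :+ con (+ 1) :* (con (+ 1) :* a)) refl (𝕀 i j) (adjacency G₁ i j)
    coronaAdj-weight (inj₁ i) (inj₂ (j , y)) with splitAt n₂ y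
    ... | inj₁ v = trans (indicator-∧ (i == j) false)
      (solve 2 (λ e a → e :* con (+ 0) := e :* con (+ 0) :+ con (+ 1) :* (con (+ 0) :* a))
        refl (𝕀 i j) (adjacency G₁ i j))
    ... | inj₂ e = trans (indicator-∧ (i == j) true)
      (solve 2 (λ e a → e :* con (+ 1) := e :* con (+ 1) :+ con (+ 1) :* (con (+ 0) :* a))
        refl (𝕀 i j) (adjacency G₁ i j))
    coronaAdj-weight (inj₂ (i , x)) (inj₁ j) with splitAt n₂ x
    ... | inj₁ v = trans (indicator-∧ (j == i) false)
      (solve 3 (λ d e a → d :* con (+ 0) := e :* con (+ 0) :+ con (+ 0) :* (con (+ 1) :* a))
        refl (𝕀 j i) (𝕀 i j) (adjacency G₁ i j))
    ... | inj₂ e = trans (indicator-∧ (j == i) true) (trans (*-congʳ (𝕀-sym j i))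
      (solve 2 (λ e a → e :* con (+ 1) := e :* con (+ 1) :+ con (+ 0) :* (con (+ 1) :* a))
        refl (𝕀 i j) (adjacency G₁ i j)))
    coronaAdj-weight (inj₂ (i , x)) (inj₂ (j , y)) with splitAt n₂ x | splitAt n₂ y
    ... | inj₁ v | inj₁ w = trans (indicator-∧ (i == j) false) (within 0# i j)
    ... | inj₁ v | inj₂ e = trans (indicator-∧ (i == j) (incident G₂ v e)) (within (incidence G₂ v e) i j)
    ... | inj₂ e | inj₁ v = trans (indicator-∧ (i == j) (incident G₂ v e)) (within (incidence G₂ v e) i j)
    ... | inj₂ e | inj₂ f = trans (indicator-∧ (i == j) false) (within 0# i j)

    -- The two summands of `weight` separate the current: one part stays within the copy of x, the
    -- other runs along G₁ and exists only at a root.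
    divergence-locate : ∀ (F : Fin n₁ × Place → Carrier) x → let (i , s) = locate x in
      divergence H (λ y → F (locate y)) x ≈
      sumPlaces (λ t → localAdj s t * (F (i , s) - F (i , t))) +
      isRoot s * ∑[ j < n₁ ] (adjacency G₁ i j * (F (i , s) - F (j , root)))
    divergence-locate F x = begin
      divergence H (λ y → F (locate y)) x
        ≈⟨ sum-cong-≋ (λ y → *-congʳ (coronaAdj-weight (coronaVertex G₁ G₂ x) (coronaVertex G₁ G₂ y))) ⟩
      ∑[ y < n₁ ℕ.+ n₁ ℕ.* N ] (weight (i , s) (locate y) * (F (i , s) - F (locate y)))
        ≈⟨ sum-locate (λ q → weight (i , s) q * (F (i , s) - F q)) ⟩
      ∑[ j < n₁ ] sumPlaces (λ t → weight (i , s) (j , t) * d j t)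
        ≈⟨ sum-cong-≋ split ⟩
      ∑[ j < n₁ ] (𝕀 i j * sumPlaces (inner j) + isRoot s * outer j root)
        ≈⟨ ∑-distrib-+ (λ j → 𝕀 i j * sumPlaces (inner j)) (λ j → isRoot s * outer j root) ⟩
      ∑[ j < n₁ ] (𝕀 i j * sumPlaces (inner j)) + ∑[ j < n₁ ] (isRoot s * outer j root)
        ≈⟨ +-cong (sum-𝕀 i (λ j → sumPlaces (inner j)))
                  (sym (*-distribˡ-sum (isRoot s) (λ j → outer j root))) ⟩
      sumPlaces (inner i) + isRoot s * ∑[ j < n₁ ] outer j root ∎
      where
      i = proj₁ (locate x)
      s = proj₂ (locate x)

      d inner outer : Fin n₁ → Place → Carrier
      d j t     = F (i , s) - F (j , t)
      inner j t = localAdj s t * d j t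
      outer j t = adjacency G₁ i j * d j t

      split : ∀ j → sumPlaces (λ t → weight (i , s) (j , t) * d j t) ≈
                    𝕀 i j * sumPlaces (inner j) + isRoot s * outer j root
      split j = begin
        sumPlaces (λ t → weight (i , s) (j , t) * d j t)
          ≈⟨ sumPlaces-cong (λ t → solve 6
               (λ e l x y a d → (e :* l :+ x :* (y :* a)) :* d := e :* (l :* d) :+ x :* (y :* (a :* d))) refl
               (𝕀 i j) (localAdj s t) (isRoot s) (isRoot t) (adjacency G₁ i j) (d j t)) ⟩
        sumPlaces (λ t → 𝕀 i j * inner j t + isRoot s * (isRoot t * outer j t))
          ≈⟨ sumPlaces-+ (λ t → 𝕀 i j * inner j t) (λ t → isRoot s * (isRoot t * outer j t)) ⟩
        sumPlaces (λ t → 𝕀 i j * inner j t) + sumPlaces (λ t → isRoot s * (isRoot t * outer j t))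
          ≈⟨ +-cong (sym (*-distribˡ-sumPlaces (𝕀 i j) (inner j)))
                    (trans (sym (*-distribˡ-sumPlaces (isRoot s) (λ t → isRoot t * outer j t)))
                           (*-congˡ (sumPlaces-isRoot (outer j)))) ⟩
        𝕀 i j * sumPlaces (inner j) + isRoot s * outer j root ∎

    Y : Fin n₁ × Place → Fin n₁ × Place → Carrier
    Y (i , s) (k , t) = X₁ i k + 𝕀 i k * Z s t

    δ-diag : ∀ s → δ s s ≈ 1#
    δ-diag root       = refl
    δ-diag (vertex v) = 𝕀-diag v
    δ-diag (edge e)   = 𝕀-diag e

    δ-off : ∀ {s t} → s ≢ t → δ s t ≈ 0#
    δ-off {root}     {root}     s≢t = contradiction ≡.refl s≢t
    δ-off {root}     {vertex _} s≢t = refl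
    δ-off {root}     {edge _}   s≢t = refl
    δ-off {vertex _} {root}     s≢t = refl
    δ-off {vertex _} {vertex _} s≢t = 𝕀-off (s≢t ∘ ≡.cong vertex)
    δ-off {vertex _} {edge _}   s≢t = refl
    δ-off {edge _}   {root}     s≢t = refl
    δ-off {edge _}   {vertex _} s≢t = refl
    δ-off {edge _}   {edge _}   s≢t = 𝕀-off (s≢t ∘ ≡.cong edge)

    𝕀-locate : ∀ x u → 𝕀 (proj₁ (locate x)) (proj₁ (locate u)) * δ (proj₂ (locate x)) (proj₂ (locate u)) ≈ 𝕀 x u
    𝕀-locate x u = go (x ≟ u)
      where
      go : Dec (x ≡ u) → 𝕀 (proj₁ (locate x)) (proj₁ (locate u)) * δ (proj₂ (locate x)) (proj₂ (locate u)) ≈ 𝕀 x u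
      go (yes ≡.refl) = trans (*-cong (𝕀-diag (proj₁ (locate x))) (δ-diag (proj₂ (locate x))))
                              (trans (*-identityˡ 1#) (sym (𝕀-diag x)))
      go (no  x≢u) with proj₁ (locate x) ≟ proj₁ (locate u)
      ... | no  _   = trans (zeroˡ _) (sym (𝕀-off x≢u))
      ... | yes i≡k = trans (*-congˡ (δ-off (λ s≡t → x≢u (locate-injective (≡.cong₂ _,_ i≡k s≡t)))))
                            (trans (zeroʳ _) (sym (𝕀-off x≢u)))

    -- X₁ is constant on each copy, so only Z drives current inside copies; Z vanishes at roots, so
    -- only X₁ drives current along G₁. What Z delivers at the root of its copy is exactly what X₁
    -- injects there.
    divergence-Y : ∀ u x → divergence H (λ y → Y (locate y) (locate u)) x ≈
                   𝕀 x u - isRoot (proj₂ (locate x)) * p₁ (proj₁ (locate x))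
    divergence-Y u x = begin
      divergence H (λ y → Y (locate y) (locate u)) x
        ≈⟨ divergence-locate (λ q → Y q (locate u)) x ⟩
      sumPlaces (λ t → localAdj s t * (Y (i , s) (k , t₀) - Y (i , t) (k , t₀))) +
      isRoot s * ∑[ j < n₁ ] (adjacency G₁ i j * (Y (i , s) (k , t₀) - Y (j , root) (k , t₀)))
        ≈⟨ +-cong
             (trans (sumPlaces-cong (λ t → solve 5 (λ l x e y z → l :* (x :+ e :* y :- (x :+ e :* z)) := e :* (l :* (y :- z)))
               refl
                      (localAdj s t) (X₁ i k) (𝕀 i k) (Z s t₀) (Z t t₀)))
                    (trans (sym (*-distribˡ-sumPlaces (𝕀 i k) (λ t → localAdj s t * (Z s t₀ - Z t t₀))))
                           (*-congˡ (localDivergence-Z t₀ s))))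
             (at-root s) ⟩
      𝕀 i k * (δ s t₀ - isRoot s) + isRoot s * divergence G₁ (λ j → X₁ j k) i
        ≈⟨ +-congˡ (*-congˡ (LX₁≈ k i)) ⟩
      𝕀 i k * (δ s t₀ - isRoot s) + isRoot s * (𝕀 i k - p₁ i)
        ≈⟨ solve 4 (λ e d o p → e :* (d :- o) :+ o :* (e :- p) := e :* d :- o :* p)
             refl (𝕀 i k) (δ s t₀) (isRoot s) (p₁ i) ⟩
      𝕀 i k * δ s t₀ - isRoot s * p₁ i
        ≈⟨ +-congʳ (𝕀-locate x u) ⟩
      𝕀 x u - isRoot s * p₁ i ∎
      where
      i = proj₁ (locate x)
      s = proj₂ (locate x)
      k = proj₁ (locate u)
      t₀ = proj₂ (locate u)

      at-root : ∀ s → isRoot s * ∑[ j < n₁ ] (adjacency G₁ i j * (Y (i , s) (k , t₀) - Y (j , root) (k , t₀))) ≈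
                      isRoot s * divergence G₁ (λ j → X₁ j k) i
      at-root root       = *-congˡ (sum-cong-≋ (λ j →
        solve 5 (λ a x e y f → a :* (x :+ e :* con (+ 0) :- (y :+ f :* con (+ 0))) := a :* (x :- y)) refl
          (adjacency G₁ i j) (X₁ i k) (𝕀 i k) (X₁ j k) (𝕀 j k)))
      at-root (vertex _) = trans (zeroˡ _) (sym (zeroˡ _))
      at-root (edge _)   = trans (zeroˡ _) (sym (zeroˡ _))

    trace-Y : ∑[ x < n₁ ℕ.+ n₁ ℕ.* N ] Y (locate x) (locate x) ≈
              M * tr X₁ + fromℕ n₁ * sumPlaces (λ s → Z s s)
    trace-Y = begin
      ∑[ x < n₁ ℕ.+ n₁ ℕ.* N ] Y (locate x) (locate x)
        ≈⟨ sum-locate (λ q → Y q q) ⟩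
      ∑[ i < n₁ ] sumPlaces (λ s → X₁ i i + 𝕀 i i * Z s s)
        ≈⟨ sum-cong-≋ {n₁} (λ i → trans
             (sumPlaces-cong {f = λ s → X₁ i i + 𝕀 i i * Z s s} {g = λ s → X₁ i i + Z s s}
               (λ s → +-congˡ (trans (*-congʳ (𝕀-diag i)) (*-identityˡ _))))
             (trans (sumPlaces-+ (λ _ → X₁ i i) (λ s → Z s s)) (+-congʳ (sumPlaces-const (X₁ i i))))) ⟩
      ∑[ i < n₁ ] (M * X₁ i i + sumPlaces (λ s → Z s s))
        ≈⟨ ∑-distrib-+ (λ i → M * X₁ i i) (λ _ → sumPlaces (λ s → Z s s)) ⟩
      ∑[ i < n₁ ] (M * X₁ i i) + ∑[ i < n₁ ] sumPlaces (λ s → Z s s)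
        ≈⟨ +-cong (sym (*-distribˡ-sum M (λ i → X₁ i i))) (sum-const {n₁} _) ⟩
      M * tr X₁ + fromℕ n₁ * sumPlaces (λ s → Z s s) ∎

    total-Y : ∑[ x < n₁ ℕ.+ n₁ ℕ.* N ] ∑[ u < n₁ ℕ.+ n₁ ℕ.* N ] Y (locate x) (locate u) ≈
              M * (M * ∑[ i < n₁ ] ∑[ k < n₁ ] X₁ i k) + fromℕ n₁ * sumPlaces sum-Z-column
    total-Y = begin
      ∑[ x < n₁ ℕ.+ n₁ ℕ.* N ] ∑[ u < n₁ ℕ.+ n₁ ℕ.* N ] Y (locate x) (locate u)
        ≈⟨ ∑-comm (λ x u → Y (locate x) (locate u)) ⟩
      ∑[ u < n₁ ℕ.+ n₁ ℕ.* N ] ∑[ x < n₁ ℕ.+ n₁ ℕ.* N ] Y (locate x) (locate u)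
        ≈⟨ sum-cong-≋ (λ u → column (locate u)) ⟩
      ∑[ u < n₁ ℕ.+ n₁ ℕ.* N ] (M * col (proj₁ (locate u)) + sum-Z-column (proj₂ (locate u)))
        ≈⟨ sum-locate (λ (k , t) → M * col k + sum-Z-column t) ⟩
      ∑[ k < n₁ ] sumPlaces (λ t → M * col k + sum-Z-column t)
        ≈⟨ sum-cong-≋ (λ k → trans (sumPlaces-+ (λ _ → M * col k) sum-Z-column) (+-congʳ (sumPlaces-const (M * col k)))) ⟩
      ∑[ k < n₁ ] (M * (M * col k) + sumPlaces sum-Z-column)
        ≈⟨ ∑-distrib-+ (λ k → M * (M * col k)) (λ _ → sumPlaces sum-Z-column) ⟩
      ∑[ k < n₁ ] (M * (M * col k)) + ∑[ k < n₁ ] sumPlaces sum-Z-column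
        ≈⟨ +-cong (trans (sym (*-distribˡ-sum M (λ k → M * col k)))
                         (*-congˡ (trans (sym (*-distribˡ-sum M col)) (*-congˡ (∑-comm (λ k i → X₁ i k))))))
                  (sum-const {n₁} _) ⟩
      M * (M * ∑[ i < n₁ ] ∑[ k < n₁ ] X₁ i k) + fromℕ n₁ * sumPlaces sum-Z-column ∎
      where
      col : Fin n₁ → Carrier
      col k = ∑[ i < n₁ ] X₁ i k

      column : ∀ q → ∑[ x < n₁ ℕ.+ n₁ ℕ.* N ] Y (locate x) q ≈ M * col (proj₁ q) + sum-Z-column (proj₂ q)
      column (k , t) = begin
        ∑[ x < n₁ ℕ.+ n₁ ℕ.* N ] Y (locate x) (k , t)
          ≈⟨ sum-locate (λ p → Y p (k , t)) ⟩
        ∑[ i < n₁ ] sumPlaces (λ s → X₁ i k + 𝕀 i k * Z s t)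
          ≈⟨ sum-cong-≋ (λ i → trans (sumPlaces-+ (λ _ → X₁ i k) (λ s → 𝕀 i k * Z s t))
               (+-cong (sumPlaces-const (X₁ i k)) (sym (*-distribˡ-sumPlaces (𝕀 i k) (λ s → Z s t))))) ⟩
        ∑[ i < n₁ ] (M * X₁ i k + 𝕀 i k * sum-Z-column t)
          ≈⟨ ∑-distrib-+ (λ i → M * X₁ i k) (λ i → 𝕀 i k * sum-Z-column t) ⟩
        ∑[ i < n₁ ] (M * X₁ i k) + ∑[ i < n₁ ] (𝕀 i k * sum-Z-column t)
          ≈⟨ +-cong (sym (*-distribˡ-sum M (λ i → X₁ i k))) (sum-𝕀′ k (λ _ → sum-Z-column t)) ⟩
        M * col k + sum-Z-column t ∎

    corona-kirchhoffIndex : ∀ {κ} →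
      κ ≈ fromℕ n₁ * M * (M * tr X₁ + fromℕ n₁ * sumPlaces (λ s → Z s s))
          - (M * (M * ∑[ i < n₁ ] ∑[ k < n₁ ] X₁ i k) + fromℕ n₁ * sumPlaces sum-Z-column) →
      IsKirchhoffIndex H κ
    corona-kirchhoffIndex κ≈ = kirchhoffIndex H (λ x u → Y (locate x) (locate u))
      (λ x → isRoot (proj₂ (locate x)) * p₁ (proj₁ (locate x))) divergence-Y
      (trans κ≈ (+-cong (*-cong order (sym trace-Y)) (-‿cong (sym total-Y))))
      where
      order : fromℕ n₁ * M ≈ fromℕ (n₁ ℕ.+ n₁ ℕ.* N)
      order = trans (sym (fromℕ-* n₁ (1 ℕ.+ n₂ ℕ.+ m₂))) (reflexive (≡.cong fromℕ (ℕₚ.*-suc n₁ N)))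

  -- Arithmetic of the closing formula

  -- W stands for the subtracted fraction, and the value assumed for it is n₁ times the total of Z.
  -- The index of G₁ enters as n T - s, and n M times M / n leaves the factor M² on it.
  corona-formula : ∀ {n M a m r n⁻¹ ⅓ r⁻¹ S τ T s W} →
    n⁻¹ * n ≈ 1# → W ≈ n * (a * (fromℕ 3 * r⁻¹ + 1#) + m * (fromℕ 2 * r⁻¹ + 1#)) →
    n * M * (n * m * ⅓ + n * ⅓ * (τ + r * S) + fromℕ 3 * n * S + M * n⁻¹ * (n * T - s)) - W ≈
    n * M * (M * T + n * (fromℕ 3 * S + ⅓ * (τ + r * S + m)))
      - (M * (M * s) + n * (a * (fromℕ 3 * r⁻¹ + 1#) + m * (fromℕ 2 * r⁻¹ + 1#)))
  corona-formula {n} {M} {a} {m} {r} {n⁻¹} {⅓} {r⁻¹} {S} {τ} {T} {s} {W} n⁻¹n≈1 W≈V = begin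
    n * M * (n * m * ⅓ + n * ⅓ * (τ + r * S) + fromℕ 3 * n * S + M * n⁻¹ * (n * T - s)) - W
      ≈⟨ solve 11 (λ n M m r i h S τ T s W →
           n :* M :* (n :* m :* h :+ n :* h :* (τ :+ r :* S) :+ con (+ 3) :* n :* S :+ M :* i :* (n :* T :- s)) :- W
             := n :* M :* (n :* (con (+ 3) :* S :+ h :* (τ :+ r :* S :+ m))) :+ M :* M :* (i :* n) :* (n :* T :- s) :- W)
           refl n M m r n⁻¹ ⅓ S τ T s W ⟩
    n * M * (n * (fromℕ 3 * S + ⅓ * (τ + r * S + m))) + M * M * (n⁻¹ * n) * (n * T - s) - W
      ≈⟨ +-cong (+-congˡ (*-congʳ (*-congˡ n⁻¹n≈1))) (-‿cong W≈V) ⟩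
    n * M * (n * (fromℕ 3 * S + ⅓ * (τ + r * S + m))) + M * M * 1# * (n * T - s) - V
      ≈⟨ solve 6 (λ n M Q T s V →
           n :* M :* (n :* Q) :+ M :* M :* con (+ 1) :* (n :* T :- s) :- V
             := n :* M :* (M :* T :+ n :* Q) :- (M :* (M :* s) :+ V))
           refl n M (fromℕ 3 * S + ⅓ * (τ + r * S + m)) T s V ⟩
    n * M * (M * T + n * (fromℕ 3 * S + ⅓ * (τ + r * S + m))) - (M * (M * s) + V) ∎
    where
    V = n * (a * (fromℕ 3 * r⁻¹ + 1#) + m * (fromℕ 2 * r⁻¹ + 1#))

  -- Dividing by 3 r gives n (m/3 + a r/3 + 2 a + 3 a/r). By the handshake identity 2 m = a r the
  -- second summand is 2 m/3, and one of the two a is 2 m/r.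
  total-formula : ∀ {n a m r ⅓ r⁻¹ q} →
    ⅓ * fromℕ 3 ≈ 1# → r⁻¹ * r ≈ 1# → q * (fromℕ 3 * r) ≈ 1# → fromℕ 2 * m ≈ a * r →
    (n * m * r + n * a * ((r + fromℕ 3) * (r + fromℕ 3))) * q ≈
    n * (a * (fromℕ 3 * r⁻¹ + 1#) + m * (fromℕ 2 * r⁻¹ + 1#))
  total-formula {n} {a} {m} {r} {⅓} {r⁻¹} {q} ⅓3≈1 r⁻¹r≈1 q3r≈1 2m≈ar = begin
    (n * m * r + n * a * ((r + fromℕ 3) * (r + fromℕ 3))) * q
      ≈⟨ *-congˡ q≈ ⟩
    (n * m * r + n * a * ((r + fromℕ 3) * (r + fromℕ 3))) * (⅓ * r⁻¹)
      ≈⟨ solve 6 (λ n a m r h i →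
           (n :* m :* r :+ n :* a :* ((r :+ con (+ 3)) :* (r :+ con (+ 3)))) :* (h :* i)
             := n :* (m :* h :* (i :* r) :+ (h :* (a :* r) :* (i :* r)
                  :+ (h :* con (+ 3) :* con (+ 2) :* a :* (i :* r) :+ h :* con (+ 3) :* con (+ 3) :* a :* i))))
           refl n a m r ⅓ r⁻¹ ⟩
    n * (m * ⅓ * (r⁻¹ * r) + (⅓ * (a * r) * (r⁻¹ * r)
      + (⅓ * fromℕ 3 * fromℕ 2 * a * (r⁻¹ * r) + ⅓ * fromℕ 3 * fromℕ 3 * a * r⁻¹)))
      ≈⟨ *-congˡ (+-cong (*-congˡ r⁻¹r≈1) (+-cong (*-cong (*-congˡ (sym 2m≈ar)) r⁻¹r≈1)
           (+-cong (*-cong (*-congʳ (*-congʳ ⅓3≈1)) r⁻¹r≈1) (*-congʳ (*-congʳ (*-congʳ ⅓3≈1)))))) ⟩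
    n * (m * ⅓ * 1# + (⅓ * (fromℕ 2 * m) * 1# + (1# * fromℕ 2 * a * 1# + 1# * fromℕ 3 * a * r⁻¹)))
      ≈⟨ solve 5 (λ n a m h i →
           n :* (m :* h :* con (+ 1) :+ (h :* (con (+ 2) :* m) :* con (+ 1)
                  :+ (con (+ 1) :* con (+ 2) :* a :* con (+ 1) :+ con (+ 1) :* con (+ 3) :* a :* i)))
             := n :* (m :* (h :* con (+ 3)) :+ (a :+ a :* con (+ 1) :+ con (+ 3) :* a :* i)))
           refl n a m ⅓ r⁻¹ ⟩
    n * (m * (⅓ * fromℕ 3) + (a + a * 1# + fromℕ 3 * a * r⁻¹))
      ≈⟨ *-congˡ (+-cong (*-congˡ ⅓3≈1) (+-congʳ (+-congˡ (*-congˡ (sym r⁻¹r≈1))))) ⟩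
    n * (m * 1# + (a + a * (r⁻¹ * r) + fromℕ 3 * a * r⁻¹))
      ≈⟨ solve 5 (λ n a m r i →
           n :* (m :* con (+ 1) :+ (a :+ a :* (i :* r) :+ con (+ 3) :* a :* i))
             := n :* (m :+ (a :+ i :* (a :* r) :+ con (+ 3) :* a :* i)))
           refl n a m r r⁻¹ ⟩
    n * (m + (a + r⁻¹ * (a * r) + fromℕ 3 * a * r⁻¹))
      ≈⟨ *-congˡ (+-congˡ (+-congʳ (+-congˡ (*-congˡ 2m≈ar)))) ⟨
    n * (m + (a + r⁻¹ * (fromℕ 2 * m) + fromℕ 3 * a * r⁻¹))
      ≈⟨ solve 4 (λ n a m i →
           n :* (m :+ (a :+ i :* (con (+ 2) :* m) :+ con (+ 3) :* a :* i))
             := n :* (a :* (con (+ 3) :* i :+ con (+ 1)) :+ m :* (con (+ 2) :* i :+ con (+ 1))))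
           refl n a m r⁻¹ ⟩
    n * (a * (fromℕ 3 * r⁻¹ + 1#) + m * (fromℕ 2 * r⁻¹ + 1#)) ∎
    where
    q≈ : q ≈ ⅓ * r⁻¹
    q≈ = begin
      q                                    ≈⟨ solve 1 (λ q → q := q :* con (+ 1) :* con (+ 1)) refl q ⟩
      q * 1# * 1#                          ≈⟨ *-cong (*-congˡ ⅓3≈1) r⁻¹r≈1 ⟨
      q * (⅓ * fromℕ 3) * (r⁻¹ * r)        ≈⟨ solve 4 (λ q h i r → q :* (h :* con (+ 3)) :* (i :* r) := q :* (con (+ 3) :* r) :* (h :* i))
                                                refl q ⅓ r⁻¹ r ⟩
      q * (fromℕ 3 * r) * (⅓ * r⁻¹)        ≈⟨ trans (*-congʳ q3r≈1) (*-identityˡ _) ⟩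
      ⅓ * r⁻¹                              ∎

  module Assembly {k n₂ r₂ : ℕ} .{{_ : NonZero r₂}} (G₁ : Graph (suc k)) (G₂ : Graph n₂)
                  (connected : Connected G₁) (regular : Regular G₂ r₂)
                  (μ : Fin n₂ → Carrier) (spectrum : IsSpectrumOf μ (laplacian G₂)) where

    private
      n₁ m₂ : ℕ
      n₁ = suc k
      m₂ = size G₂

    X₁ : Matrix n₁
    X₁ = groundedInverse G₁ connected

    open Corona G₁ G₂ r₂ regular X₁ (λ x → 𝕀 x zero) (divergence-groundedInverse G₁ connected)
      public

    n r n⁻¹ q T s τ Kf₁ : Carrier
    n   = fromℕ n₁
    r   = fromℕ r₂
    n⁻¹ = inverse (char0 n₁)
    q   = inverse (char0 (3 ℕ.* r₂) {{ℕₚ.m*n≢0 3 r₂}})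
    T   = tr X₁
    s   = ∑[ i < n₁ ] ∑[ k < n₁ ] X₁ i k
    τ   = tr (C⁻¹ ⊡ adjacency G₂)
    Kf₁ = n * T - s

    nz : ∀ i → μ i + r # 0#
    nz = shifted-eigenvalues-#0 spectrum r C⁻¹ det-C#0

    S : Carrier
    S = ∑[ i < n₂ ] inverse (nz i)

    S≈ : S ≈ tr C⁻¹
    S≈ = sum-inverse-eigenvalues spectrum r C⁻¹ C⁻¹⊡C det-C#0 nz

    order : m₂ ℕ.+ n₂ ℕ.+ 1 ≡ 1 ℕ.+ n₂ ℕ.+ m₂
    order = ≡.trans (ℕₚ.+-comm (m₂ ℕ.+ n₂) 1) (≡.cong suc (ℕₚ.+-comm m₂ n₂))

    numerator : fromℕ (n₁ ℕ.* m₂ ℕ.* r₂ ℕ.+ n₁ ℕ.* n₂ ℕ.* (r₂ ℕ.+ 3) ℕ.^ 2) ≈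
                n * fromℕ m₂ * r + n * fromℕ n₂ * ((r + fromℕ 3) * (r + fromℕ 3))
    numerator = begin
      fromℕ (n₁ ℕ.* m₂ ℕ.* r₂ ℕ.+ n₁ ℕ.* n₂ ℕ.* (r₂ ℕ.+ 3) ℕ.^ 2)
        ≈⟨ fromℕ-+ (n₁ ℕ.* m₂ ℕ.* r₂) (n₁ ℕ.* n₂ ℕ.* (r₂ ℕ.+ 3) ℕ.^ 2) ⟩
      fromℕ (n₁ ℕ.* m₂ ℕ.* r₂) + fromℕ (n₁ ℕ.* n₂ ℕ.* (r₂ ℕ.+ 3) ℕ.^ 2)
        ≈⟨ +-cong (trans (fromℕ-* (n₁ ℕ.* m₂) r₂) (*-congʳ (fromℕ-* n₁ m₂)))
                  (trans (fromℕ-* (n₁ ℕ.* n₂) ((r₂ ℕ.+ 3) ℕ.^ 2)) (*-cong (fromℕ-* n₁ n₂) square)) ⟩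
      n * fromℕ m₂ * r + n * fromℕ n₂ * ((r + fromℕ 3) * (r + fromℕ 3)) ∎
      where
      square : fromℕ ((r₂ ℕ.+ 3) ℕ.^ 2) ≈ (r + fromℕ 3) * (r + fromℕ 3)
      square = trans (reflexive (≡.cong (λ k → fromℕ ((r₂ ℕ.+ 3) ℕ.* k)) (ℕₚ.*-identityʳ (r₂ ℕ.+ 3))))
        (trans (fromℕ-* (r₂ ℕ.+ 3) (r₂ ℕ.+ 3)) (*-cong (fromℕ-+ r₂ 3) (fromℕ-+ r₂ 3)))

    q*3r≈1 : q * (fromℕ 3 * r) ≈ 1#
    q*3r≈1 = trans (*-congˡ (sym (fromℕ-* 3 r₂))) (inverse-* (char0 (3 ℕ.* r₂) {{ℕₚ.m*n≢0 3 r₂}}))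

    kirchhoffIndex-G₁ : IsKirchhoffIndex G₁ Kf₁
    kirchhoffIndex-G₁ = kirchhoffIndex G₁ X₁ (λ x → 𝕀 x zero) (divergence-groundedInverse G₁ connected) refl

    kirchhoffIndex-⋆ : IsKirchhoffIndex (G₁ ⋆ G₂)
      ( fromℕ (n₁ ℕ.* (1 ℕ.+ n₂ ℕ.+ m₂))
        * ( fromℕ (n₁ ℕ.* m₂) * ⅓
          + n * ⅓ * (τ + r * S)
          + fromℕ 3 * n * S
          + fromℕ (m₂ ℕ.+ n₂ ℕ.+ 1) * n⁻¹ * Kf₁)
      - fromℕ (n₁ ℕ.* m₂ ℕ.* r₂ ℕ.+ n₁ ℕ.* n₂ ℕ.* (r₂ ℕ.+ 3) ℕ.^ 2) * q)
    kirchhoffIndex-⋆ = corona-kirchhoffIndex (begin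
      fromℕ (n₁ ℕ.* (1 ℕ.+ n₂ ℕ.+ m₂))
        * ( fromℕ (n₁ ℕ.* m₂) * ⅓
          + n * ⅓ * (τ + r * S)
          + fromℕ 3 * n * S
          + fromℕ (m₂ ℕ.+ n₂ ℕ.+ 1) * n⁻¹ * Kf₁)
        - fromℕ (n₁ ℕ.* m₂ ℕ.* r₂ ℕ.+ n₁ ℕ.* n₂ ℕ.* (r₂ ℕ.+ 3) ℕ.^ 2) * q
        ≈⟨ +-cong
             (*-cong (fromℕ-* n₁ (1 ℕ.+ n₂ ℕ.+ m₂))
               (+-cong (+-cong (+-cong (*-congʳ (fromℕ-* n₁ m₂)) (*-congˡ (+-congˡ (*-congˡ S≈))))
                               (*-congˡ S≈))
                       (*-congʳ (*-congʳ (reflexive (≡.cong fromℕ order))))))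
             (-‿cong (*-congʳ numerator)) ⟩
      n * M
        * ( n * fromℕ m₂ * ⅓
          + n * ⅓ * (τ + r * tr C⁻¹)
          + fromℕ 3 * n * tr C⁻¹
          + M * n⁻¹ * Kf₁)
        - (n * fromℕ m₂ * r + n * fromℕ n₂ * ((r + fromℕ 3) * (r + fromℕ 3))) * q
        ≈⟨ corona-formula (inverse-* (char0 n₁))
             (total-formula (inverse-* (char0 3)) (inverse-* (char0 r₂)) q*3r≈1 handshake) ⟩
      n * M * (M * T + n * (fromℕ 3 * tr C⁻¹ + ⅓ * (τ + r * tr C⁻¹ + fromℕ m₂)))
        - (M * (M * s) + n * (fromℕ n₂ * (fromℕ 3 * r⁻¹ + 1#) + fromℕ m₂ * (fromℕ 2 * r⁻¹ + 1#)))
        ≈⟨ +-cong (*-congˡ (+-congˡ (*-congˡ trace-Z))) (-‿cong (+-congˡ (*-congˡ total-Z))) ⟨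
      n * M * (M * T + n * sumPlaces (λ t → Z t t)) - (M * (M * s) + n * sumPlaces sum-Z-column) ∎)

-- The inverse of C, the apartness from 0 and the index of G₁ are produced by the proof. Inverses
-- and Kirchhoff indices are unique up to `≈`, so the formula holds for any choice of them.
theorem4p3 :
  ∀ {c ℓ₁ ℓ₂} (K : HeytingField c ℓ₁ ℓ₂) (char0 : CharacteristicZero K) →
  let open Scalars K char0 in
  ∀ {n₁ n₂ r₂ : ℕ} .{{_ : NonZero n₁}} .{{_ : NonZero r₂}}
    (G₁ : Graph n₁) (G₂ : Graph n₂) →
  Connected G₁ → Regular G₂ r₂ →
  (μ : Fin n₂ → Carrier) → IsSpectrumOf μ (laplacian G₂) →
  let m₂ = size G₂
      C  = laplacian G₂ ⊞ fromℕ r₂ · 𝕀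
  in
  Σ[ C⁻¹ ∈ Matrix n₂ ] IsInverseOf C C⁻¹ ×
  (Σ[ nz ∈ (∀ i → μ i + fromℕ r₂ # 0#) ]
   ∃[ Kf₁ ] IsKirchhoffIndex G₁ Kf₁ ×
   (let S = ∑[ i < n₂ ] inverse (nz i) in
    IsKirchhoffIndex (G₁ ⋆ G₂)
      ( fromℕ (n₁ ℕ.* (1 ℕ.+ n₂ ℕ.+ m₂))
        * ( fromℕ (n₁ ℕ.* m₂) ÷ 3
          + fromℕ n₁ ÷ 3 * (tr (C⁻¹ ⊡ adjacency G₂) + fromℕ r₂ * S)
          + fromℕ 3 * fromℕ n₁ * S
          + fromℕ (m₂ ℕ.+ n₂ ℕ.+ 1) ÷ n₁ * Kf₁
          )
      - _÷_ (fromℕ (n₁ ℕ.* m₂ ℕ.* r₂ ℕ.+ n₁ ℕ.* n₂ ℕ.* (r₂ ℕ.+ 3) ℕ.^ 2))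
            (3 ℕ.* r₂) {{m*n≢0 3 r₂}}
      )))
-- Matching `n₁` with a successor provides the vertex zero at which G₁ is grounded.
theorem4p3 K char0 {ℕ.suc _} G₁ G₂ connected regular μ spectrum =
  C⁻¹ , (C⊡C⁻¹ , C⁻¹⊡C) , nz , Kf₁ , kirchhoffIndex-G₁ , kirchhoffIndex-⋆
  where
  open Proof K char0
  open Assembly G₁ G₂ connected regular μ spectrum
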